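{- Let $n\ge2$, let $\theta$ be a limit ordinal with $0<\theta<\omega^\omega$, and let $\alpha$ be a nonzero limit ordinal. Then $\mathfrak T_\alpha^n$ is elementarily equivalent to $\mathfrak T_{\omega^\omega+\theta}^n$ if and only if $\alpha=\alpha_0+\theta$ for some ordinal $\alpha_0$ with $\alpha_0\equiv\omega^\omega$ and $\operatorname{cf}(\alpha_0)=\omega$.
   Context: For a nonzero limit ordinal $\alpha$, $\mathfrak T_\alpha^n=(n^{<\alpha},\subseteq,S_0,\dots,S_{n-1})$, where $n^{<\alpha}$ is the set of all functions $s:\beta\to n=\{0,\dots,n-1\}$ with $\beta<\alpha$, $\subseteq$ is the initial-segment (inclusion) order, and $S_i(s)$ is $s$ extended by one further entry $i$. For an ordinal $\alpha_0$, $\alpha_0\equiv\omega^\omega$ means that $(\alpha_0,<)$ and $(\omega^\omega,<)$ are elementarily equivalent as linear orders. $\operatorname{cf}$ denotes cofinality. -}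

module Defs where

open import Data.Empty using (⊥; ⊥-elim)
open import Data.Fin using (Fin; zero; suc)
open import Data.Irrelevant using ([_])
open import Data.List using (List; []; _∷_; _∷ʳ_)
open import Data.List.Relation.Binary.Lex.Strict as Lex using (Lex-<; halt; this; next)
open import Data.List.Relation.Binary.Pointwise using (Pointwise-≡⇒≡; ≡⇒Pointwise-≡)
open import Data.List.Relation.Unary.Linked as Linked using (Linked; []; [-]; _∷_)
open import Data.Nat using (ℕ; _≤_; _≥_; z≤n)
import Data.Nat as ℕ
open import Data.Nat.Induction using (<-wellFounded)
import Data.Nat.Properties as ℕ
open import Data.Product using (Σ-syntax; ∃; _×_; _,_; proj₁; proj₂)
open import Data.Refinement using (Refinement-syntax; _,_; value; proof; value-injective)
open import Data.Sum using (_⊎_; inj₁; inj₂)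
open import Data.Sum.Relation.Binary.LeftOrder
  using (_⊎-<_; ₁∼₂; ₁∼₁; ₂∼₂; ⊎-<-transitive; ⊎-<-wellFounded)
open import Data.Vec.Functional using (Vector) renaming (_∷_ to _∷ᵛ_)
open import Function using (_on_; _∘_)
open import Function.Bundles using (_⇔_)
open import Induction.WellFounded using (WellFounded; Acc; acc)
open import Level using (Level; _⊔_; 0ℓ) renaming (suc to lsuc)
open import Relation.Binary.Core using (Rel)
open import Relation.Binary.Definitions using (Trichotomous; tri<; tri≈; tri>)
open import Relation.Binary.Morphism.Structures using (IsOrderIsomorphism)
open import Relation.Binary.PropositionalEquality
  using (_≡_; refl; sym; trans; cong; subst; isEquivalence; resp₂)
open import Relation.Binary.Structures using (IsEquivalence; IsStrictTotalOrder)
open import Relation.Binary.Structures.Biased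
  using (IsStrictTotalOrderᶜ; isStrictTotalOrderᶜ)
import Relation.Binary.Construct.On as On
open import Relation.Nullary using (¬_; Dec; recompute)

private
  variable
    a b k : Level

-- An ordinal is presented by a well-order of that order type; equality of
-- ordinals is order isomorphism _≅_.

record Ordinal a : Set (lsuc a) where
  infix 4 _<_
  field
    Carrier            : Set a
    _<_                : Rel Carrier a
    isStrictTotalOrder : IsStrictTotalOrder _≡_ _<_
    wellFounded        : WellFounded _<_

  open IsStrictTotalOrder isStrictTotalOrder public
    using (compare; irrefl; _<?_) renaming (trans to <-trans)

  Succ : Rel Carrier a
  Succ x y = x < y × (∀ z → x < z → ¬ z < y)

open Ordinal using (Carrier)

private
  strictTotal : {A : Set a} {_<_ : Rel A b} →
                (∀ {x y z} → x < y → y < z → x < z) →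
                Trichotomous _≡_ _<_ → IsStrictTotalOrder _≡_ _<_
  strictTotal t c = isStrictTotalOrderᶜ (record
    { isEquivalence = isEquivalence ; trans = t ; compare = c })

infix 4 _≅_ _<ₒ_ _≤ₒ_

_≅_ : Ordinal a → Ordinal b → Set (a ⊔ b)
α ≅ β = ∃ λ f → IsOrderIsomorphism _≡_ _≡_ (Ordinal._<_ α) (Ordinal._<_ β) f

-- The ordinal represented by an element l, namely the set of its predecessors.

infix 8 _↓_

_↓_ : (α : Ordinal a) → Carrier α → Ordinal a
α ↓ l = record
  { Carrier            = [ x ∈ Carrier α ∣ x < l ]
  ; _<_                = _<_ on value
  ; isStrictTotalOrder = strictTotal <-trans cmp
  ; wellFounded        = On.wellFounded value wellFounded
  }
  where
  open Ordinal α hiding (Carrier)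
  cmp : Trichotomous _≡_ (_<_ on value {P = _< l})
  cmp x y with compare (value x) (value y)
  ... | tri< p q r = tri< p (q ∘ cong value) r
  ... | tri≈ p q r = tri≈ p (value-injective q) r
  ... | tri> p q r = tri> p (q ∘ cong value) r

_<ₒ_ : Ordinal a → Ordinal b → Set (a ⊔ b)
α <ₒ β = ∃ λ l → α ≅ β ↓ l

_≤ₒ_ : Ordinal a → Ordinal b → Set (a ⊔ b)
α ≤ₒ β = α <ₒ β ⊎ α ≅ β

Positive : Ordinal a → Set a
Positive α = Carrier α

-- Every β < α satisfies β + 1 < α. In particular 0 is a limit ordinal.

IsLimit : Ordinal a → Set a
IsLimit α = ∀ x → ∃ λ y → Ordinal.Succ α x y

infixl 6 _+ₒ_

_+ₒ_ : Ordinal a → Ordinal b → Ordinal (a ⊔ b)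
_+ₒ_ {a} {b} α β = record
  { Carrier            = Carrier α ⊎ Carrier β
  ; _<_                = A._<_ ⊎-< B._<_
  ; isStrictTotalOrder = strictTotal (⊎-<-transitive A.<-trans B.<-trans) cmp
  ; wellFounded        = ⊎-<-wellFounded A.wellFounded B.wellFounded
  }
  where
  module A = Ordinal α
  module B = Ordinal β
  cmp : Trichotomous _≡_ (A._<_ ⊎-< B._<_)
  cmp (inj₁ x) (inj₂ y) = tri< ₁∼₂ (λ ()) (λ ())
  cmp (inj₂ x) (inj₁ y) = tri> (λ ()) (λ ()) ₁∼₂
  cmp (inj₁ x) (inj₁ y) with A.compare x y
  ... | tri< p q r = tri< (₁∼₁ p) (λ { refl → q refl }) (λ { (₁∼₁ s) → r s })
  ... | tri≈ p q r = tri≈ (λ { (₁∼₁ s) → p s }) (cong inj₁ q) (λ { (₁∼₁ s) → r s })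
  ... | tri> p q r = tri> (λ { (₁∼₁ s) → p s }) (λ { refl → q refl }) (₁∼₁ r)
  cmp (inj₂ x) (inj₂ y) with B.compare x y
  ... | tri< p q r = tri< (₂∼₂ p) (λ { refl → q refl }) (λ { (₂∼₂ s) → r s })
  ... | tri≈ p q r = tri≈ (λ { (₂∼₂ s) → p s }) (cong inj₂ q) (λ { (₂∼₂ s) → r s })
  ... | tri> p q r = tri> (λ { (₂∼₂ s) → p s }) (λ { refl → q refl }) (₂∼₂ r)

+ₒ-isLimit : (α : Ordinal a) (β : Ordinal b) →
             IsLimit α → IsLimit β → IsLimit (α +ₒ β)
+ₒ-isLimit α β limα limβ (inj₁ x) with limα x
... | y , x<y , least = inj₁ y , ₁∼₁ x<y ,
  λ { (inj₁ z) (₁∼₁ x<z) (₁∼₁ z<y) → least z x<z z<y ; (inj₂ z) _ () }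
+ₒ-isLimit α β limα limβ (inj₂ x) with limβ x
... | y , x<y , least = inj₂ y , ₂∼₂ x<y ,
  λ { (inj₁ z) () _ ; (inj₂ z) (₂∼₂ x<z) (₂∼₂ z<y) → least z x<z z<y }

ω : Ordinal 0ℓ
ω = record
  { Carrier            = ℕ
  ; _<_                = ℕ._<_
  ; isStrictTotalOrder = ℕ.<-isStrictTotalOrder
  ; wellFounded        = <-wellFounded
  }

-- ω^ω, via Cantor normal form: the list e₁ ≥ e₂ ≥ … ≥ eₘ of natural numbers
-- stands for ω^e₁ + ω^e₂ + … + ω^eₘ. These are exactly the ordinals below
-- ω^ω, and their order is the lexicographic one.

CNF : Set
CNF = [ es ∈ List ℕ ∣ Linked _≥_ es ]

_<ˡ_ : Rel (List ℕ) 0ℓ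
_<ˡ_ = Lex-< _≡_ ℕ._<_

private
  _<ᶜ_ : Rel CNF 0ℓ
  _<ᶜ_ = _<ˡ_ on value

  <ᶜ-compare : Trichotomous _≡_ _<ᶜ_
  <ᶜ-compare x y with Lex.<-compare sym ℕ.<-cmp (value x) (value y)
  ... | tri< p q r = tri< p (q ∘ ≡⇒Pointwise-≡ ∘ cong value) r
  ... | tri≈ p q r = tri≈ p (value-injective (Pointwise-≡⇒≡ q)) r
  ... | tri> p q r = tri> p (q ∘ ≡⇒Pointwise-≡ ∘ cong value) r

  -- Desc e xs: xs is weakly decreasing with all entries at most e.
  data Desc : ℕ → List ℕ → Set where
    []  : ∀ {e} → Desc e []
    _∷_ : ∀ {e x xs} → x ≤ e → Desc x xs → Desc e (x ∷ xs)

  Decreasing : List ℕ → Set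
  Decreasing xs = ∃ λ e → Desc e xs

  _<ᵈ_ : Rel (∃ Decreasing) 0ℓ
  _<ᵈ_ = _<ˡ_ on proj₁

  AccD : List ℕ → Set
  AccD xs = ∀ {d : Decreasing xs} → Acc _<ᵈ_ (xs , d)

  acc-[] : AccD []
  acc-[] = acc λ { {[] , _} (Lex.base ()) }

  HeadAcc : ℕ → Set
  HeadAcc e = ∀ {xs} → Desc e xs → AccD (e ∷ xs)

  cons-acc : ∀ {e} → (∀ {x} → x ℕ.< e → HeadAcc x) →
             ∀ {xs} {d : Decreasing xs} → Acc _<ᵈ_ (xs , d) → AccD (e ∷ xs)
  cons-acc ih (acc rec) = acc λ
    { {[] , _}               _                 → acc-[]
    ; {y ∷ ys , _ , _ ∷ dys} (this y<e)        → ih y<e dys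
    ; {y ∷ ys , _ , _ ∷ dys} (next refl ys<xs) →
        cons-acc ih (rec {ys , y , dys} ys<xs)
    }

  desc-acc : ∀ {e} → (∀ {x} → x ℕ.< e → HeadAcc x) → ∀ {xs} → Desc e xs → AccD xs
  desc-acc ih []          = acc-[]
  desc-acc ih (x≤e ∷ dxs) with ℕ.m≤n⇒m<n∨m≡n x≤e
  ... | inj₁ x<e  = ih x<e dxs
  ... | inj₂ refl = cons-acc ih (desc-acc ih dxs {_ , dxs})

  head-acc : ∀ {e} → Acc ℕ._<_ e → HeadAcc e
  head-acc {e} (acc rec) dxs = cons-acc ih (desc-acc ih dxs {e , dxs})
    where
    ih : ∀ {x} → x ℕ.< e → HeadAcc x
    ih x<e = head-acc (rec x<e)

  linked⇒desc : ∀ {x xs} → Linked _≥_ (x ∷ xs) → Desc x xs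
  linked⇒desc [-]       = []
  linked⇒desc (y≤x ∷ l) = y≤x ∷ linked⇒desc l

  decreasing : ∀ {xs} → Linked _≥_ xs → Decreasing xs
  decreasing {[]}     _ = 0 , []
  decreasing {x ∷ xs} l = x , ℕ.≤-refl ∷ linked⇒desc l

  relevant : (x : CNF) → Linked _≥_ (value x)
  relevant (xs , [ l ]) = recompute (Linked.linked? ℕ._≥?_ xs) l

  toDecreasing : CNF → ∃ Decreasing
  toDecreasing x = value x , decreasing (relevant x)

  <ᵈ-wellFounded : WellFounded _<ᵈ_
  <ᵈ-wellFounded (xs , e , d) = desc-acc (λ {x} _ → head-acc (<-wellFounded x)) d

ω^ω : Ordinal 0ℓ
ω^ω = record
  { Carrier            = CNF
  ; _<_                = _<ˡ_ on value
  ; isStrictTotalOrder =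
      strictTotal (Lex.<-transitive isEquivalence (resp₂ ℕ._<_) ℕ.<-trans) <ᶜ-compare
  ; wellFounded        = On.wellFounded toDecreasing <ᵈ-wellFounded
  }

private
  ∷ʳ-linked : ∀ {xs} → Linked _≥_ xs → Linked _≥_ (xs ∷ʳ 0)
  ∷ʳ-linked []      = [-]
  ∷ʳ-linked [-]     = z≤n ∷ [-]
  ∷ʳ-linked (p ∷ l) = p ∷ ∷ʳ-linked l

  xs<xs∷ʳ0 : ∀ xs → xs <ˡ (xs ∷ʳ 0)
  xs<xs∷ʳ0 []       = halt
  xs<xs∷ʳ0 (x ∷ xs) = next refl (xs<xs∷ʳ0 xs)

  ∷ʳ-least : ∀ xs zs → xs <ˡ zs → ¬ zs <ˡ (xs ∷ʳ 0)
  ∷ʳ-least []       []       (Lex.base ())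
  ∷ʳ-least []       (z ∷ zs) _             (this ())
  ∷ʳ-least []       (z ∷ zs) _             (next _ (Lex.base ()))
  ∷ʳ-least (x ∷ xs) (z ∷ zs) (this x<z)    (this z<x)    = ℕ.<-asym x<z z<x
  ∷ʳ-least (x ∷ xs) (z ∷ zs) (this x<z)    (next refl _) = ℕ.<-irrefl refl x<z
  ∷ʳ-least (x ∷ xs) (z ∷ zs) (next refl _) (this z<x)    = ℕ.<-irrefl refl z<x
  ∷ʳ-least (x ∷ xs) (z ∷ zs) (next _ p)    (next _ q)    = ∷ʳ-least xs zs p q

ω^ω-isLimit : IsLimit ω^ω
ω^ω-isLimit (xs , [ l ]) =
  (xs ∷ʳ 0 , [ ∷ʳ-linked l ]) , xs<xs∷ʳ0 xs , λ z → ∷ʳ-least xs (value z)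

-- In HasCofinality, the β in the universe of α suffice: the least ordinal that
-- maps cofinally into α is at most α, hence isomorphic to α or to some α ↓ l.

IsCofinal : (β : Ordinal b) (α : Ordinal a) → (Carrier β → Carrier α) → Set (a ⊔ b)
IsCofinal β α f = ∀ y → ∃ λ x → ¬ Ordinal._<_ α (f x) y

HasCofinality : Ordinal a → Ordinal k → Set (lsuc a ⊔ k)
HasCofinality {a} α κ =
  ∃ (IsCofinal κ α) × (∀ (β : Ordinal a) → ∃ (IsCofinal β α) → κ ≤ₒ β)

record Signature : Set₁ where
  field
    FuncSym : ℕ → Set
    RelSym  : ℕ → Set

module _ (L : Signature) where
  open Signature L

  data Term (m : ℕ) : Set where
    var  : Fin m → Term m
    func : ∀ {r} → FuncSym r → Vector (Term m) r → Term m

  -- At most m free variables (de Bruijn indices). The remaining connectives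
  -- and ∀ are the usual classical abbreviations.
  data Formula (m : ℕ) : Set where
    _≐_    : Term m → Term m → Formula m
    rel    : ∀ {r} → RelSym r → Vector (Term m) r → Formula m
    not    : Formula m → Formula m
    _and_  : Formula m → Formula m → Formula m
    exists : Formula (ℕ.suc m) → Formula m

  Sentence : Set
  Sentence = Formula 0

  -- The symbol ≐ is interpreted as _≈_, so that domains may be setoids.
  record Structure a : Set (lsuc a) where
    infix 4 _≈_
    field
      Domain        : Set a
      _≈_           : Domain → Domain → Set a
      ≈-equivalence : IsEquivalence _≈_
      ⟦_⟧ᶠ          : ∀ {r} → FuncSym r → Vector Domain r → Domain
      ⟦_⟧ʳ          : ∀ {r} → RelSym r → Vector Domain r → Set a
      ⟦⟧ᶠ-cong      : ∀ {r} (f : FuncSym r) {xs ys} →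
                      (∀ i → xs i ≈ ys i) → ⟦ f ⟧ᶠ xs ≈ ⟦ f ⟧ᶠ ys
      ⟦⟧ʳ-resp      : ∀ {r} (R : RelSym r) {xs ys} →
                      (∀ i → xs i ≈ ys i) → ⟦ R ⟧ʳ xs → ⟦ R ⟧ʳ ys

module _ {L : Signature} where

  module _ (M : Structure L a) where
    open Structure M

    eval : ∀ {m} → Vector Domain m → Term L m → Domain
    eval ρ (var i)     = ρ i
    eval ρ (func f ts) = ⟦ f ⟧ᶠ λ i → eval ρ (ts i)

    Sat : ∀ {m} → Vector Domain m → Formula L m → Set a
    Sat ρ (s ≐ t)    = eval ρ s ≈ eval ρ t
    Sat ρ (rel R ts) = ⟦ R ⟧ʳ λ i → eval ρ (ts i)
    Sat ρ (not φ)    = ¬ Sat ρ φ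
    Sat ρ (φ and ψ)  = Sat ρ φ × Sat ρ ψ
    Sat ρ (exists φ) = ∃ λ d → Sat (d ∷ᵛ ρ) φ

  infix 4 _⊨_ _≡ₑ_

  _⊨_ : Structure L a → Sentence L → Set a
  M ⊨ φ = Sat M (λ ()) φ

  _≡ₑ_ : Structure L a → Structure L b → Set (a ⊔ b)
  M ≡ₑ N = ∀ φ → M ⊨ φ ⇔ N ⊨ φ

data OrderRel : ℕ → Set where
  lt : OrderRel 2

Order : Signature
Order = record { FuncSym = λ _ → ⊥ ; RelSym = OrderRel }

orderStructure : Ordinal a → Structure Order a
orderStructure α = record
  { Domain        = Carrier α
  ; _≈_           = _≡_
  ; ≈-equivalence = isEquivalence
  ; ⟦_⟧ᶠ          = λ ()
  ; ⟦_⟧ʳ          = λ { lt xs → xs zero < xs (suc zero) }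
  ; ⟦⟧ᶠ-cong      = λ ()
  ; ⟦⟧ʳ-resp      = λ { lt eq p →
      subst (_ <_) (eq (suc zero)) (subst (_< _) (eq zero) p) }
  }
  where open Ordinal α using (_<_)

data TreeFunc (n : ℕ) : ℕ → Set where
  S : Fin n → TreeFunc n 1

data TreeRel : ℕ → Set where
  ⊆ : TreeRel 2

Tree : ℕ → Signature
Tree n = record { FuncSym = TreeFunc n ; RelSym = TreeRel }

module _ (α : Ordinal a) (n : ℕ) where
  open Ordinal α hiding (Carrier)

  -- n^{<α}: a length l < α and a function from the ordinal l to n.
  Word : Set a
  Word = Σ[ l ∈ Carrier α ] (Carrier (α ↓ l) → Fin n)

  infix 4 _⊆ʷ_ _≈ʷ_

  -- Inclusion of graphs of functions.
  _⊆ʷ_ : Word → Word → Set a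
  (l , s) ⊆ʷ (m , t) = ∀ x → ∃ λ y → value x ≡ value y × s x ≡ t y

  _≈ʷ_ : Word → Word → Set a
  s ≈ʷ t = s ⊆ʷ t × t ⊆ʷ s

  -- The domain of the extended word is l + 1 = l ∪ {l}.
  extend : IsLimit α → Fin n → Word → Word
  extend lim i (l , s) = proj₁ (lim l) , s′
    where
    s′ : Carrier (α ↓ proj₁ (lim l)) → Fin n
    s′ (x , _) with compare x l
    ... | tri< x<l _ _ = s (x , [ x<l ])
    ... | tri≈ _ _ _   = i
    ... | tri> _ _ _   = i   -- impossible

  private
    ⊆ʷ-refl : ∀ s → s ⊆ʷ s
    ⊆ʷ-refl s x = x , refl , refl

    ⊆ʷ-trans : ∀ s t u → s ⊆ʷ t → t ⊆ʷ u → s ⊆ʷ u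
    ⊆ʷ-trans s t u p q x with p x
    ... | y , x≡y , sx≡ty with q y
    ...   | z , y≡z , ty≡uz = z , trans x≡y y≡z , trans sx≡ty ty≡uz

    ≈ʷ-equivalence : IsEquivalence _≈ʷ_
    ≈ʷ-equivalence = record
      { refl  = λ {s} → ⊆ʷ-refl s , ⊆ʷ-refl s
      ; sym   = λ (p , q) → q , p
      ; trans = λ {s} {t} {u} (p , q) (p′ , q′) →
          ⊆ʷ-trans s t u p p′ , ⊆ʷ-trans u t s q′ q
      }

    bound : ∀ {l} (x : Carrier (α ↓ l)) → value x < l
    bound {l} (x , [ p ]) = recompute (x <? l) p

    ⊆ʷ⇒≮ : ∀ s t → s ⊆ʷ t → ¬ proj₁ t < proj₁ s
    ⊆ʷ⇒≮ (l , s) (m , t) p m<l with p (m , [ m<l ])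
    ... | y , m≡y , _ = irrefl (sym m≡y) (bound y)

    length-≡ : ∀ s t → s ≈ʷ t → proj₁ s ≡ proj₁ t
    length-≡ s t (p , q) with compare (proj₁ s) (proj₁ t)
    ... | tri< l<m _ _ = ⊥-elim (⊆ʷ⇒≮ t s q l<m)
    ... | tri≈ _ l≡m _ = l≡m
    ... | tri> _ _ m<l = ⊥-elim (⊆ʷ⇒≮ s t p m<l)

    extend-mono : ∀ lim i s t → proj₁ s ≡ proj₁ t → s ⊆ʷ t →
                  extend lim i s ⊆ʷ extend lim i t
    extend-mono lim i (l , s) (l , t) refl p (x , x<) =
      (x , x<) , refl , agree
      where
      agree : proj₂ (extend lim i (l , s)) (x , x<) ≡ proj₂ (extend lim i (l , t)) (x , x<)
      agree with compare x l
      ... | tri≈ _ _ _ = refl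
      ... | tri> _ _ _ = refl
      ... | tri< x<l _ _ with p (x , [ x<l ])
      ...   | y , x≡y , sx≡ty = trans sx≡ty (cong t (value-injective (sym x≡y)))

    extend-cong : ∀ lim i s t → s ≈ʷ t → extend lim i s ≈ʷ extend lim i t
    extend-cong lim i s t e@(p , q) =
      extend-mono lim i s t (length-≡ s t e) p ,
      extend-mono lim i t s (sym (length-≡ s t e)) q

    ⊆ʷ-resp : ∀ s s′ t t′ → s ≈ʷ s′ → t ≈ʷ t′ → s ⊆ʷ t → s′ ⊆ʷ t′
    ⊆ʷ-resp s s′ t t′ (_ , q) (p′ , _) r =
      ⊆ʷ-trans s′ s t′ q (⊆ʷ-trans s t t′ r p′)

  𝔗 : IsLimit α → Structure (Tree n) a
  𝔗 lim = record
    { Domain        = Word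
    ; _≈_           = _≈ʷ_
    ; ≈-equivalence = ≈ʷ-equivalence
    ; ⟦_⟧ᶠ          = λ { (S i) ws → extend lim i (ws zero) }
    ; ⟦_⟧ʳ          = λ { ⊆ ws → ws zero ⊆ʷ ws (suc zero) }
    ; ⟦⟧ᶠ-cong      = λ { (S i) {ws} {ws′} e →
        extend-cong lim i (ws zero) (ws′ zero) (e zero) }
    ; ⟦⟧ʳ-resp      = λ { ⊆ {ws} {ws′} e →
        ⊆ʷ-resp (ws zero) (ws′ zero) (ws (suc zero)) (ws′ (suc zero))
          (e zero) (e (suc zero)) }
    }

{-# OPTIONS --safe #-}

module Submission where

-- A nonempty cone of the tree depends only on the remaining ordinal, so in an
-- Ehrenfeucht–Fraïssé game a position is a finite tree whose edges are words over
-- Fin n, and Duplicator only has to answer a word by an equivalent word that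
-- leaves the same remainder. The k-types of ordinal words form a finite aperiodic
-- algebra generated by letters, concatenation and ω-powers. If α₀ ≡ ω^ω and
-- cf α₀ = ω, every word of length α₀ is a concatenation of ω words each of which
-- has a factor x with x ∼ x^ω; such factors can be stretched beyond any bound, so
-- the k-types of words of length α₀ and of length ω^ω are the same.
--
-- Conversely, θ < ω^ω is characterised among ordinals by one sentence, which can
-- be evaluated at a node s on the extensions of s by zeros. So the length α₀ with
-- α = α₀ + θ, taken minimal, is definable; the theory of α₀ is interpreted in the
-- prefixes of s, and cf α₀ = ω holds iff some s of length α₀ has an unbounded set
-- of letters 1 without limit points below α₀.

open import Defs
open import Axiom.ExcludedMiddle using (ExcludedMiddle)
open import Data.Empty using (⊥-elim; ⊥; ⊥-elim-irr)
open import Data.Fin using (zero; suc; Fin)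
open import Data.List using (List; []; _∷_)
import Data.Nat as ℕ
open import Data.Nat using (ℕ; zero; suc; z≤n; s≤s; _+_)
import Data.Nat.Properties as ℕ
open import Data.Product using (∃; _×_; _,_; proj₁; proj₂; Σ-syntax; ∃₂)
open import Data.Sum using (_⊎_; inj₁; inj₂; [_,_])
open import Data.Sum.Relation.Binary.LeftOrder using (₁∼₂; ₁∼₁; ₂∼₂)
open import Data.Unit using (⊤; tt)
import Data.Unit.Polymorphic as Poly
open import Function using (id; flip; _∘_)
open import Function.Bundles using (_⇔_; mk⇔)
open import Induction.WellFounded using (Acc; acc)
open import Level using (Level; _⊔_; 0ℓ) renaming (suc to lsuc)
open import Relation.Binary.Core using (Rel)
open import Relation.Binary.Definitions using (tri<; tri≈; tri>; Trichotomous)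
open import Relation.Binary.PropositionalEquality
  using (_≡_; refl; sym; subst; trans; cong; isEquivalence)
open import Relation.Binary.Structures.Biased using (isStrictTotalOrderᶜ)
open import Relation.Nullary using (¬_; yes; no; Dec; recompute)
open import Relation.Unary using (_∪_)
open Ordinal using (Carrier)

-- Quantifying over nodes means quantifying over words, hence over sets of positions, and this could
-- make uncountable lengths visible. The branching tames it: two nodes share only a stem, so a new
-- node is compared with the old ones by choosing one point of a stem and is free afterwards. Types
-- that quantify over single positions therefore suffice, and for these types aperiodicity holds.
-- Words may contain limits of uncountable cofinality. The algebra gets no operation for them: a
-- Löwenheim-Skolem argument replaces a word that ends at such a limit by a shorter one, and the
-- same argument carries the stretching of a factor across such limits. The cofinality of α₀ itself
-- is visible because θ > 0 makes words of length α₀ into nodes, and each such node is a set of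
-- positions on which a formula can impose conditions. The factors x come from the room for x + ω^m
-- inside α₀: it yields m nested ω-powers, and with more levels than types two levels have the same
-- type. Aperiodicity turns this loop into a fixed point of the ω-power.

private variable
  a b ℓ ℓ′ : Level

-- Order lemmas for ordinals.

module Order {a} (α : Ordinal a) where
  open Ordinal α public hiding (Carrier)

  infix 4 _≤_
  _≤_ : Rel (Carrier α) a
  x ≤ y = ¬ y < x

  <⇒≤ : ∀ {x y} → x < y → x ≤ y
  <⇒≤ x<y y<x = irrefl refl (<-trans x<y y<x)

  ≤-refl : ∀ {x} → x ≤ x
  ≤-refl = irrefl refl

  ≤-reflexive : ∀ {x y} → x ≡ y → x ≤ y
  ≤-reflexive refl = ≤-refl

  <-irrefl : ∀ {x} → ¬ x < x
  <-irrefl = irrefl refl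

  ≤⇒<⊎≡ : ∀ {x y} → x ≤ y → x < y ⊎ x ≡ y
  ≤⇒<⊎≡ {x} {y} x≤y with compare x y
  ... | tri< x<y _ _ = inj₁ x<y
  ... | tri≈ _ x≡y _ = inj₂ x≡y
  ... | tri> _ _ y<x = ⊥-elim (x≤y y<x)

  <⊎≥ : ∀ x y → x < y ⊎ y ≤ x
  <⊎≥ x y with compare x y
  ... | tri< x<y _ _ = inj₁ x<y
  ... | tri≈ x≮y _ _ = inj₂ x≮y
  ... | tri> x≮y _ _ = inj₂ x≮y

  ≤-<-trans : ∀ {x y z} → x ≤ y → y < z → x < z
  ≤-<-trans x≤y y<z with ≤⇒<⊎≡ x≤y
  ... | inj₁ x<y  = <-trans x<y y<z
  ... | inj₂ refl = y<z

  <-≤-trans : ∀ {x y z} → x < y → y ≤ z → x < z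
  <-≤-trans x<y y≤z with ≤⇒<⊎≡ y≤z
  ... | inj₁ y<z  = <-trans x<y y<z
  ... | inj₂ refl = x<y

  ≤-trans : ∀ {x y z} → x ≤ y → y ≤ z → x ≤ z
  ≤-trans x≤y y≤z z<x = y≤z (<-≤-trans z<x x≤y)

  ≤-antisym : ∀ {x y} → x ≤ y → y ≤ x → x ≡ y
  ≤-antisym x≤y y≤x with ≤⇒<⊎≡ x≤y
  ... | inj₁ x<y = ⊥-elim (y≤x x<y)
  ... | inj₂ x≡y = x≡y

  Succ⇒≤ : ∀ {x y z} → Succ x y → x < z → y ≤ z
  Succ⇒≤ (_ , least) x<z z<y = least _ x<z z<y

  <Succ⇒≤ : ∀ {x y z} → Succ x y → z < y → z ≤ x
  <Succ⇒≤ (_ , least) z<y x<z = least _ x<z z<y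

  infixl 6 _∩<_ _∩>_
  _∩<_ _∩>_ : (Carrier α → Set a) → Carrier α → Carrier α → Set a
  (P ∩< x) z = P z × z < x
  (P ∩> x) z = P z × x < z

-- Ehrenfeucht-Fraïssé games on suborders and their composition.

-- EF k P Q: Duplicator survives k rounds of the Ehrenfeucht–Fraïssé game on the
-- suborders P and Q when paired points must satisfy M. A move cuts both
-- suborders in two and the game goes on in the corresponding halves.

module _ (α : Ordinal a) (β : Ordinal b) (M : Carrier α → Carrier β → Set ℓ) where
  private
    module A = Order α
    module B = Order β

  EF : ℕ → (Carrier α → Set a) → (Carrier β → Set b) → Set (a ⊔ b ⊔ ℓ)

  Reply : ℕ → (Carrier α → Set a) → (Carrier β → Set b) →
          Carrier α → Carrier β → Set (a ⊔ b ⊔ ℓ)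
  Reply k P Q x y =
    M x y × EF k (P A.∩< x) (Q B.∩< y) × EF k (P A.∩> x) (Q B.∩> y)

  EF zero    P Q = Poly.⊤
  EF (suc k) P Q =
    (∀ x → P x → ∃ λ y → Q y × Reply k P Q x y) ×
    (∀ y → Q y → ∃ λ x → P x × Reply k P Q x y)

module _ {α : Ordinal a} {β : Ordinal b} {M : Carrier α → Carrier β → Set ℓ}
         {M′ : Carrier α → Carrier β → Set ℓ′} where
  private
    module A = Order α
    module B = Order β

  -- Cuts made in a different order give predicates that are only logically equivalent, and games
  -- are moved between such predicates with this lemma. The matching condition may change too; it is
  -- compared on members only.
  EF-map : ∀ k {P P′ Q Q′} →
           (∀ {x} → P x → P′ x) → (∀ {x} → P′ x → P x) →
           (∀ {y} → Q y → Q′ y) → (∀ {y} → Q′ y → Q y) →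
           (∀ {x y} → P x → Q y → M x y → M′ x y) →
           EF α β M k P Q → EF α β M′ k P′ Q′
  EF-map zero    f f⁻ g g⁻ h _ = _
  EF-map (suc k) {P} {P′} {Q} {Q′} f f⁻ g g⁻ h (forth , back) =
    (λ x p → let y , q , r = forth x (f⁻ p) in y , g q , reply (f⁻ p) q r) ,
    (λ y q → let x , p , r = back y (g⁻ q) in x , f p , reply p (g⁻ q) r)
    where
    reply : ∀ {x y} → P x → Q y → Reply α β M k P Q x y → Reply α β M′ k P′ Q′ x y
    reply p q (m , l , r) = h p q m ,
      EF-map k (λ (u , v) → f u , v) (λ (u , v) → f⁻ u , v)
               (λ (u , v) → g u , v) (λ (u , v) → g⁻ u , v)
               (λ (u , _) (v , _) → h u v) l ,
      EF-map k (λ (u , v) → f u , v) (λ (u , v) → f⁻ u , v)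
               (λ (u , v) → g u , v) (λ (u , v) → g⁻ u , v)
               (λ (u , _) (v , _) → h u v) r

module _ {α : Ordinal a} {β : Ordinal b} {M : Carrier α → Carrier β → Set ℓ} where
  private
    module A = Order α
    module B = Order β

  EF-resp : ∀ k {P P′ Q Q′} →
            (∀ {x} → P x → P′ x) → (∀ {x} → P′ x → P x) →
            (∀ {y} → Q y → Q′ y) → (∀ {y} → Q′ y → Q y) →
            EF α β M k P Q → EF α β M k P′ Q′
  EF-resp k f f⁻ g g⁻ = EF-map k f f⁻ g g⁻ (λ _ _ m → m)

  EF-pred : ∀ k {P Q} → EF α β M (suc k) P Q → EF α β M k P Q
  EF-pred zero    _ = _
  EF-pred (suc k) (forth , back) =
    (λ x p → let y , q , m , l , r = forth x p in y , q , m , EF-pred k l , EF-pred k r) ,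
    (λ y q → let x , p , m , l , r = back y q in x , p , m , EF-pred k l , EF-pred k r)

  EF-empty : ∀ k {P Q} → (∀ {x} → ¬ P x) → (∀ {y} → ¬ Q y) → EF α β M k P Q
  EF-empty zero    _ _ = _
  EF-empty (suc k) e f = (λ x p → ⊥-elim (e p)) , (λ y q → ⊥-elim (f q))

  EF-point : ∀ k {P Q x₀ y₀} → P x₀ → Q y₀ → (∀ {x} → P x → x ≡ x₀) →
             (∀ {y} → Q y → y ≡ y₀) → M x₀ y₀ → EF α β M k P Q
  EF-point zero    _ _ _ _ _ = _
  EF-point (suc k) {P} {Q} {x₀} {y₀} p q f g m =
    (λ x px → y₀ , q , subst (λ z → Reply α β M k P Q z y₀) (sym (f px)) r) ,
    (λ y qy → x₀ , p , subst (λ z → Reply α β M k P Q x₀ z) (sym (g qy)) r)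
    where
    r : Reply α β M k P Q x₀ y₀
    r = m ,
      EF-empty k (λ (u , v) → A.irrefl (f u) v) (λ (u , v) → B.irrefl (g u) v) ,
      EF-empty k (λ (u , v) → A.irrefl (sym (f u)) v) (λ (u , v) → B.irrefl (sym (g u)) v)

  -- Duplicator copies moves along the isomorphism. Giving it as a relation `R` lets it serve
  -- unchanged for both halves after every cut.
  EF-iso : ∀ k {P Q} (R : Carrier α → Carrier β → Set ℓ′) →
           (∀ {x} → P x → ∃ λ y → Q y × R x y) →
           (∀ {y} → Q y → ∃ λ x → P x × R x y) →
           (∀ {x y x′ y′} → P x → Q y → P x′ → Q y′ → R x y → R x′ y′ → x A.< x′ → y B.< y′) →
           (∀ {x y x′ y′} → P x → Q y → P x′ → Q y′ → R x y → R x′ y′ → y B.< y′ → x A.< x′) →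
           (∀ {x y} → P x → Q y → R x y → M x y) →
           EF α β M k P Q
  EF-iso zero    R _ _ _ _ _ = _
  EF-iso (suc k) {P} {Q} R to from mono cancel match =
    (λ x p → let y , q , r = to p in y , q , reply p q r) ,
    (λ y q → let x , p , r = from q in x , p , reply p q r)
    where
    reply : ∀ {x y} → P x → Q y → R x y → Reply α β M k P Q x y
    reply p q r = match p q r ,
      EF-iso k R
        (λ (u , x<) → let y , v , s = to u in y , (v , mono u v p q s r x<) , s)
        (λ (v , y<) → let x , u , s = from v in x , (u , cancel u v p q s r y<) , s)
        (λ (p , _) (q , _) (p′ , _) (q′ , _) → mono p q p′ q′)
        (λ (p , _) (q , _) (p′ , _) (q′ , _) → cancel p q p′ q′)
        (λ (p , _) (q , _) → match p q) ,
      EF-iso k R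
        (λ (u , x<) → let y , v , s = to u in y , (v , mono p q u v r s x<) , s)
        (λ (v , y<) → let x , u , s = from v in x , (u , cancel p q u v r s y<) , s)
        (λ (p , _) (q , _) (p′ , _) (q′ , _) → mono p q p′ q′)
        (λ (p , _) (q , _) (p′ , _) (q′ , _) → cancel p q p′ q′)
        (λ (p , _) (q , _) → match p q)

  EF-sym : ∀ k {P Q} → EF α β M k P Q → EF β α (flip M) k Q P
  EF-sym zero    _ = _
  EF-sym (suc k) (forth , back) =
    (λ y q → let x , p , m , l , r = back y q in x , p , m , EF-sym k l , EF-sym k r) ,
    (λ x p → let y , q , m , l , r = forth x p in y , q , m , EF-sym k l , EF-sym k r)

  -- A move is answered in its own summand. The cut splits that summand and leaves the other one
  -- whole on one side, where it has to survive one round fewer.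
  EF-∪ : ∀ k {P₁ P₂ Q₁ Q₂} →
         (∀ {x y} → P₁ x → P₂ y → x A.< y) → (∀ {x y} → Q₁ x → Q₂ y → x B.< y) →
         EF α β M k P₁ Q₁ → EF α β M k P₂ Q₂ → EF α β M k (P₁ ∪ P₂) (Q₁ ∪ Q₂)
  EF-∪ zero _ _ _ _ = _
  EF-∪ (suc k) {P₁} {P₂} {Q₁} {Q₂} s t e₁@(f₁ , b₁) e₂@(f₂ , b₂) =
    (λ { x (inj₁ p) → let y , q , r = f₁ x p in y , inj₁ q , left p q r
       ; x (inj₂ p) → let y , q , r = f₂ x p in y , inj₂ q , right p q r }) ,
    (λ { y (inj₁ q) → let x , p , r = b₁ y q in x , inj₁ p , left p q r
       ; y (inj₂ q) → let x , p , r = b₂ y q in x , inj₂ p , right p q r })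
    where
    left : ∀ {x y} → P₁ x → Q₁ y → Reply α β M k P₁ Q₁ x y →
           Reply α β M k (P₁ ∪ P₂) (Q₁ ∪ Q₂) x y
    left p q (m , l , r) = m ,
      EF-resp k (λ (u , v) → inj₁ u , v)
                (λ { (inj₁ u , v) → u , v ; (inj₂ u , v) → ⊥-elim (A.<⇒≤ (s p u) v) })
                (λ (u , v) → inj₁ u , v)
                (λ { (inj₁ u , v) → u , v ; (inj₂ u , v) → ⊥-elim (B.<⇒≤ (t q u) v) }) l ,
      EF-resp k (λ { (inj₁ (u , v)) → inj₁ u , v ; (inj₂ u) → inj₂ u , s p u })
                (λ { (inj₁ u , v) → inj₁ (u , v) ; (inj₂ u , v) → inj₂ u })
                (λ { (inj₁ (u , v)) → inj₁ u , v ; (inj₂ u) → inj₂ u , t q u })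
                (λ { (inj₁ u , v) → inj₁ (u , v) ; (inj₂ u , v) → inj₂ u })
        (EF-∪ k (λ (u , _) → s u) (λ (u , _) → t u) r (EF-pred k e₂))

    right : ∀ {x y} → P₂ x → Q₂ y → Reply α β M k P₂ Q₂ x y →
            Reply α β M k (P₁ ∪ P₂) (Q₁ ∪ Q₂) x y
    right p q (m , l , r) = m ,
      EF-resp k (λ { (inj₂ (u , v)) → inj₂ u , v ; (inj₁ u) → inj₁ u , s u p })
                (λ { (inj₂ u , v) → inj₂ (u , v) ; (inj₁ u , v) → inj₁ u })
                (λ { (inj₂ (u , v)) → inj₂ u , v ; (inj₁ u) → inj₁ u , t u q })
                (λ { (inj₂ u , v) → inj₂ (u , v) ; (inj₁ u , v) → inj₁ u })
        (EF-∪ k (λ v (u , _) → s v u) (λ v (u , _) → t v u) (EF-pred k e₁) l) ,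
      EF-resp k (λ (u , v) → inj₂ u , v)
                (λ { (inj₂ u , v) → u , v ; (inj₁ u , v) → ⊥-elim (A.<⇒≤ (s u p) v) })
                (λ (u , v) → inj₂ u , v)
                (λ { (inj₂ u , v) → u , v ; (inj₁ u , v) → ⊥-elim (B.<⇒≤ (t u q) v) }) r

EF-trans : {α : Ordinal a} {β : Ordinal b} {γ : Ordinal ℓ} →
           ∀ {m₁ m₂ m₃} {M : Carrier α → Carrier β → Set m₁} {N : Carrier β → Carrier γ → Set m₂}
           {O : Carrier α → Carrier γ → Set m₃} →
           (∀ {x y z} → M x y → N y z → O x z) →
           ∀ k {P Q R} → EF α β M k P Q → EF β γ N k Q R → EF α γ O k P R
EF-trans t zero    _ _ = _
EF-trans t (suc k) (f₁ , b₁) (f₂ , b₂) =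
  (λ x p → let y , q , m , l , r = f₁ x p ; z , s , m′ , l′ , r′ = f₂ y q in
     z , s , t m m′ , EF-trans t k l l′ , EF-trans t k r r′) ,
  (λ z s → let y , q , m′ , l′ , r′ = b₂ z s ; x , p , m , l , r = b₁ y q in
     x , p , t m m′ , EF-trans t k l l′ , EF-trans t k r r′)

module _ {α : Ordinal a} {β : Ordinal b} {M : Carrier α → Carrier β → Set ℓ}
         (ι κ : Ordinal 0ℓ) where
  private
    module A = Order α
    module B = Order β
    module I = Order ι
    module K = Order κ

  Ordered : (Carrier ι → Carrier α → Set a) → Set a
  Ordered P = ∀ {i j x y} → i I.< j → P i x → P j y → x A.< y

  Ordered′ : (Carrier κ → Carrier β → Set b) → Set b
  Ordered′ Q = ∀ {i j x y} → i K.< j → Q i x → Q j y → x B.< y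

  -- The matching condition of the index game is equivalence of the summands. One round on the sum
  -- is one round on the indices together with one round inside the two chosen summands; the
  -- summands before and after these go on with the index game.
  EF-⋃ : ∀ k {J J′ P Q} → Ordered P → Ordered′ Q →
         EF ι κ (λ i j → EF α β M k (P i) (Q j)) k J J′ →
         EF α β M k (λ x → ∃ λ i → J i × P i x) (λ y → ∃ λ j → J′ j × Q j y)
  EF-⋃ zero    _ _ _ = _
  EF-⋃ (suc k) {J} {J′} {P} {Q} s t (forth , back) =
    (λ { x (i , ji , p) → let j , jj , m , l , r = forth i ji ; y , q , r′ = proj₁ m x p in
           y , (j , jj , q) , reply ji jj p q l r r′ }) ,
    (λ { y (j , jj , q) → let i , ji , m , l , r = back j jj ; x , p , r′ = proj₂ m y q in
           x , (i , ji , p) , reply ji jj p q l r r′ })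
    where
    E : ℕ → Carrier ι → Carrier κ → Set _
    E k i j = EF α β M k (P i) (Q j)

    weaken : ∀ {J J′} → EF ι κ (E (suc k)) k J J′ → EF ι κ (E k) k J J′
    weaken = EF-map k id id id id (λ _ _ → EF-pred k)

    reply : ∀ {x y i j} → J i → J′ j → P i x → Q j y →
            EF ι κ (E (suc k)) k (J I.∩< i) (J′ K.∩< j) →
            EF ι κ (E (suc k)) k (J I.∩> i) (J′ K.∩> j) →
            Reply α β M k (P i) (Q j) x y →
            Reply α β M k (λ x → ∃ λ i → J i × P i x) (λ y → ∃ λ j → J′ j × Q j y) x y
    reply {x} {y} {i} {j} ji jj p q l r (m , l′ , r′) = m ,
      EF-resp k
        (λ { (inj₁ (h , (jh , h<i) , u)) → (h , jh , u) , s h<i u p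
           ; (inj₂ (u , z<x)) → (i , ji , u) , z<x })
        (λ { ((h , jh , u) , z<x) → splitA h jh u z<x })
        (λ { (inj₁ (h , (jh , h<i) , u)) → (h , jh , u) , t h<i u q
           ; (inj₂ (u , z<x)) → (j , jj , u) , z<x })
        (λ { ((h , jh , u) , z<x) → splitB h jh u z<x })
        (EF-∪ k (λ { (h , (_ , h<i) , u) (v , _) → s h<i u v })
                (λ { (h , (_ , h<j) , u) (v , _) → t h<j u v })
          (EF-⋃ k s t (weaken l)) l′) ,
      EF-resp k
        (λ { (inj₂ (h , (jh , i<h) , u)) → (h , jh , u) , s i<h p u
           ; (inj₁ (u , z<x)) → (i , ji , u) , z<x })
        (λ { ((h , jh , u) , x<z) → splitA′ h jh u x<z })
        (λ { (inj₂ (h , (jh , i<h) , u)) → (h , jh , u) , t i<h q u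
           ; (inj₁ (u , z<x)) → (j , jj , u) , z<x })
        (λ { ((h , jh , u) , x<z) → splitB′ h jh u x<z })
        (EF-∪ k (λ { (v , _) (h , (_ , i<h) , u) → s i<h v u })
                (λ { (v , _) (h , (_ , j<h) , u) → t j<h v u })
          r′ (EF-⋃ k s t (weaken r)))
      where
      splitA : ∀ {z} h → J h → P h z → z A.< x →
               (∃ λ h → (J I.∩< i) h × P h z) ⊎ (P i z × z A.< x)
      splitA h jh u z<x with I.compare h i
      ... | tri< h<i _ _  = inj₁ (h , (jh , h<i) , u)
      ... | tri≈ _ refl _ = inj₂ (u , z<x)
      ... | tri> _ _ i<h  = ⊥-elim (A.<⇒≤ z<x (s i<h p u))
      splitA′ : ∀ {z} h → J h → P h z → x A.< z →
                (P i z × x A.< z) ⊎ (∃ λ h → (J I.∩> i) h × P h z)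
      splitA′ h jh u x<z with I.compare h i
      ... | tri< h<i _ _  = ⊥-elim (A.<⇒≤ x<z (s h<i u p))
      ... | tri≈ _ refl _ = inj₁ (u , x<z)
      ... | tri> _ _ i<h  = inj₂ (h , (jh , i<h) , u)
      splitB : ∀ {z} h → J′ h → Q h z → z B.< y →
               (∃ λ h → (J′ K.∩< j) h × Q h z) ⊎ (Q j z × z B.< y)
      splitB h jh u z<x with K.compare h j
      ... | tri< h<i _ _  = inj₁ (h , (jh , h<i) , u)
      ... | tri≈ _ refl _ = inj₂ (u , z<x)
      ... | tri> _ _ i<h  = ⊥-elim (B.<⇒≤ z<x (t i<h q u))
      splitB′ : ∀ {z} h → J′ h → Q h z → y B.< z →
                (Q j z × y B.< z) ⊎ (∃ λ h → (J′ K.∩> j) h × Q h z)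
      splitB′ h jh u x<z with K.compare h j
      ... | tri< h<i _ _  = ⊥-elim (B.<⇒≤ x<z (t h<i u q))
      ... | tri≈ _ refl _ = inj₁ (u , x<z)
      ... | tri> _ _ i<h  = inj₂ (h , (jh , i<h) , u)

-- Least elements, pigeonhole and Ramsey's theorem.

module Classical (em : ∀ {ℓ : Level} → ExcludedMiddle ℓ) where

  abstract
    dne : {A : Set a} → ¬ ¬ A → A
    dne {A = A} ¬¬x with em {P = A}
    ... | yes x = x
    ... | no ¬x = ⊥-elim (¬¬x ¬x)

  ¬∀⇒∃¬ : {A : Set a} {P : A → Set ℓ} → ¬ (∀ x → P x) → ∃ λ x → ¬ P x
  ¬∀⇒∃¬ ¬∀ = dne λ ¬∃ → ¬∀ λ x → dne λ ¬p → ¬∃ (x , ¬p)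

  module _ (α : Ordinal a) where
    open Order α

    abstract
      least : (P : Carrier α → Set ℓ) → ∃ P → ∃ λ x → P x × (∀ y → P y → x ≤ y)
      least P (x , p) = go x p (wellFounded x)
        where
        go : ∀ x → P x → Acc _<_ x → ∃ λ x → P x × (∀ y → P y → x ≤ y)
        go x p (acc rec) with em {P = ∃ λ y → P y × y < x}
        ... | yes (y , q , y<x) = go y q (rec y<x)
        ... | no ¬∃             = x , p , λ y q y<x → ¬∃ (y , q , y<x)

    module _ (f : ℕ → Carrier α) where

      steps⇒< : (∀ i → f i < f (suc i)) → ∀ {i j} → i ℕ.< j → f i < f j
      steps⇒< step {i} {suc j} (s≤s i≤j) with ℕ.m≤n⇒m<n∨m≡n i≤j
      ... | inj₁ i<j  = <-trans (steps⇒< step i<j) (step j)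
      ... | inj₂ refl = step j

      steps⇒≤ : (∀ i → f i ≤ f (suc i)) → ∀ {i j} → i ℕ.≤ j → f i ≤ f j
      steps⇒≤ step {i} {j} i≤j with ℕ.m≤n⇒m<n∨m≡n i≤j
      ... | inj₂ refl = ≤-refl
      steps⇒≤ step {i} {suc j} i≤j | inj₁ (s≤s i≤j′) = ≤-trans (steps⇒≤ step i≤j′) (step j)

      locate : ∀ {x} j → f 0 ≤ x → x < f j → ∃ λ i → f i ≤ x × x < f (suc i)
      locate zero f0≤x x<f0 = ⊥-elim (f0≤x x<f0)
      locate {x} (suc j) f0≤x x<fj with <⊎≥ x (f j)
      ... | inj₁ x<f = locate j f0≤x x<f
      ... | inj₂ f≤x = j , f≤x , x<fj

      locate-unique : (∀ i → f i ≤ f (suc i)) → ∀ {x} i j →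
                      f i ≤ x → x < f (suc i) → f j ≤ x → x < f (suc j) → i ≡ j
      locate-unique step i j fi≤x x<fi fj≤x x<fj with ℕ.<-cmp i j
      ... | tri≈ _ i≡j _ = i≡j
      ... | tri< i<j _ _ = ⊥-elim (≤-trans (steps⇒≤ step i<j) fj≤x x<fi)
      ... | tri> _ _ j<i = ⊥-elim (≤-trans (steps⇒≤ step j<i) fi≤x x<fj)

  bounded : ∀ {N} (f : Fin N → ℕ) → ∃ λ m → ∀ i → f i ℕ.≤ m
  bounded {zero}  f = 0 , λ ()
  bounded {suc N} f = let m , h = bounded (f ∘ suc) in
    f zero ℕ.⊔ m , λ { zero → ℕ.m≤m⊔n _ _ ; (suc i) → ℕ.≤-trans (h i) (ℕ.m≤n⊔m (f zero) m) }

  Infinite : (ℕ → Set ℓ) → Set ℓ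
  Infinite P = ∀ m → ∃ λ j → m ℕ.≤ j × P j

  Increasing : (ℕ → ℕ) → Set
  Increasing f = ∀ i → f i ℕ.< f (suc i)

  abstract
    -- If every colour stopped occurring, let `m` bound all the stages from which they are absent;
    -- the colour of `m` itself would then occur too late.
    infinite-pigeonhole : ∀ {N} (f : ℕ → Fin N) → ∃ λ d → Infinite λ j → f j ≡ d
    infinite-pigeonhole f = dne λ ¬inf →
      let m , bound = bounded (λ d → proj₁ (stop ¬inf d)) in
      proj₂ (stop ¬inf (f m)) m (bound (f m)) refl
      where
      stop : ¬ (∃ λ d → Infinite λ j → f j ≡ d) → ∀ d → ∃ λ m → ∀ j → m ℕ.≤ j → ¬ f j ≡ d
      stop ¬inf d = let m , h = ¬∀⇒∃¬ (λ inf → ¬inf (d , inf)) in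
        m , λ j m≤j e → h (j , m≤j , e)

  abstract
    enumerate : {P : ℕ → Set ℓ} → Infinite P → ∃ λ f → Increasing f × (∀ i → P (f i))
    enumerate {P = P} inf = f , (λ i → proj₁ (proj₂ (inf (suc (f i))))) , holds
      where
      f : ℕ → ℕ
      f zero    = proj₁ (inf 0)
      f (suc i) = proj₁ (inf (suc (f i)))
      holds : ∀ i → P (f i)
      holds zero    = proj₂ (proj₂ (inf 0))
      holds (suc i) = proj₂ (proj₂ (inf (suc (f i))))

  module _ {N : ℕ} (c : ℕ → ℕ → Fin N) where

    private
      thin : ∀ (g : ℕ → ℕ) → ∃ λ d → ∃ λ s → Increasing s × (∀ j → c (g 0) (g (suc (s j))) ≡ d)
      thin g = let d , inf = infinite-pigeonhole (λ j → c (g 0) (g (suc j))) in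
               d , enumerate inf

      -- Successive thinnings: `G (suc n)` lists indices of `G n` after the first whose pairs with
      -- `G n 0` all have one colour. On the diagonal of the points `G n 0` the colour of a pair
      -- depends on its first entry only, and one more pigeonhole makes it constant.
      G : ℕ → ℕ → ℕ
      G zero    j = j
      G (suc n) j = G n (suc (proj₁ (proj₂ (thin (G n))) j))

      colour : ℕ → Fin N
      colour n = proj₁ (thin (G n))

      G-inc : ∀ n → Increasing (G n)
      G-inc zero    i = ℕ.≤-refl
      G-inc (suc n) i = steps⇒< ω (G n) (G-inc n) (s≤s (proj₁ (proj₂ (proj₂ (thin (G n)))) i))

      G-range : ∀ {m n} → n ℕ.≤ m → ∀ j → ∃ λ i → G m j ≡ G n i
      G-range {m} {n} n≤m j with ℕ.m≤n⇒m<n∨m≡n n≤m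
      ... | inj₂ refl = j , refl
      G-range {suc m} n≤m j | inj₁ (s≤s n≤m′) = G-range n≤m′ _

      G-colour : ∀ {m n} → n ℕ.< m → c (G n 0) (G m 0) ≡ colour n
      G-colour {m} {n} n<m with G-range n<m 0
      ... | i , e rewrite e = proj₂ (proj₂ (proj₂ (thin (G n)))) i

      G-head : ∀ i → G i 0 ℕ.< G (suc i) 0
      G-head i = steps⇒< ω (G i) (G-inc i) (s≤s z≤n)

    abstract
      ramsey : ∃ λ f → Increasing f × ∃ λ d → ∀ {i j} → i ℕ.< j → c (f i) (f j) ≡ d
      ramsey =
        let d , inf = infinite-pigeonhole colour
            f , f-inc , h = enumerate inf
        in (λ i → G (f i) 0) ,
           (λ i → steps⇒< ω (λ i → G i 0) G-head (f-inc i)) ,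
           d , λ {i} i<j → trans (G-colour (steps⇒< ω f f-inc i<j)) (h i)

-- Coloured orders, their types and the algebra of words.

module Words (em : ∀ {ℓ : Level} → ExcludedMiddle ℓ) (n : ℕ) where

  open import Data.Fin using (combine; funToFin; finToFun; toℕ)
  open import Data.Fin.Properties using (combine-injective; finToFun-funToFin; pigeonhole; toℕ<n)
  open import Data.Nat using (_*_; _^_)
  open import Data.Nat.DivMod
    using (_%_; _/_; m≡m%n+[m/n]*n; [m+kn]%n≡m%n; [m+n]%n≡m%n; m<n⇒m%n≡m; n%n≡0; m%n<n)
  open import Data.Nat.Tactic.RingSolver using (solve-∀)
  open import Data.Product.Relation.Binary.Lex.Strict
    using (×-Lex; ×-transitive; ×-compare; ×-wellFounded)
  open import Data.Product.Relation.Binary.Pointwise.NonDependent using (≡×≡⇒≡; ≡⇒≡×≡)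
  open import Relation.Binary.Bundles using (Setoid)
  open import Relation.Binary.PropositionalEquality using (resp₂)
  import Relation.Binary.Reasoning.Setoid as SetoidReasoning
  open Classical em

  -- The suborder is a predicate on a fixed coloured order, so the segments of one word share
  -- carrier and colouring and are cut and joined by changing `on` alone.
  record Piece a : Set (lsuc a) where
    constructor piece
    field
      ord : Ordinal a
      col : Carrier ord → Fin n
      on  : Carrier ord → Set a
  open Piece public

  infix 4 _≈[_]_
  record _≈[_]_ (P : Piece a) (k : ℕ) (Q : Piece b) : Set (a ⊔ b) where
    constructor ef
    field game : EF (ord P) (ord Q) (λ x y → col P x ≡ col Q y) k (on P) (on Q)
  open _≈[_]_ public

  ≈-refl : ∀ {k} {P : Piece a} → P ≈[ k ] P
  ≈-refl {k = k} {P} = ef (EF-iso k _≡_ (λ p → _ , p , refl) (λ p → _ , p , refl)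
    (λ { _ _ _ _ refl refl x<y → x<y }) (λ { _ _ _ _ refl refl x<y → x<y }) (λ { _ _ refl → refl }))

  ≈-sym : ∀ {k} {P : Piece a} {Q : Piece b} → P ≈[ k ] Q → Q ≈[ k ] P
  ≈-sym {k = k} (ef g) = ef (EF-map k id id id id (λ _ _ → sym) (EF-sym k g))

  ≈-trans : ∀ {k} {P : Piece a} {Q : Piece b} {R : Piece ℓ} → P ≈[ k ] Q → Q ≈[ k ] R → P ≈[ k ] R
  ≈-trans {k = k} (ef g) (ef h) = ef (EF-trans trans k g h)

  ≈-pred : ∀ {k} {P : Piece a} {Q : Piece b} → P ≈[ suc k ] Q → P ≈[ k ] Q
  ≈-pred {k = k} (ef g) = ef (EF-pred k g)

  ≈-down : ∀ {k l} {P : Piece a} {Q : Piece b} → k ℕ.≤ l → P ≈[ l ] Q → P ≈[ k ] Q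
  ≈-down {k = k} {l} k≤l e with ℕ.m≤n⇒m<n∨m≡n k≤l
  ... | inj₂ refl = e
  ≈-down {k = k} {suc l} k≤l e | inj₁ (s≤s k≤l′) = ≈-down k≤l′ (≈-pred e)

  ≈-nonempty : ∀ {k} {P : Piece a} {Q : Piece b} → P ≈[ suc k ] Q → ∃ (on P) → ∃ (on Q)
  ≈-nonempty (ef (forth , _)) (x , p) = let y , q , _ = forth x p in y , q

  types : ℕ → ℕ
  types zero    = 1
  types (suc k) = 2 ^ (n * (types k * types k))

  private
    bit : {A : Set a} → Dec A → Fin 2
    bit (yes _) = suc zero
    bit (no _)  = zero

    bit≡⇒ : {A : Set a} {B : Set b} (x : Dec A) (y : Dec B) → bit x ≡ bit y → A → B
    bit≡⇒ (yes _) (yes y) _ _ = y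
    bit≡⇒ (no ¬x) _ _ x       = ⊥-elim (¬x x)

  -- The k-type of a piece is determined by the set of triples (colour of x, type
  -- below x, type above x), where the types have one rank less.
  code   : ∀ k → Piece a → Fin (types k)
  triple : ∀ k (P : Piece a) → Carrier (ord P) → Fin (n * (types k * types k))
  code zero    P = zero
  code (suc k) P = funToFin λ i → bit (em {P = ∃ λ x → on P x × triple k P x ≡ i})
  triple k P x = combine (col P x) (combine
    (code k (record P { on = on P ∩< x })) (code k (record P { on = on P ∩> x })))
    where open Order (ord P)

  code⇒≈ : ∀ k (P : Piece a) (Q : Piece b) → code k P ≡ code k Q → P ≈[ k ] Q

  triple⇒Reply : ∀ k (P : Piece a) (Q : Piece b) {x y} → triple k P x ≡ triple k Q y →
                 Reply (ord P) (ord Q) (λ x y → col P x ≡ col Q y) k (on P) (on Q) x y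

  code⇒≈ zero    P Q e = ef _
  code⇒≈ (suc k) P Q e = ef
    ( (λ x px → let y , q , e′ = half P Q e x px in
         y , q , triple⇒Reply k P Q (sym e′))
    , (λ y qy → let x , p , e′ = half Q P (sym e) y qy in
         x , p , triple⇒Reply k P Q e′))
    where
    half : ∀ {a b} (P : Piece a) (Q : Piece b) → code (suc k) P ≡ code (suc k) Q →
           ∀ x → on P x → ∃ λ y → on Q y × triple k Q y ≡ triple k P x
    half P Q e x px = bit≡⇒ em em
      (trans (sym (finToFun-funToFin _ (triple k P x)))
        (trans (cong (λ i → finToFun i (triple k P x)) e) (finToFun-funToFin _ (triple k P x))))
      (x , px , refl)

  triple⇒Reply k P Q {x} {y} e =
    let m , e′ = combine-injective (col P x) _ (col Q y) _ e
        l , r = combine-injective (code k _) _ (code k _) _ e′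
    in m , game (code⇒≈ k _ _ l) , game (code⇒≈ k _ _ r)

  seg : (α : Ordinal a) → (Carrier α → Fin n) → Carrier α → Carrier α → Piece a
  seg α f x y = piece α f (λ z → x ≤ z × z < y)
    where open Order α

  tail : (α : Ordinal a) → (Carrier α → Fin n) → Carrier α → Piece a
  tail α f x = piece α f (λ z → x ≤ z)
    where open Order α

  recolour : ∀ {k} (P : Piece a) (f : Carrier (ord P) → Fin n) → (∀ {x} → on P x → col P x ≡ f x) →
             P ≈[ k ] record P { col = f }
  recolour {k = k} P f h = ef (EF-iso k _≡_ (λ p → _ , p , refl) (λ p → _ , p , refl)
    (λ { _ _ _ _ refl refl x<y → x<y }) (λ { _ _ _ _ refl refl x<y → x<y }) (λ { p _ refl → h p }))

  join : ∀ {k} {P : Piece a} {Q : Piece b} {P₁ P₂ Q₁ Q₂} →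
         (∀ {x} → on P x → P₁ x ⊎ P₂ x) → (∀ {x} → P₁ x ⊎ P₂ x → on P x) →
         (∀ {x y} → P₁ x → P₂ y → Ordinal._<_ (ord P) x y) →
         (∀ {x} → on Q x → Q₁ x ⊎ Q₂ x) → (∀ {x} → Q₁ x ⊎ Q₂ x → on Q x) →
         (∀ {x y} → Q₁ x → Q₂ y → Ordinal._<_ (ord Q) x y) →
         record P { on = P₁ } ≈[ k ] record Q { on = Q₁ } →
         record P { on = P₂ } ≈[ k ] record Q { on = Q₂ } → P ≈[ k ] Q
  join {k = k} f f⁻ s g g⁻ t (ef e₁) (ef e₂) = ef (EF-resp k f⁻ f g⁻ g (EF-∪ k s t e₁ e₂))

  -- Representatives of the types. Each expression denotes a word of length below ω^ω; that these
  -- represent the types of all segments, even uncountable ones, is the content of `classify`.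
  data Expr : Set where
    ε      : Expr
    letter : Fin n → Expr
    _·_    : Expr → Expr → Expr
    _^ω    : Expr → Expr

  infixr 6 _·_
  infix 8 _^ω

  private
    strictTotal : {A : Set a} {_<_ : Rel A b} → (∀ {x y z} → x < y → y < z → x < z) →
                  Trichotomous _≡_ _<_ → _
    strictTotal {_<_ = _<_} t c = isStrictTotalOrderᶜ {_<_ = _<_} (record
      { isEquivalence = isEquivalence ; trans = t ; compare = c })

  𝟘 𝟙 : Ordinal 0ℓ
  𝟘 = record { Carrier = ⊥ ; _<_ = λ _ _ → ⊥ ; isStrictTotalOrder = strictTotal (λ ()) (λ ()) ; wellFounded = λ () }
  𝟙 = record { Carrier = ⊤ ; _<_ = λ _ _ → ⊥ ; isStrictTotalOrder = strictTotal (λ ()) (λ _ _ → tri≈ (λ ()) refl (λ ()))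
             ; wellFounded = λ _ → acc λ () }

  module _ (α : Ordinal a) where
    private module A = Order α

    _·ω : Ordinal a
    _·ω = record
      { Carrier            = ℕ × Carrier α
      ; _<_                = ×-Lex _≡_ ℕ._<_ A._<_
      ; isStrictTotalOrder = strictTotal
          (×-transitive {_<₂_ = A._<_} isEquivalence (resp₂ ℕ._<_) ℕ.<-trans A.<-trans) cmp
      ; wellFounded        = ×-wellFounded (Ordinal.wellFounded ω) A.wellFounded
      }
      where
      cmp : Trichotomous _≡_ (×-Lex _≡_ ℕ._<_ A._<_)
      cmp x y with ×-compare sym ℕ.<-cmp A.compare x y
      ... | tri< p q r = tri< p (q ∘ ≡⇒≡×≡) r
      ... | tri≈ p q r = tri≈ p (≡×≡⇒≡ q) r
      ... | tri> p q r = tri> p (q ∘ ≡⇒≡×≡) r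

  carrier : Expr → Ordinal 0ℓ
  carrier ε          = 𝟘
  carrier (letter _) = 𝟙
  carrier (σ · τ)    = carrier σ +ₒ carrier τ
  carrier (τ ^ω)     = carrier τ ·ω

  colour : ∀ τ → Carrier (carrier τ) → Fin n
  colour (letter i) _        = i
  colour (σ · τ)    (inj₁ x) = colour σ x
  colour (σ · τ)    (inj₂ y) = colour τ y
  colour (τ ^ω)     (_ , x)  = colour τ x

  ⟦_⟧ : Expr → Piece 0ℓ
  ⟦ τ ⟧ = piece (carrier τ) (colour τ) (λ _ → ⊤)

  infix 4 _~[_]_
  record _~[_]_ (σ : Expr) (k : ℕ) (τ : Expr) : Set where
    constructor ⟪_⟫
    field equiv : ⟦ σ ⟧ ≈[ k ] ⟦ τ ⟧
  open _~[_]_ public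

  -- Congruence and the laws of concatenation and ω-power.

  module _ {k : ℕ} where

    bijection : {P : Piece a} {Q : Piece b} (h : Carrier (ord P) → Carrier (ord Q)) →
                (∀ {x} → on P x → on Q (h x)) →
                (∀ {y} → on Q y → ∃ λ x → on P x × h x ≡ y) →
                (∀ {x y} → Ordinal._<_ (ord P) x y → Ordinal._<_ (ord Q) (h x) (h y)) →
                (∀ x → col P x ≡ col Q (h x)) → P ≈[ k ] Q
    bijection {P = P} {Q} h to from mono match = ef (EF-iso k (λ x y → h x ≡ y)
      (λ {x} p → h x , to p , refl) from
      (λ { _ _ _ _ refl refl → mono })
      (λ { {x} {_} {x′} _ _ _ _ refl refl hx<hx′ → reflect x x′ hx<hx′ })
      (λ { {x} _ _ refl → match x }))
      where
      module A = Order (ord P)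
      module B = Order (ord Q)
      reflect : ∀ x x′ → h x B.< h x′ → x A.< x′
      reflect x x′ hx<hx′ with A.compare x x′
      ... | tri< x<x′ _ _ = x<x′
      ... | tri≈ _ refl _ = ⊥-elim (B.<-irrefl hx<hx′)
      ... | tri> _ _ x′<x = ⊥-elim (B.<⇒≤ (mono x′<x) hx<hx′)

    inj₁-≈ : ∀ σ τ → ⟦ σ ⟧ ≈[ k ] piece (carrier (σ · τ)) (colour (σ · τ)) (λ z → ∃ λ x → z ≡ inj₁ x)
    inj₁-≈ σ τ = bijection inj₁ (λ {x} _ → x , refl) (λ { (x , refl) → x , tt , refl }) ₁∼₁ (λ _ → refl)

    inj₂-≈ : ∀ σ τ → ⟦ τ ⟧ ≈[ k ] piece (carrier (σ · τ)) (colour (σ · τ)) (λ z → ∃ λ x → z ≡ inj₂ x)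
    inj₂-≈ σ τ = bijection inj₂ (λ {x} _ → x , refl) (λ { (x , refl) → x , tt , refl }) ₂∼₂ (λ _ → refl)

    block-≈ : ∀ τ i → ⟦ τ ⟧ ≈[ k ] piece (carrier (τ ^ω)) (colour (τ ^ω)) (λ z → proj₁ z ≡ i)
    block-≈ τ i = bijection (i ,_) (λ _ → refl) (λ { {_ , x} refl → x , tt , refl }) (λ x<y → inj₂ (refl , x<y)) (λ _ → refl)

    join-· : ∀ σ τ {P : Piece a} {P₁ P₂} →
             (∀ {x} → on P x → P₁ x ⊎ P₂ x) → (∀ {x} → P₁ x ⊎ P₂ x → on P x) →
             (∀ {x y} → P₁ x → P₂ y → Ordinal._<_ (ord P) x y) →
             record P { on = P₁ } ≈[ k ] ⟦ σ ⟧ → record P { on = P₂ } ≈[ k ] ⟦ τ ⟧ → P ≈[ k ] ⟦ σ · τ ⟧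
    join-· σ τ f f⁻ s e₁ e₂ = join {Q = ⟦ σ · τ ⟧} f f⁻ s
      (λ { {inj₁ x} _ → inj₁ (x , refl) ; {inj₂ y} _ → inj₂ (y , refl) }) (λ _ → tt)
      (λ { (_ , refl) (_ , refl) → ₁∼₂ }) (≈-trans e₁ (inj₁-≈ σ τ)) (≈-trans e₂ (inj₂-≈ σ τ))

    ·-cong : ∀ {σ σ′ τ τ′} → σ ~[ k ] σ′ → τ ~[ k ] τ′ → (σ · τ) ~[ k ] (σ′ · τ′)
    ·-cong {σ} {σ′} {τ} {τ′} ⟪ e₁ ⟫ ⟪ e₂ ⟫ = ⟪ join-· σ′ τ′ {P = ⟦ σ · τ ⟧}
      (λ { {inj₁ x} _ → inj₁ (x , refl) ; {inj₂ y} _ → inj₂ (y , refl) }) (λ _ → tt)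
      (λ { (_ , refl) (_ , refl) → ₁∼₂ })
      (≈-trans (≈-sym (inj₁-≈ σ τ)) e₁) (≈-trans (≈-sym (inj₂-≈ σ τ)) e₂) ⟫

    join-ω : {P : Piece a} {Q : Piece b} {P′ : ℕ → Carrier (ord P) → Set a} {Q′ : ℕ → Carrier (ord Q) → Set b} →
             (∀ {x} → on P x → ∃ λ i → P′ i x) → (∀ {x i} → P′ i x → on P x) →
             (∀ {i j x y} → i ℕ.< j → P′ i x → P′ j y → Ordinal._<_ (ord P) x y) →
             (∀ {x} → on Q x → ∃ λ i → Q′ i x) → (∀ {x i} → Q′ i x → on Q x) →
             (∀ {i j x y} → i ℕ.< j → Q′ i x → Q′ j y → Ordinal._<_ (ord Q) x y) →
             (∀ i → record P { on = P′ i } ≈[ k ] record Q { on = Q′ i }) → P ≈[ k ] Q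
    join-ω f f⁻ s g g⁻ t e = ef (EF-resp k (λ (i , _ , p) → f⁻ p) (λ p → let i , p′ = f p in i , tt , p′)
                                            (λ (i , _ , p) → g⁻ p) (λ p → let i , p′ = g p in i , tt , p′)
      (EF-⋃ ω ω k {J = λ _ → ⊤} {J′ = λ _ → ⊤} s t
        (EF-iso k _≡_ (λ _ → _ , tt , refl) (λ _ → _ , tt , refl)
          (λ { _ _ _ _ refl refl x → x }) (λ { _ _ _ _ refl refl x → x })
          (λ { {i} _ _ refl → game (e i) }))))

    join-^ω : ∀ τ {P : Piece a} {P′ : ℕ → Carrier (ord P) → Set a} →
              (∀ {x} → on P x → ∃ λ i → P′ i x) → (∀ {x i} → P′ i x → on P x) →
              (∀ {i j x y} → i ℕ.< j → P′ i x → P′ j y → Ordinal._<_ (ord P) x y) →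
              (∀ i → record P { on = P′ i } ≈[ k ] ⟦ τ ⟧) → P ≈[ k ] ⟦ τ ^ω ⟧
    join-^ω τ f f⁻ s e = join-ω {Q = ⟦ τ ^ω ⟧} f f⁻ s (λ {x} _ → proj₁ x , refl) (λ _ → tt)
      (λ { i<j refl refl → inj₁ i<j }) (λ i → ≈-trans (e i) (block-≈ τ i))

    ω-cong : ∀ {σ τ} → σ ~[ k ] τ → (σ ^ω) ~[ k ] (τ ^ω)
    ω-cong {σ} {τ} ⟪ e ⟫ = ⟪ join-^ω τ {P = ⟦ σ ^ω ⟧} (λ {x} _ → proj₁ x , refl) (λ _ → tt)
      (λ { i<j refl refl → inj₁ i<j }) (λ i → ≈-trans (≈-sym (block-≈ σ i)) e) ⟫

    ·-assoc : ∀ ρ σ τ → ((ρ · σ) · τ) ~[ k ] (ρ · (σ · τ))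
    ·-assoc ρ σ τ = ⟪ bijection h (λ _ → tt) (λ {y} _ → let x , e = h⁻ y in x , tt , e) mono match ⟫
      where
      h : _ → _
      h (inj₁ (inj₁ x)) = inj₁ x
      h (inj₁ (inj₂ x)) = inj₂ (inj₁ x)
      h (inj₂ x)        = inj₂ (inj₂ x)
      h⁻ : ∀ y → ∃ λ x → h x ≡ y
      h⁻ (inj₁ x)        = inj₁ (inj₁ x) , refl
      h⁻ (inj₂ (inj₁ x)) = inj₁ (inj₂ x) , refl
      h⁻ (inj₂ (inj₂ x)) = inj₂ x , refl
      mono : ∀ {x y} → Ordinal._<_ (carrier ((ρ · σ) · τ)) x y → Ordinal._<_ (carrier (ρ · (σ · τ))) (h x) (h y)
      mono (₁∼₁ (₁∼₁ r)) = ₁∼₁ r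
      mono (₁∼₁ (₂∼₂ r)) = ₂∼₂ (₁∼₁ r)
      mono (₁∼₁ ₁∼₂)     = ₁∼₂
      mono (₂∼₂ r)       = ₂∼₂ (₂∼₂ r)
      mono {inj₁ (inj₁ _)} ₁∼₂ = ₁∼₂
      mono {inj₁ (inj₂ _)} ₁∼₂ = ₂∼₂ ₁∼₂
      match : ∀ x → colour ((ρ · σ) · τ) x ≡ colour (ρ · (σ · τ)) (h x)
      match (inj₁ (inj₁ x)) = refl
      match (inj₁ (inj₂ x)) = refl
      match (inj₂ x)        = refl

    ·-identityˡ : ∀ τ → (ε · τ) ~[ k ] τ
    ·-identityˡ τ = ⟪ ≈-sym (bijection inj₂ (λ _ → tt) (λ { {inj₂ y} _ → y , tt , refl }) ₂∼₂ (λ _ → refl)) ⟫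

    ·-identityʳ : ∀ τ → (τ · ε) ~[ k ] τ
    ·-identityʳ τ = ⟪ ≈-sym (bijection inj₁ (λ _ → tt) (λ { {inj₁ y} _ → y , tt , refl }) ₁∼₁ (λ _ → refl)) ⟫

    ω-unfold : ∀ τ → (τ ^ω) ~[ k ] (τ · τ ^ω)
    ω-unfold τ = ⟪ bijection h (λ _ → tt) (λ {y} _ → let x , e = h⁻ y in x , tt , e) mono match ⟫
      where
      h : _ → _
      h (zero , x)  = inj₁ x
      h (suc i , x) = inj₂ (i , x)
      h⁻ : ∀ y → ∃ λ x → h x ≡ y
      h⁻ (inj₁ x)       = (0 , x) , refl
      h⁻ (inj₂ (i , x)) = (suc i , x) , refl
      mono : ∀ {x y} → Ordinal._<_ (carrier (τ ^ω)) x y → Ordinal._<_ (carrier (τ · τ ^ω)) (h x) (h y)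
      mono {zero , _}  {suc _ , _} (inj₁ _)         = ₁∼₂
      mono {suc _ , _} {suc _ , _} (inj₁ (s≤s i<j)) = ₂∼₂ (inj₁ i<j)
      mono {zero , _}  {zero , _}  (inj₂ (_ , r))   = ₁∼₁ r
      mono {suc _ , _} {suc _ , _} (inj₂ (refl , r)) = ₂∼₂ (inj₂ (refl , r))
      match : ∀ x → colour (τ ^ω) x ≡ colour (τ · τ ^ω) (h x)
      match (zero , _)  = refl
      match (suc _ , _) = refl

    -- Both sides are the word σ τ σ τ ... with the brackets moved: the copy of `σ` in block `suc i`
    -- becomes the second half of block `i`.
    ω-rotate : ∀ σ τ → ((σ · τ) ^ω) ~[ k ] (σ · (τ · σ) ^ω)
    ω-rotate σ τ = ⟪ bijection h (λ _ → tt) (λ {y} _ → let x , e = h⁻ y in x , tt , e) mono match ⟫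
      where
      h : _ → _
      h (i , inj₂ x)     = inj₂ (i , inj₁ x)
      h (zero , inj₁ x)  = inj₁ x
      h (suc i , inj₁ x) = inj₂ (i , inj₂ x)
      h⁻ : ∀ y → ∃ λ x → h x ≡ y
      h⁻ (inj₁ x)            = (0 , inj₁ x) , refl
      h⁻ (inj₂ (i , inj₁ x)) = (i , inj₂ x) , refl
      h⁻ (inj₂ (i , inj₂ x)) = (suc i , inj₁ x) , refl
      mono : ∀ {x y} → Ordinal._<_ (carrier ((σ · τ) ^ω)) x y →
             Ordinal._<_ (carrier (σ · (τ · σ) ^ω)) (h x) (h y)
      mono {zero , inj₁ _}  {suc _ , inj₁ _} (inj₁ _)          = ₁∼₂
      mono {zero , inj₁ _}  {suc _ , inj₂ _} (inj₁ _)          = ₁∼₂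
      mono {suc _ , inj₁ _} {suc _ , inj₁ _} (inj₁ (s≤s i<j))  = ₂∼₂ (inj₁ i<j)
      mono {suc _ , inj₁ _} {suc _ , inj₂ _} (inj₁ i<j)        = ₂∼₂ (inj₁ (ℕ.<⇒≤ i<j))
      mono {i , inj₂ _} {suc j , inj₁ _} (inj₁ (s≤s i≤j)) with ℕ.m≤n⇒m<n∨m≡n i≤j
      ... | inj₁ i<j  = ₂∼₂ (inj₁ i<j)
      ... | inj₂ refl = ₂∼₂ (inj₂ (refl , ₁∼₂))
      mono {zero , inj₂ _} {suc _ , inj₂ _} (inj₁ i<j)         = ₂∼₂ (inj₁ i<j)
      mono {suc _ , inj₂ _} {suc _ , inj₂ _} (inj₁ i<j)        = ₂∼₂ (inj₁ i<j)
      mono {zero , inj₁ _}  {zero , inj₁ _}  (inj₂ (_ , ₁∼₁ r)) = ₁∼₁ r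
      mono {suc _ , inj₁ _} {suc _ , inj₁ _} (inj₂ (refl , ₁∼₁ r)) = ₂∼₂ (inj₂ (refl , ₂∼₂ r))
      mono {zero , inj₁ _}  {zero , inj₂ _}  (inj₂ (_ , ₁∼₂))  = ₁∼₂
      mono {suc _ , inj₁ _} {suc _ , inj₂ _} (inj₂ (refl , ₁∼₂)) = ₂∼₂ (inj₁ ℕ.≤-refl)
      mono {i , inj₂ _} {i , inj₂ _} (inj₂ (refl , ₂∼₂ r))     = ₂∼₂ (inj₂ (refl , ₁∼₁ r))
      match : ∀ x → colour ((σ · τ) ^ω) x ≡ colour (σ · (τ · σ) ^ω) (h x)
      match (zero , inj₁ _)  = refl
      match (suc _ , inj₁ _) = refl
      match (zero , inj₂ _)  = refl
      match (suc _ , inj₂ _) = refl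

  -- This is 2^k - 1: finite linear orders with at least that many points cannot be told apart in
  -- `k` rounds. A move in at least 2t + 1 points leaves at least t points on one of its sides.
  threshold : ℕ → ℕ
  threshold zero    = 0
  threshold (suc k) = suc (threshold k + threshold k)

  Close : ℕ → ℕ → ℕ → Set
  Close k l m = l ≡ m ⊎ (threshold k ℕ.≤ l × threshold k ℕ.≤ m)

  Close-sym : ∀ {k l m} → Close k l m → Close k m l
  Close-sym (inj₁ e)       = inj₁ (sym e)
  Close-sym (inj₂ (p , q)) = inj₂ (q , p)

  -- A side shorter than the threshold is copied exactly, and then the other side is above the
  -- threshold in both orders. If both sides are long, the reply leaves exactly the threshold to its
  -- left.
  Close-split : ∀ k {m} u v → Close (suc k) (u + suc v) m →
                ∃₂ λ u′ v′ → m ≡ u′ + suc v′ × Close k u u′ × Close k v v′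
  Close-split k u v (inj₁ refl) = u , v , refl , inj₁ refl , inj₁ refl
  Close-split k {m} u v (inj₂ (p , q)) with ℕ.m≤n⇒∃[o]m+o≡n q
  ... | o , refl with ℕ.<-≤-connex u (threshold k)
  ...   | inj₁ u<t = u , t ℕ.∸ u + o + t , eq , inj₁ refl ,
          inj₂ (t≤v , ℕ.m≤n+m t (t ℕ.∸ u + o))
    where
    t = threshold k
    t≤v : t ℕ.≤ v
    t≤v = ℕ.+-cancelˡ-≤ t _ _ (ℕ.≤-trans (ℕ.s≤s⁻¹ (ℕ.≤-trans p (ℕ.≤-reflexive (ℕ.+-suc u v))))
                                             (ℕ.+-monoˡ-≤ v (ℕ.<⇒≤ u<t)))
    eq : suc (t + t + o) ≡ u + suc (t ℕ.∸ u + o + t)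
    eq = trans (cong suc (trans (ℕ.+-assoc t t o) (trans (cong (t +_) (ℕ.+-comm t o))
           (trans (cong (_+ (o + t)) (sym (ℕ.m+[n∸m]≡n (ℕ.<⇒≤ u<t))))
             (trans (ℕ.+-assoc u _ _) (cong (u +_) (sym (ℕ.+-assoc (t ℕ.∸ u) o t)))))))) (sym (ℕ.+-suc u _))
  ...   | inj₂ t≤u with ℕ.<-≤-connex v (threshold k)
  ...     | inj₂ t≤v = threshold k , threshold k + o , eq , inj₂ (t≤u , ℕ.≤-refl) , inj₂ (t≤v , ℕ.m≤m+n _ o)
    where
    eq : suc (threshold k + threshold k + o) ≡ threshold k + suc (threshold k + o)
    eq = trans (cong suc (ℕ.+-assoc (threshold k) _ o)) (sym (ℕ.+-suc _ _))
  ...     | inj₁ v<t = (t ℕ.∸ v + o + t) , v , eq , inj₂ (t≤u , ℕ.m≤n+m t (t ℕ.∸ v + o)) , inj₁ refl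
    where
    t = threshold k
    eq : suc (t + t + o) ≡ t ℕ.∸ v + o + t + suc v
    eq = trans (cong suc (trans (cong (_+ o) (cong (t +_) (sym (ℕ.m∸n+n≡m (ℕ.<⇒≤ v<t))))) (rearrange t (t ℕ.∸ v) v o)))
           (sym (ℕ.+-suc _ v))
      where
      rearrange : ∀ t w v o → t + (w + v) + o ≡ w + o + t + v
      rearrange = solve-∀

  private module W = Order ω

  interval : ℕ → ℕ → ℕ → Set
  interval x l i = x ℕ.≤ i × i ℕ.< x + l

  module _ {c} {M : ℕ → ℕ → Set c} (match : ∀ i j → M i j) where

    private
      split : ∀ {x l i} → interval x l i → ∃₂ λ u v → l ≡ u + suc v × i ≡ x + u
      split {x} {l} {i} (x≤i , i<) with ℕ.m≤n⇒∃[o]m+o≡n x≤i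
      ... | u , refl with ℕ.m≤n⇒∃[o]m+o≡n (ℕ.+-cancelˡ-< x u l i<)
      ...   | v , e = u , v , trans (sym e) (sym (ℕ.+-suc u v)) , refl

      cut-< : ∀ x u v {i} → (interval x (u + suc v) W.∩< (x + u)) i → interval x u i
      cut-< x u v ((x≤i , _) , i<) = x≤i , i<
      cut-<⁻ : ∀ x u v {i} → interval x u i → (interval x (u + suc v) W.∩< (x + u)) i
      cut-<⁻ x u v (x≤i , i<) = (x≤i , ℕ.<-≤-trans i< (ℕ.+-monoʳ-≤ x (ℕ.m≤m+n u (suc v)))) , i<
      shift : ∀ x u v → x + (u + suc v) ≡ suc (x + u) + v
      shift x u v = trans (sym (ℕ.+-assoc x u (suc v))) (ℕ.+-suc (x + u) v)
      cut-> : ∀ x u v {i} → (interval x (u + suc v) W.∩> (x + u)) i → interval (suc (x + u)) v i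
      cut-> x u v ((_ , i<) , <i) = <i , ℕ.<-≤-trans i< (ℕ.≤-reflexive (shift x u v))
      cut->⁻ : ∀ x u v {i} → interval (suc (x + u)) v i → (interval x (u + suc v) W.∩> (x + u)) i
      cut->⁻ x u v (<i , i<) = (ℕ.≤-trans (ℕ.m≤m+n x u) (ℕ.<⇒≤ <i) , ℕ.<-≤-trans i< (ℕ.≤-reflexive (sym (shift x u v)))) , <i
      inside : ∀ x u v → interval x (u + suc v) (x + u)
      inside x u v = ℕ.m≤m+n x u , ℕ.+-monoʳ-< x (ℕ.m<m+n u (s≤s z≤n))

    EF-interval : ∀ k x y {l m} → Close k l m → EF ω ω M k (interval x l) (interval y m)
    EF-interval zero x y _ = _
    EF-interval (suc k) x y {l} {m} cl = forth , back
      where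
      reply : ∀ u v u′ v′ → Close k u u′ → Close k v v′ →
              Reply ω ω M k (interval x (u + suc v)) (interval y (u′ + suc v′)) (x + u) (y + u′)
      reply u v u′ v′ c₁ c₂ = match _ _ ,
        EF-resp k (cut-<⁻ x u v) (cut-< x u v) (cut-<⁻ y u′ v′) (cut-< y u′ v′) (EF-interval k x y c₁) ,
        EF-resp k (cut->⁻ x u v) (cut-> x u v) (cut->⁻ y u′ v′) (cut-> y u′ v′) (EF-interval k _ _ c₂)
      forth : ∀ i → interval x l i → _
      forth i p with split p
      ... | u , v , refl , refl with Close-split k u v cl
      ...   | u′ , v′ , refl , c₁ , c₂ = y + u′ , inside y u′ v′ , reply u v u′ v′ c₁ c₂
      back : ∀ i → interval y m i → _
      back i p with split p
      ... | u , v , refl , refl with Close-split k u v (Close-sym {suc k} cl)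
      ...   | u′ , v′ , refl , c₁ , c₂ = x + u′ , inside x u′ v′ , reply u′ v′ u v (Close-sym {k} c₁) (Close-sym {k} c₂)

  pow : Expr → ℕ → Expr
  pow σ zero    = ε
  pow σ (suc m) = σ · pow σ m

  module _ (k : ℕ) where

    private
      copies : ∀ σ m → ⟦ pow σ m ⟧ ≈[ k ] piece (carrier (σ ^ω)) (colour (σ ^ω)) (λ z → ∃ λ i → interval 0 m i × proj₁ z ≡ i)
      copies σ m = bijection (h m) (λ {x} _ → _ , (z≤n , bound m x) , refl)
        (λ { {i , x} (_ , (_ , i<m) , refl) → let z , e = h⁻ m i x i<m in z , tt , e }) (mono m) (match m)
        where
        h : ∀ m → Carrier (carrier (pow σ m)) → ℕ × Carrier (carrier σ)
        h (suc m) (inj₁ x) = 0 , x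
        h (suc m) (inj₂ z) = let i , x = h m z in suc i , x
        bound : ∀ m z → proj₁ (h m z) ℕ.< m
        bound (suc m) (inj₁ x) = s≤s z≤n
        bound (suc m) (inj₂ z) = s≤s (bound m z)
        h⁻ : ∀ m i x → i ℕ.< m → ∃ λ z → h m z ≡ (i , x)
        h⁻ (suc m) zero    x _         = inj₁ x , refl
        h⁻ (suc m) (suc i) x (s≤s i<m) = let z , e = h⁻ m i x i<m in inj₂ z , cong (λ (i , x) → suc i , x) e
        mono : ∀ m {x y} → Ordinal._<_ (carrier (pow σ m)) x y → Ordinal._<_ (carrier (σ ^ω)) (h m x) (h m y)
        mono (suc m) ₁∼₂     = inj₁ (s≤s z≤n)
        mono (suc m) (₁∼₁ r) = inj₂ (refl , r)
        mono (suc m) (₂∼₂ r) with mono m r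
        ... | inj₁ i<j       = inj₁ (s≤s i<j)
        ... | inj₂ (e , r′)  = inj₂ (cong suc e , r′)
        match : ∀ m x → colour (pow σ m) x ≡ colour (σ ^ω) (h m x)
        match (suc m) (inj₁ x) = refl
        match (suc m) (inj₂ z) = match m z

    -- A power of `σ` is a finite sum of pairwise equivalent blocks. By `EF-⋃` it is enough to play
    -- on the indices, and these are two linear orders of at least `threshold k` points.
    aperiodic : ∀ σ → pow σ (threshold k) ~[ k ] pow σ (suc (threshold k))
    aperiodic σ = ⟪ ≈-trans (copies σ _) (≈-trans
      (ef (EF-⋃ ω ω k (λ { i<j refl refl → inj₁ i<j }) (λ { i<j refl refl → inj₁ i<j })
        (EF-interval (λ i j → game (≈-trans (≈-sym (block-≈ σ i)) (block-≈ σ j))) k 0 0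
          (inj₂ (ℕ.≤-refl , ℕ.n≤1+n _)))))
      (≈-sym (copies σ _))) ⟫

    ~-setoid : Setoid 0ℓ 0ℓ
    ~-setoid = record
      { Carrier = Expr ; _≈_ = _~[ k ]_
      ; isEquivalence = record
        { refl  = ⟪ ≈-refl ⟫
        ; sym   = λ (⟪ e ⟫) → ⟪ ≈-sym e ⟫
        ; trans = λ (⟪ e ⟫) (⟪ f ⟫) → ⟪ ≈-trans e f ⟫ } }

    open Setoid ~-setoid public using (_≈_) renaming (refl to ~-refl; sym to ~-sym; trans to ~-trans; reflexive to ~-reflexive)
    open SetoidReasoning ~-setoid

    -- Substituting the hypothesis into itself gives y ≈ p^t · y · r for every t. At the threshold
    -- one more factor `p` makes no difference by aperiodicity.
    absorb : ∀ p y q → y ≈ p · y · q → p · y ≈ y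
    absorb p y q e = let r , f = iterate (threshold k) in begin
      p · y                                ≈⟨ ·-cong ~-refl f ⟩
      p · pow p (threshold k) · y · r      ≈⟨ ·-assoc p _ _ ⟨
      pow p (suc (threshold k)) · y · r    ≈⟨ ·-cong (~-sym (aperiodic p)) ~-refl ⟩
      pow p (threshold k) · y · r          ≈⟨ f ⟨
      y                                    ∎
      where
      iterate : ∀ m → ∃ λ r → y ≈ pow p m · y · r
      iterate zero    = ε , ~-sym (~-trans (·-identityˡ _) (·-identityʳ y))
      iterate (suc m) = let r , f = iterate m in r · q , (begin
        y                             ≈⟨ e ⟩
        p · y · q                     ≈⟨ ·-cong ~-refl (·-cong f ~-refl) ⟩
        p · (pow p m · y · r) · q     ≈⟨ ·-cong ~-refl (·-assoc (pow p m) (y · r) q) ⟩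
        p · pow p m · (y · r) · q     ≈⟨ ·-cong ~-refl (·-cong ~-refl (·-assoc y r q)) ⟩
        p · pow p m · y · r · q       ≈⟨ ·-assoc p _ _ ⟨
        pow p (suc m) · y · r · q     ∎)

    module _ (e a : ℕ → Expr) (step : ∀ i → e i ≈ a i · e (suc i) ^ω)
             (d : ℕ) (periodic : ∀ i → e (suc d + i) ≡ e i) where

      private
        Y : ℕ → Expr
        Y i = e i ^ω

        Y-periodic : ∀ i → Y (suc d + i) ≡ Y i
        Y-periodic i = cong _^ω (periodic i)

        -- Unfolding Y i ≈ e i · Y i ≈ a i · Y (i+1) · Y i repeatedly collects a i · ... · a (i+j-1)
        -- to the left of Y (i+j), which is `A i j`, and Y (i+j-1) · ... · Y i to its right, which
        -- is `D i j`.
        A D : ℕ → ℕ → Expr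
        A i zero    = ε
        A i (suc j) = a i · A (suc i) j
        D i zero    = ε
        D i (suc j) = D (suc i) j · Y i

        D-left : ∀ i j → D i (suc j) ≈ Y (j + i) · D i j
        D-left i zero    = ~-trans (·-identityˡ _) (~-sym (·-identityʳ _))
        D-left i (suc j) = begin
          D (suc i) (suc j) · Y i               ≈⟨ ·-cong (D-left (suc i) j) ~-refl ⟩
          (Y (j + suc i) · D (suc i) j) · Y i   ≈⟨ ·-assoc _ _ _ ⟩
          Y (j + suc i) · D i (suc j)           ≡⟨ cong (λ m → Y m · D i (suc j)) (ℕ.+-suc j i) ⟩
          Y (suc j + i) · D i (suc j)           ∎

        Y-expand : ∀ i j → Y i ≈ A i j · Y (j + i) · D i j
        Y-expand i zero    = ~-sym (~-trans (·-identityˡ _) (·-identityʳ _))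
        Y-expand i (suc j) = begin
          Y i                                                          ≈⟨ ω-unfold (e i) ⟩
          e i · Y i                                                    ≈⟨ ·-cong (step i) ~-refl ⟩
          (a i · Y (suc i)) · Y i                                      ≈⟨ ·-assoc _ _ _ ⟩
          a i · Y (suc i) · Y i                                        ≈⟨ ·-cong ~-refl (·-cong (Y-expand (suc i) j) ~-refl) ⟩
          a i · (A (suc i) j · Y (j + suc i) · D (suc i) j) · Y i      ≈⟨ ·-cong ~-refl (·-assoc _ _ _) ⟩
          a i · A (suc i) j · (Y (j + suc i) · D (suc i) j) · Y i      ≈⟨ ·-cong ~-refl (·-cong ~-refl (·-assoc _ _ _)) ⟩
          a i · A (suc i) j · Y (j + suc i) · D i (suc j)              ≈⟨ ·-assoc _ _ _ ⟨
          A i (suc j) · Y (j + suc i) · D i (suc j)                    ≡⟨ cong (λ m → A i (suc j) · Y m · D i (suc j)) (ℕ.+-suc j i) ⟩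
          A i (suc j) · Y (suc j + i) · D i (suc j)                    ∎

        A-absorb : ∀ i → A i (suc d) · Y i ≈ Y i
        A-absorb i = absorb _ _ (D i (suc d))
          (~-trans (Y-expand i (suc d)) (·-cong ~-refl (·-cong (~-reflexive (Y-periodic i)) ~-refl)))

        e-expand : ∀ i → e i ≈ Y i · D (suc i) d
        e-expand i = begin
          e i                                                 ≈⟨ step i ⟩
          a i · Y (suc i)                                     ≈⟨ ·-cong ~-refl (Y-expand (suc i) d) ⟩
          a i · A (suc i) d · Y (d + suc i) · D (suc i) d     ≈⟨ ·-assoc _ _ _ ⟨
          A i (suc d) · Y (d + suc i) · D (suc i) d           ≡⟨ cong (λ m → A i (suc d) · Y m · D (suc i) d) (ℕ.+-suc d i) ⟩
          A i (suc d) · Y (suc d + i) · D (suc i) d           ≡⟨ cong (λ y → A i (suc d) · y · D (suc i) d) (Y-periodic i) ⟩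
          A i (suc d) · Y i · D (suc i) d                     ≈⟨ ·-assoc _ _ _ ⟨
          (A i (suc d) · Y i) · D (suc i) d                   ≈⟨ ·-cong (A-absorb i) ~-refl ⟩
          Y i · D (suc i) d                                   ∎

        e-product : ∀ i → e i ≈ D (suc i) (suc d)
        e-product i = begin
          e i                              ≈⟨ e-expand i ⟩
          Y i · D (suc i) d                ≡⟨ cong (_· D (suc i) d) (Y-periodic i) ⟨
          Y (suc d + i) · D (suc i) d      ≡⟨ cong (λ m → Y m · D (suc i) d) (ℕ.+-suc d i) ⟨
          Y (d + suc i) · D (suc i) d      ≈⟨ D-left (suc i) d ⟨
          D (suc i) (suc d)                ∎

        -- By `e-expand`, `e (suc i)` starts with Y (i+1). Rotating its ω-power moves this factor to
        -- the end of the body, and the new body is the product that `e-product` identifies with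
        -- `e i`.
        Y-absorb : ∀ i → Y (suc i) · Y i ≈ Y (suc i)
        Y-absorb i = ~-sym (begin
          Y (suc i)                                              ≈⟨ ω-cong (e-expand (suc i)) ⟩
          (Y (suc i) · D (suc (suc i)) d) ^ω                     ≈⟨ ω-rotate _ _ ⟩
          Y (suc i) · (D (suc (suc i)) d · Y (suc i)) ^ω         ≈⟨ ·-cong ~-refl (ω-cong (e-product i)) ⟨
          Y (suc i) · Y i                                        ∎)

        D-collapse : ∀ i j → D i (suc j) ≈ Y (j + i)
        D-collapse i zero    = ·-identityˡ _
        D-collapse i (suc j) = begin
          D i (suc (suc j))               ≈⟨ D-left i (suc j) ⟩
          Y (suc j + i) · D i (suc j)     ≈⟨ ·-cong ~-refl (D-collapse i j) ⟩
          Y (suc j + i) · Y (j + i)       ≈⟨ Y-absorb (j + i) ⟩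
          Y (suc j + i)                   ∎

      -- After a full period the left context `A` is absorbed, and `e i` becomes the product Y
      -- (i+d+1) · ... · Y (i+1). Each factor absorbs the one to its right, so only the leftmost
      -- remains, and by periodicity it is Y i.
      cyclic⇒ω-stable : ∀ i → e i ≈ e i ^ω
      cyclic⇒ω-stable i = begin
        e i                  ≈⟨ e-product i ⟩
        D (suc i) (suc d)    ≈⟨ D-collapse (suc i) d ⟩
        Y (d + suc i)        ≡⟨ cong Y (ℕ.+-suc d i) ⟩
        Y (suc d + i)        ≡⟨ Y-periodic i ⟩
        Y i                  ∎

    module _ (e a : ℕ → Expr) (i d : ℕ) (e≈ : e i ≈ e (i + suc d))
             (step : ∀ j → j ℕ.≤ d → e (i + j) ≈ a (i + j) · e (suc (i + j)) ^ω) where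

      private
        e′ a′ : ℕ → Expr
        e′ t = e (i + t % suc d)
        a′ t = a (i + t % suc d)

        suc-% : ∀ t → suc t % suc d ≡ suc (t % suc d) % suc d
        suc-% t = trans (cong (λ m → suc m % suc d) (m≡m%n+[m/n]*n t (suc d)))
                        ([m+kn]%n≡m%n (suc (t % suc d)) (t / suc d) (suc d))

        step′ : ∀ t → e′ t ≈ a′ t · e′ (suc t) ^ω
        step′ t with ℕ.m≤n⇒m<n∨m≡n (m%n<n t (suc d))
        ... | inj₁ t<d = ~-trans (step _ (ℕ.s≤s⁻¹ (m%n<n t (suc d)))) (~-reflexive
                (cong (λ m → a′ t · e m ^ω) (sym (trans (cong (i +_) (trans (suc-% t) (m<n⇒m%n≡m t<d))) (ℕ.+-suc i _)))))
        ... | inj₂ eq = ~-trans (step _ (ℕ.s≤s⁻¹ (m%n<n t (suc d)))) (·-cong ~-refl (ω-cong (~-trans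
                (~-reflexive (cong e (trans (sym (ℕ.+-suc i _)) (cong (i +_) eq))))
                (~-trans (~-sym e≈) (~-reflexive (cong e (sym (trans (cong (i +_)
                  (trans (suc-% t) (trans (cong (_% suc d) eq) (n%n≡0 (suc d))))) (ℕ.+-identityʳ i)))))))))

      -- Only finitely many steps are given, and their two ends agree only up to equivalence.
      -- Reading the index modulo `suc d` produces a strictly periodic sequence; `e≈` is what makes
      -- its step hold at the wrap-around.
      loop⇒ω-stable : e i ≈ e i ^ω
      loop⇒ω-stable = ~-trans (~-reflexive (cong e (sym (ℕ.+-identityʳ i))))
        (~-trans (cyclic⇒ω-stable e′ a′ step′ d periodic 0)
          (~-reflexive (cong (λ m → e m ^ω) (ℕ.+-identityʳ i))))
        where
        periodic : ∀ t → e′ (suc d + t) ≡ e′ t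
        periodic t = cong (λ m → e (i + m)) (trans (cong (_% suc d) (ℕ.+-comm (suc d) t)) ([m+n]%n≡m%n t (suc d)))

  -- Cutting segments along cofinal sequences.

  module _ (α : Ordinal a) where
    open Order α

    record Partition (c : ℕ → Carrier α) (P : Carrier α → Set a) : Set a where
      field
        mono  : ∀ i → c i ≤ c (suc i)
        above : ∀ {z} → P z → c 0 ≤ z
        below : ∀ {z} → P z → ∃ λ i → z < c i
        onto  : ∀ {z i} → c 0 ≤ z → z < c i → P z

      Block : ℕ → Carrier α → Set a
      Block i z = c i ≤ z × z < c (suc i)

      find : ∀ {z} → P z → ∃ λ i → Block i z
      find p = let j , z<cj = below p in locate α c j (above p) z<cj

      Block⇒P : ∀ {z i} → Block i z → P z
      Block⇒P (ci≤z , z<) = onto (≤-trans (steps⇒≤ α c mono z≤n) ci≤z) z<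

      ordered : ∀ {i j x y} → i ℕ.< j → Block i x → Block j y → x < y
      ordered i<j (_ , x<) (cj≤y , _) = <-≤-trans (<-≤-trans x< (steps⇒≤ α c mono i<j)) cj≤y

    IsSup : (ℕ → Carrier α) → Carrier α → Set a
    IsSup c s = (∀ i → c i ≤ s) × (∀ p → p < s → ∃ λ i → p < c i)

    sup-partition : ∀ {c s} → (∀ i → c i ≤ c (suc i)) → IsSup c s → Partition c (λ z → c 0 ≤ z × z < s)
    sup-partition mono (ub , cof) = record
      { mono = mono ; above = proj₁ ; below = λ (_ , z<s) → cof _ z<s
      ; onto = λ {_} {i} c≤z z<c → c≤z , <-≤-trans z<c (ub i) }

    record Cofinal (c : ℕ → Carrier α) (s : Carrier α) : Set a where
      field
        strict  : ∀ i → c i < c (suc i)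
        bound   : ∀ i → c i < s
        cofinal : ∀ p → p < s → ∃ λ i → p < c i

      isSup : IsSup c s
      isSup = (λ i → <⇒≤ (bound i)) , cofinal

    finite-bound : ∀ {N s b} → b < s → (v : Fin N → Carrier α) → (∀ i → v i < s) →
                   ∃ λ w → w < s × b ≤ w × (∀ i → v i ≤ w)
    finite-bound {zero}  {b = b} b<s v v<s = b , b<s , ≤-refl , λ ()
    finite-bound {suc N} {b = b} b<s v v<s with finite-bound b<s (v ∘ suc) (v<s ∘ suc)
    ... | w , w<s , b≤w , v≤w with <⊎≥ w (v zero)
    ...   | inj₂ v₀≤w = w , w<s , b≤w , λ { zero → v₀≤w ; (suc i) → v≤w i }
    ...   | inj₁ w<v₀ = v zero , v<s zero , ≤-trans b≤w (<⇒≤ w<v₀) ,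
            λ { zero → ≤-refl ; (suc i) → ≤-trans (v≤w i) (<⇒≤ w<v₀) }

    module _ {k : ℕ} (f : Carrier α → Fin n) where

      seg-· : ∀ σ τ {x y z} → x ≤ y → y ≤ z → seg α f x y ≈[ k ] ⟦ σ ⟧ → seg α f y z ≈[ k ] ⟦ τ ⟧ →
              seg α f x z ≈[ k ] ⟦ σ · τ ⟧
      seg-· σ τ {x} {y} {z} x≤y y≤z = join-· σ τ {P = seg α f x z} split
        (λ { (inj₁ (p , q)) → p , <-≤-trans q y≤z ; (inj₂ (p , q)) → ≤-trans x≤y p , q })
        (λ (_ , u<y) (y≤v , _) → <-≤-trans u<y y≤v)
        where
        split : ∀ {u} → x ≤ u × u < z → (x ≤ u × u < y) ⊎ (y ≤ u × u < z)
        split {u} (p , q) with <⊎≥ u y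
        ... | inj₁ u<y = inj₁ (p , u<y)
        ... | inj₂ y≤u = inj₂ (y≤u , q)

      seg-empty : ∀ {x y} → y ≤ x → seg α f x y ≈[ k ] ⟦ ε ⟧
      seg-empty y≤x = ef (EF-empty k (λ (x≤z , z<y) → y≤x (≤-<-trans x≤z z<y)) (λ { {()} }))

      seg-letter : ∀ {x y} → Succ x y → seg α f x y ≈[ k ] ⟦ letter (f x) ⟧
      seg-letter {x} {y} s = ef (EF-point k (≤-refl , proj₁ s) tt
        (λ (x≤z , z<y) → ≤-antisym (<Succ⇒≤ s z<y) x≤z) (λ _ → refl) refl)

      partition-^ω : ∀ τ {c P} → Partition c P → (∀ i → seg α f (c i) (c (suc i)) ≈[ k ] ⟦ τ ⟧) →
                     piece α f P ≈[ k ] ⟦ τ ^ω ⟧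
      partition-^ω τ part e = join-^ω τ find Block⇒P ordered e
        where open Partition part

      abstract
        -- Ramsey's theorem for the codes of the segments between points of `c`, started at an index
        -- whose point lies above `p`. The new points are members of `c`, so that their properties
        -- survive in `chain`.
        homogeneous : ∀ {c s p} → Cofinal c s → p < s →
                      ∃ λ c′ → Cofinal c′ s × p ≤ c′ 0 × (∀ i → ∃ λ j → c′ i ≡ c j) ×
                               (∀ i → seg α f (c′ i) (c′ (suc i)) ≈[ k ] seg α f (c′ 0) (c′ 1))
        homogeneous {c} {s} {p} cof p<s =
          let i₀ , p<c = cofinal p p<s
              h , h-inc , _ , h-code = ramsey λ i j → code k (seg α f (c (i₀ + i)) (c (i₀ + j)))
              c′ = λ i → c (i₀ + h i)
          in c′ , record
               { strict  = λ i → steps⇒< α c strict (ℕ.+-monoʳ-< i₀ (h-inc i))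
               ; bound   = λ i → bound _
               ; cofinal = λ q q<s → let i , q<ci = cofinal q q<s in
                   i , <-≤-trans q<ci (steps⇒≤ α c (λ i → <⇒≤ (strict i))
                         (ℕ.≤-trans (id≤ h h-inc i) (ℕ.m≤n+m (h i) i₀)))
               } ,
             <⇒≤ (<-≤-trans p<c (steps⇒≤ α c (λ i → <⇒≤ (strict i)) (ℕ.m≤m+n i₀ (h 0)))) ,
             (λ i → _ , refl) ,
             λ i → code⇒≈ k _ _ (trans (h-code ℕ.≤-refl) (sym (h-code ℕ.≤-refl)))
          where
          open Cofinal cof
          id≤ : ∀ h → Increasing h → ∀ i → i ℕ.≤ h i
          id≤ h inc zero    = z≤n
          id≤ h inc (suc i) = ℕ.≤-<-trans (id≤ h inc i) (inc i)

    seg-cong : ∀ {k f g x y} → (∀ {z} → x ≤ z → z < y → f z ≡ g z) → seg α f x y ≈[ k ] seg α g x y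
    seg-cong {f = f} {g} {x} {y} h = recolour (seg α f x y) g (λ (x≤z , z<y) → h x≤z z<y)

  partition-≈ : ∀ {k} {α : Ordinal a} {β : Ordinal b} {f : Carrier α → Fin n} {g : Carrier β → Fin n}
                {c d P Q} → Partition α c P → Partition β d Q →
                (∀ i → seg α f (c i) (c (suc i)) ≈[ k ] seg β g (d i) (d (suc i))) →
                piece α f P ≈[ k ] piece β g Q
  partition-≈ {α = α} {β} {f} {g} {P = P} {Q} p q = join-ω {P = piece α f P} {Q = piece β g Q}
    (find p) (Block⇒P p) (ordered p) (find q) (Block⇒P q) (ordered q)
    where open Partition

  -- A Löwenheim–Skolem argument: below a limit s that no ω-sequence reaches, a
  -- countable closure under choosing representatives of k-types stays below s.
  module Reflection (α : Ordinal a) (f : Carrier α → Fin n) (k : ℕ) (P : Carrier α → Set a) where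
    open Order α

    module _ {s : Carrier α} (limit : ∀ p → p < s → ∃ λ q → p < q × q < s)
             (unreached : ¬ (∃ λ c → Cofinal α c s)) where

      private
        Between : Carrier α → Carrier α → Set a
        Between u z = P z × u < z × z < s

        Tₚ : Carrier α → Piece a
        Tₚ u = piece α f (Between u)

        Represented : Carrier α → Carrier α → Set a
        Represented u w = ∀ v → Between u v → ∃ λ v′ → Between u v′ × v′ ≤ w ×
          Reply α α (λ x y → f x ≡ f y) k (Between u) (Between u) v v′

        pick : ∀ u {i} → Dec (∃ λ v → Between u v × triple k (Tₚ u) v ≡ i) → Carrier α
        pick u (yes (v , _)) = v
        pick u (no _)        = u

        pick-bound : ∀ {u i} → u < s → (d : Dec (∃ λ v → Between u v × triple k (Tₚ u) v ≡ i)) → pick u d < s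
        pick-bound u<s (yes (v , (_ , _ , v<s) , _)) = v<s
        pick-bound u<s (no _)                        = u<s

        pick-spec : ∀ {u i} (d : Dec (∃ λ v → Between u v × triple k (Tₚ u) v ≡ i)) →
                    (∃ λ v → Between u v × triple k (Tₚ u) v ≡ i) →
                    Between u (pick u d) × triple k (Tₚ u) (pick u d) ≡ i
        pick-spec (yes (v , p , e)) _ = p , e
        pick-spec (no ¬∃)           ∃v = ⊥-elim (¬∃ ∃v)

        abstract
          -- Only finitely many triples of types occur above `u`. One representative of each is
          -- picked, and finitely many points below `s` have a bound below `s`.
          represent : ∀ u → u < s → ∃ λ w → w < s × u ≤ w × Represented u w
          represent u u<s =
            let w , w<s , u≤w , rep≤w = finite-bound α u<s (λ i → pick u {i} em) (λ i → pick-bound u<s em)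
            in w , w<s , u≤w , λ v bv →
                 let bv′ , e = pick-spec {u} {triple k (Tₚ u) v} em (v , bv , refl)
                 in _ , bv′ , rep≤w _ , triple⇒Reply k (Tₚ u) (Tₚ u) (sym e)

      module _ (g : Carrier α → Carrier α) (g<s : ∀ {p} → p < s → g p < s) {b : Carrier α} (b<s : b < s) where

        private
          Below : Set a
          Below = ∃ λ p → p < s

          abstract
            step : ∀ ((u , _) : Below) → ∃ λ ((u′ , _) : Below) → u < u′ × g u < u′ ×
                   ∃ λ w → w < u′ × Represented u w
            step (u , u<s) with represent u u<s
            ... | w , w<s , u≤w , rep with <⊎≥ w (g u)
            ...   | inj₁ w<gu = let q , gu<q , q<s = limit (g u) (g<s u<s) in
                    (q , q<s) , <-trans (≤-<-trans u≤w w<gu) gu<q , gu<q , w , <-trans w<gu gu<q , rep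
            ...   | inj₂ gu≤w = let q , w<q , q<s = limit w w<s in
                    (q , q<s) , ≤-<-trans u≤w w<q , ≤-<-trans gu≤w w<q , w , w<q , rep

          u′ : ℕ → Below
          u′ zero    = b , b<s
          u′ (suc i) = proj₁ (step (u′ i))

          u : ℕ → Carrier α
          u i = proj₁ (u′ i)

          strict : ∀ i → u i < u (suc i)
          strict i = proj₁ (proj₂ (step (u′ i)))

          abstract
            bounded-below-s : ∃ λ p → p < s × (∀ i → u i ≤ p)
            bounded-below-s = dne λ ¬∃ → unreached (u , record
              { strict = strict ; bound = λ i → proj₂ (u′ i)
              ; cofinal = λ p p<s → dne λ ¬i → ¬∃ (p , p<s , λ i p<ui → ¬i (i , p<ui)) })

            sup : ∃ λ y → (∀ i → u i ≤ y) × (∀ z → (∀ i → u i ≤ z) → y ≤ z)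
            sup = least α (λ y → ∀ i → u i ≤ y) (let p , _ , ub = bounded-below-s in p , ub)

          y : Carrier α
          y = proj₁ sup

          u<y : ∀ i → u i < y
          u<y i = <-≤-trans (strict i) (proj₁ (proj₂ sup) (suc i))

          y<s : y < s
          y<s = let p , p<s , ub = bounded-below-s in ≤-<-trans (proj₂ (proj₂ sup) p ub) p<s

          reach : ∀ {p} → p < y → ∃ λ i → p < u i
          reach p<y = dne λ ¬i → proj₂ (proj₂ sup) _ (λ i p<ui → ¬i (i , p<ui)) p<y

          Eventually : (Carrier α → Set a) → ℕ → Set a
          Eventually Q m = ∀ {z} → u m < z → (Q z → P z) × (P z → Q z)

          -- `Q` agrees with `P` beyond `u m`, and cutting off what lies below a move keeps a
          -- condition of this form. A move below `y`, or not above `u m`, is copied. A move `v`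
          -- above `u m` is answered by its representative `v′`, which lies below `u (suc m)`: the
          -- parts between `u m` and the two moves are equivalent, and so are the parts between the
          -- moves and `s`. Induction replaces `s` by `y` above `v′`.
          reflect : ∀ j → j ℕ.≤ k → ∀ Q m → Eventually Q m →
                    EF α α (λ x y → f x ≡ f y) j (Q ∩< y) (Q ∩< s)
          reflect zero    _   Q m ev = _
          reflect (suc j) j<k Q m ev =
            (λ v (qv , v<y) → v , (qv , <-trans v<y y<s) , same qv v<y) , back
            where
            self : ∀ R → EF α α (λ x y → f x ≡ f y) j R R
            self R = game (≈-refl {k = j} {piece α f R})

            above : ∀ v → v < y → EF α α (λ x y → f x ≡ f y) j ((Q ∩> v) ∩< y) ((Q ∩> v) ∩< s)
            above v v<y = let i , v<ui = reach v<y in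
              reflect j (ℕ.<⇒≤ j<k) (Q ∩> v) (m ℕ.⊔ i) λ uz →
                let u≤ = λ {l} l≤ → steps⇒≤ α u (λ i → <⇒≤ (strict i)) {l} {m ℕ.⊔ i} l≤
                    to , from = ev (≤-<-trans (u≤ (ℕ.m≤m⊔n m i)) uz)
                in (λ (q , _) → to q) ,
                   (λ p → from p , <-trans (<-≤-trans v<ui (u≤ (ℕ.m≤n⊔m m i))) uz)

            swap : ∀ {p q r : Level} {A : Set p} {B : Set q} {C : Set r} → (A × B) × C → (A × C) × B
            swap ((x , y) , z) = (x , z) , y

            same : ∀ {v} → Q v → v < y → Reply α α (λ x y → f x ≡ f y) j (Q ∩< y) (Q ∩< s) v v
            same {v} qv v<y = refl ,
              EF-resp j (λ (q , z<v) → (q , <-trans z<v v<y) , z<v) (λ ((q , _) , z<v) → q , z<v)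
                        (λ (q , z<v) → (q , <-trans z<v (<-trans v<y y<s)) , z<v) (λ ((q , _) , z<v) → q , z<v)
                (self (Q ∩< v)) ,
              EF-resp j swap swap swap swap (above v v<y)

            back : ∀ v → (Q ∩< s) v → ∃ λ x → (Q ∩< y) x × Reply α α (λ x y → f x ≡ f y) j (Q ∩< y) (Q ∩< s) x v
            back v (qv , v<s) with <⊎≥ (u m) v
            ... | inj₂ v≤um = v , (qv , ≤-<-trans v≤um (u<y m)) , same qv (≤-<-trans v≤um (u<y m))
            ... | inj₁ um<v with proj₂ (proj₂ (proj₂ (step (u′ m))))
            ...   | w , w<u , rep with rep v (proj₁ (ev um<v) qv , um<v , v<s)
            ...     | v′ , (pv′ , um<v′ , v′<s) , v′≤w , fv≡ , l , r =
              v′ , (proj₂ (ev um<v′) pv′ , v′<y) , sym fv≡ , below , above′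
              where
              v′<y : v′ < y
              v′<y = <-trans (≤-<-trans v′≤w w<u) (u<y (suc m))
              flipped : ∀ {R S} → EF α α (λ x y → f x ≡ f y) k R S → EF α α (λ x y → f x ≡ f y) j S R
              flipped e = game (≈-sym (≈-down {P = piece α f _} {piece α f _} (ℕ.<⇒≤ j<k) (ef e)))
              Low : Carrier α → Set a
              Low z = Q z × z ≤ u m
              split : ∀ {t z} → Q z → z < t → t < s → Low z ⊎ (Between (u m) ∩< t) z
              split {z = z} q z<t t<s with <⊎≥ (u m) z
              ... | inj₁ um<z = inj₂ ((proj₁ (ev um<z) q , um<z , <-trans z<t t<s) , z<t)
              ... | inj₂ z≤um = inj₁ (q , z≤um)
              merge : ∀ {t z} → u m < t → Low z ⊎ (Between (u m) ∩< t) z → Q z × z < t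
              merge um<t (inj₁ (q , z≤um))                = q , ≤-<-trans z≤um um<t
              merge um<t (inj₂ ((p , um<z , _) , z<t))    = proj₂ (ev um<z) p , z<t
              below : EF α α (λ x y → f x ≡ f y) j ((Q ∩< y) ∩< v′) ((Q ∩< s) ∩< v)
              below = EF-resp j
                (λ z → let q , z<v′ = merge um<v′ z in (q , <-trans z<v′ v′<y) , z<v′)
                (λ ((q , _) , z<v′) → split q z<v′ v′<s)
                (λ z → let q , z<v = merge um<v z in (q , <-trans z<v v<s) , z<v)
                (λ ((q , _) , z<v) → split q z<v v<s)
                (EF-∪ j (λ (_ , z≤um) ((_ , um<z , _) , _) → ≤-<-trans z≤um um<z)
                        (λ (_ , z≤um) ((_ , um<z , _) , _) → ≤-<-trans z≤um um<z)
                  (self Low) (flipped l))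
              above′ : EF α α (λ x y → f x ≡ f y) j ((Q ∩< y) ∩> v′) ((Q ∩< s) ∩> v)
              above′ = EF-trans trans j
                (EF-resp j swap swap swap swap (above v′ v′<y))
                (EF-resp j
                  (λ ((p , um<z , z<s) , v<z) → (proj₂ (ev um<z) p , z<s) , v<z)
                  (λ ((q , z<s) , v<z) → (proj₁ (ev (<-trans um<v′ v<z)) q , <-trans um<v′ v<z , z<s) , v<z)
                  (λ ((p , um<z , z<s) , v<z) → (proj₂ (ev um<z) p , z<s) , v<z)
                  (λ ((q , z<s) , v<z) → (proj₁ (ev (<-trans um<v v<z)) q , <-trans um<v v<z , z<s) , v<z)
                  (flipped r))

        abstract
          -- `y` is the supremum of the ω-sequence `u` and stays below `s`, which no ω-sequence
          -- reaches. Closure under `g` makes `y` a limit of starting points in `LongWords`; in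
          -- `classify` the function is the identity.
          reflection : ∃ λ y → b < y × y < s × (∀ p → p < y → ∃ λ q → p < q × g q < y) ×
                       piece α f (P ∩< y) ≈[ k ] piece α f (P ∩< s)
          reflection = y , u<y 0 , y<s ,
            (λ p p<y → let i , p<ui = reach p<y in
               u i , p<ui , <-trans (proj₁ (proj₂ (proj₂ (step (u′ i))))) (u<y (suc i))) ,
            ef (reflect k ℕ.≤-refl P 0 (λ _ → id , id))

  module _ (α : Ordinal a) (f : Carrier α → Fin n) (k : ℕ) where
    open Order α

    -- Induction on the end of the segment. A successor contributes a last letter, a limit of an
    -- ω-sequence contributes an ω-power by homogeneity, and at any other limit reflection moves the
    -- end down without changing the type.
    classify : ∀ x s → ∃ λ τ → seg α f x s ≈[ k ] ⟦ τ ⟧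
    classify x s = go s (wellFounded s) x
      where
      go : ∀ s → Acc _<_ s → ∀ x → ∃ λ τ → seg α f x s ≈[ k ] ⟦ τ ⟧
      go s (acc rec) x with em {P = x < s}
      ... | no x≮s = ε , seg-empty α f x≮s
      ... | yes x<s with em {P = ∃ λ m → x ≤ m × Succ m s}
      ...   | yes (m , x≤m , succ) = let τ , e = go m (rec (proj₁ succ)) x in
              τ · letter (f m) , seg-· α f τ _ x≤m (<⇒≤ (proj₁ succ)) e (seg-letter α f succ)
      ...   | no ¬succ with em {P = ∃ λ c → Cofinal α c s}
      ...     | yes (c , cof) =
        let c′ , cof′ , x≤c , _ , hom = homogeneous α {k} f cof x<s
            open Cofinal cof′
            ρ , e₀ = go (c′ 0) (rec (bound 0)) x
            τ , e  = go (c′ 1) (rec (bound 1)) (c′ 0)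
        in ρ · τ ^ω , seg-· α f ρ (τ ^ω) x≤c (<⇒≤ (bound 0)) e₀
             (partition-^ω α f τ (sup-partition α (λ i → <⇒≤ (strict i)) isSup) (λ i → ≈-trans (hom i) e))
      ...     | no unreached =
        let y , x<y , y<s , _ , e = Reflection.reflection α f k (x ≤_) limit unreached id id x<s
            τ , e′ = go y (rec y<s) x
        in τ , ≈-trans (≈-sym e) e′
        where
        limit : ∀ p → p < s → ∃ λ q → p < q × q < s
        limit p p<s with <⊎≥ p x
        ... | inj₁ p<x = x , p<x , x<s
        ... | inj₂ x≤p = dne λ ¬q → ¬succ (p , x≤p , p<s , λ z p<z z<s → ¬q (z , p<z , z<s))

  -- Realising expressions in ordinals divisible by ω^ω.

  module _ (α : Ordinal a) where
    open Order α

    -- Add m x y says y = x + ω^m: the least y above x closed under adding ω^(m-1).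
    Add Closed : ℕ → Carrier α → Carrier α → Set a
    Add zero    x y = Succ x y
    Add (suc m) x y = Closed m x y × (∀ z → z < y → ¬ Closed m x z)
    Closed m x y = x < y × (∀ p → x ≤ p → p < y → ∃ λ q → q < y × Add m p q)

    -- Says that α is a multiple of ω^ω, possibly 0. For each `m` it is a first-order condition, so
    -- α₀ inherits it from ω^ω.
    Spacious : Set a
    Spacious = ∀ m x → ∃ λ y → Add m x y

    Add⇒< : ∀ m {x y} → Add m x y → x < y
    Add⇒< zero    = proj₁
    Add⇒< (suc m) = proj₁ ∘ proj₁

    abstract
      supremum : ∀ c e → (∀ i → c i ≤ e) → ∃ λ y → y ≤ e × IsSup α c y
      supremum c e ub = let y , ub′ , lub = least α (λ y → ∀ i → c i ≤ y) (e , ub) in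
        y , lub e ub , ub′ , λ p p<y → dne λ ¬i → lub p (λ i p<ci → ¬i (i , p<ci)) p<y

    splice : Carrier α → (f g : Carrier α → Fin n) → Carrier α → Fin n
    splice y f g z with <⊎≥ z y
    ... | inj₁ _ = f z
    ... | inj₂ _ = g z

    splice-< : ∀ {y f g z} → z < y → splice y f g z ≡ f z
    splice-< {y} {z = z} z<y with <⊎≥ z y
    ... | inj₁ _   = refl
    ... | inj₂ y≤z = ⊥-elim (y≤z z<y)

    splice-≥ : ∀ {y f g z} → y ≤ z → splice y f g z ≡ g z
    splice-≥ {y} {z = z} y≤z with <⊎≥ z y
    ... | inj₁ z<y = ⊥-elim (y≤z z<y)
    ... | inj₂ _   = refl

    glue : ∀ c → (∀ i → c i ≤ c (suc i)) → (h : ℕ → Carrier α → Fin n) →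
           ∃ λ f → ∀ i {z} → c i ≤ z → z < c (suc i) → f z ≡ h i z
    glue c mono h = (λ z → pick z em) , λ i {z} c≤z z<c → spec i c≤z z<c em
      where
      Found : Carrier α → Set a
      Found z = ∃ λ i → c i ≤ z × z < c (suc i)
      pick : ∀ z → Dec (Found z) → Fin n
      pick z (yes (i , _)) = h i z
      pick z (no _)        = h 0 z
      spec : ∀ i {z} → c i ≤ z → z < c (suc i) → (d : Dec (Found z)) → pick z d ≡ h i z
      spec i c≤z z<c (yes (j , p , q)) = cong (λ i → h i _) (locate-unique α c mono j i p q c≤z z<c)
      spec i c≤z z<c (no ¬f)           = ⊥-elim (¬f (i , c≤z , z<c))

    module _ (k : ℕ) where

      Fills : Expr → Carrier α → Carrier α → Set a
      Fills τ x y = ∃ λ h → seg α h x y ≈[ k ] ⟦ τ ⟧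

      fills-· : ∀ σ τ {x y z} → x ≤ y → y ≤ z → Fills σ x y → Fills τ y z → Fills (σ · τ) x z
      fills-· σ τ {x} {y} x≤y y≤z (h , e) (h′ , e′) = splice y h h′ ,
        seg-· α _ σ τ x≤y y≤z
          (≈-trans (seg-cong α (λ _ z<y → splice-< z<y)) e)
          (≈-trans (seg-cong α (λ y≤z _ → splice-≥ y≤z)) e′)

      fills-^ω : ∀ τ {c y} → (∀ i → c i ≤ c (suc i)) → IsSup α c y → (∀ i → Fills τ (c i) (c (suc i))) →
                 Fills (τ ^ω) (c 0) y
      fills-^ω τ {c} mono sup fill = let h , agree = glue c mono (λ i → proj₁ (fill i)) in
        h , partition-^ω α h τ (sup-partition α mono sup)
              (λ i → ≈-trans (seg-cong α (agree i)) (proj₂ (fill i)))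

      -- The word of `τ` has length at most ω^(`depth τ`): one letter has length ω^0, two words of
      -- length at most ω^m fit below ω^(m+1), and ω of them have length at most ω^(m+1).
      depth : Expr → ℕ
      depth ε          = 0
      depth (letter _) = 0
      depth (σ · τ)    = suc (depth σ ℕ.⊔ depth τ)
      depth (τ ^ω)     = suc (depth τ)

      Fits : Expr → Carrier α → Carrier α → Set a
      Fits τ x e = ∃ λ z → x ≤ z × z ≤ e × Fills τ x z

      module _ (i₀ : Fin n) where

        -- Every part of a compound expression ends strictly below `e`, because `e` is closed under
        -- adding the next smaller power. For an ω-power the copies follow each other below `e`, and
        -- the supremum of their ends is at most `e`.
        fit : ∀ τ m {x e} → depth τ ℕ.≤ m → Add m x e → Fits τ x e

        private
          fit-below : ∀ τ m {x p e} → depth τ ℕ.≤ m → Add (suc m) x e → x ≤ p → p < e →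
                      ∃ λ z → p ≤ z × z < e × Fills τ p z
          fit-below τ m τ≤m (cl , _) x≤p p<e =
            let q , q<e , add = proj₂ cl _ x≤p p<e
                z , p≤z , z≤q , fill = fit τ m τ≤m add
            in z , p≤z , ≤-<-trans z≤q q<e , fill

        fit ε m {x} _ add = x , ≤-refl , <⇒≤ (Add⇒< m add) , (λ _ → i₀) , seg-empty α _ ≤-refl
        fit (letter i) zero {x} {e} _ add = e , <⇒≤ (proj₁ add) , ≤-refl , (λ _ → i) , seg-letter α _ add
        fit (letter i) (suc m) _ add@((x<e , _) , _) =
          let z , x≤z , z<e , fill = fit-below (letter i) m z≤n add ≤-refl x<e in
          z , x≤z , <⇒≤ z<e , fill
        fit (σ · τ) (suc m) (s≤s d≤m) add@((x<e , _) , _) =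
          let y , x≤y , y<e , fill  = fit-below σ m (ℕ.≤-trans (ℕ.m≤m⊔n _ _) d≤m) add ≤-refl x<e
              z , y≤z , z<e , fill′ = fit-below τ m (ℕ.≤-trans (ℕ.m≤n⊔m (depth σ) _) d≤m) add x≤y y<e
          in z , ≤-trans x≤y y≤z , <⇒≤ z<e , fills-· σ τ x≤y y≤z fill fill′
        fit (τ ^ω) (suc m) {x} {e} (s≤s d≤m) add@((x<e , _) , _) =
          let y , y≤e , sup = supremum c e (λ i → <⇒≤ (proj₂ (proj₂ (c′ i)))) in
          y , proj₁ sup 0 , y≤e , fills-^ω τ mono sup (λ i → proj₂ (proj₂ (proj₂ (next (c′ i)))))
          where
          Inside : Set a
          Inside = ∃ λ p → x ≤ p × p < e
          next : ((p , _) : Inside) → ∃ λ z → p ≤ z × z < e × Fills τ p z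
          next (p , x≤p , p<e) = fit-below τ m d≤m add x≤p p<e
          c′ : ℕ → Inside
          c′ zero    = x , ≤-refl , x<e
          c′ (suc i) = let z , p≤z , z<e , _ = next (c′ i) in z , ≤-trans (proj₁ (proj₂ (c′ i))) p≤z , z<e
          c : ℕ → Carrier α
          c i = proj₁ (c′ i)
          mono : ∀ i → c i ≤ c (suc i)
          mono i = proj₁ (proj₂ (next (c′ i)))

        realise : Spacious → ∀ τ x → ∃ λ z → x ≤ z × Fills τ x z
        realise room τ x = let e , add = room (depth τ) x
                               z , x≤z , _ , fill = fit τ (depth τ) ℕ.≤-refl add
                           in z , x≤z , fill

  -- If x ∼ x·x ∼ x^ω then x is the type of arbitrarily long words: lay copies of x
  -- one after another, restarting at limits of starting points.
  module LongWords (α : Ordinal a) (k : ℕ) (i₀ : Fin n) (room : Spacious α) (τ : Expr)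
                   (nonempty : ∃ (on ⟦ τ ⟧)) (idem : (τ · τ) ~[ suc k ] τ) (stable : (τ ^ω) ~[ suc k ] τ)
                   (x₀ : Carrier α) where
    open Order α

    private
      abstract
        -- It takes one round to see that a word is nonempty, hence the rank `suc k`: the realised
        -- copy then contains a point and ends above `b`.
        copy : ∀ b → ∃ λ z → b < z × Fills α (suc k) τ b z
        copy b = let z , _ , h , e = realise α (suc k) i₀ room τ b
                     _ , b≤y , y<z = ≈-nonempty (≈-sym e) nonempty
                 in z , ≤-<-trans b≤y y<z , h , e

      end : Carrier α → Carrier α
      end b = proj₁ (copy b)

      <end : ∀ b → b < end b
      <end b = proj₁ (proj₂ (copy b))

      data Start : Carrier α → Set a where
        base : Start x₀
        next : ∀ {b} → Start b → Start (end b)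
        lim  : ∀ {b} → x₀ < b → (∀ p → p < b → ∃ λ q → p < q × q < b × Start q) → Start b

      x₀≤ : ∀ {b} → Start b → x₀ ≤ b
      x₀≤ base         = ≤-refl
      x₀≤ (next s)     = <⇒≤ (≤-<-trans (x₀≤ s) (<end _))
      x₀≤ (lim x₀<b _) = <⇒≤ x₀<b

      end≤ : ∀ {b b′} → Start b → Start b′ → b < b′ → end b ≤ b′
      end≤ {b} {b′} s s′ = go b s b′ s′ (wellFounded b′)
        where
        go : ∀ b → Start b → ∀ b′ → Start b′ → Acc _<_ b′ → b < b′ → end b ≤ b′
        go b s _ base _ b<x₀ = ⊥-elim (x₀≤ s b<x₀)
        go b s _ (next {b′} s′) (acc rec) b<e with compare b b′
        ... | tri< b<b′ _ _ = <⇒≤ (≤-<-trans (go b s b′ s′ (rec (<end b′)) b<b′) (<end b′))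
        ... | tri≈ _ refl _ = ≤-refl
        ... | tri> _ _ b′<b = ⊥-elim (go b′ s′ b s (rec b<e) b′<b b<e)
        go b s b′ (lim _ cof) (acc rec) b<b′ = let q , b<q , q<b′ , sq = cof b b<b′ in
          <⇒≤ (≤-<-trans (go b s q sq (rec q<b′) b<q) q<b′)

      Within : Carrier α → Set a
      Within p = ∃ λ b → Start b × b ≤ p × p < end b

      abstract
        -- The supremum `y` of the starts up to `p` is a start itself, since otherwise `lim` would
        -- make it one. Its copy goes beyond `p`; if not, `end y` would be a start up to `p` above
        -- the supremum.
        within : ∀ p → x₀ ≤ p → Within p
        within p x₀≤p = dne absurd
          where
          absurd : ¬ ¬ Within p
          absurd ¬w = y∉ (lim (strictly base x₀≤p) λ q q<y → dne λ ¬b →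
            proj₂ (proj₂ sup) q (λ b (s , b≤p) q<b → ¬b (b , q<b , strictly s b≤p , s)) q<y)
            where
            sup : ∃ λ y → (∀ b → Start b × b ≤ p → b ≤ y) × (∀ z → (∀ b → Start b × b ≤ p → b ≤ z) → y ≤ z)
            sup = least α (λ y → ∀ b → Start b × b ≤ p → b ≤ y) (p , λ _ (_ , b≤p) → b≤p)
            y : Carrier α
            y = proj₁ sup
            y≤p : y ≤ p
            y≤p = proj₂ (proj₂ sup) p (λ _ (_ , b≤p) → b≤p)
            y∉ : ¬ Start y
            y∉ s = ¬w (y , s , y≤p , dne λ e≤p → proj₁ (proj₂ sup) (end y) (next s , e≤p) (<end y))
            strictly : ∀ {b} → Start b → b ≤ p → b < y
            strictly {b} s b≤p with ≤⇒<⊎≡ (proj₁ (proj₂ sup) b (s , b≤p))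
            ... | inj₁ b<y  = b<y
            ... | inj₂ refl = ⊥-elim (y∉ s)

      within-unique : ∀ {p} ((b , _) (b′ , _) : Within p) → b ≡ b′
      within-unique (b , s , b≤p , p<e) (b′ , s′ , b′≤p , p<e′) with compare b b′
      ... | tri≈ _ b≡b′ _ = b≡b′
      ... | tri< b<b′ _ _ = ⊥-elim (≤-trans (end≤ s s′ b<b′) b′≤p p<e)
      ... | tri> _ _ b′<b = ⊥-elim (≤-trans (end≤ s′ s b′<b) b≤p p<e′)

      pick : ∀ p → Dec (Within p) → Fin n
      pick p (yes (b , _)) = proj₁ (proj₂ (proj₂ (copy b))) p
      pick p (no _)        = i₀

      h : Carrier α → Fin n
      h p = pick p em

      h-copy : ∀ {b} → Start b → seg α h b (end b) ≈[ suc k ] ⟦ τ ⟧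
      h-copy {b} s = ≈-trans (seg-cong α (λ b≤z z<e → agree b≤z z<e em)) (proj₂ (proj₂ (proj₂ (copy b))))
        where
        agree : ∀ {z} → b ≤ z → z < end b → (d : Dec (Within z)) → pick z d ≡ proj₁ (proj₂ (proj₂ (copy b))) z
        agree {z} b≤z z<e (yes w) = cong (λ b → proj₁ (proj₂ (proj₂ (copy b))) z) (within-unique w (b , s , b≤z , z<e))
        agree b≤z z<e (no ¬w)     = ⊥-elim (¬w (b , s , b≤z , z<e))

      -- Induction on the later start. After `next`, idempotence absorbs the last copy. At a limit
      -- of an ω-sequence, starts along the sequence cut the word into ω equivalent pieces and
      -- stability applies. At any other limit, reflection finds a smaller limit of starts with the
      -- same type.
      between : ∀ {b b′} → Start b → Start b′ → b < b′ → seg α h b b′ ≈[ suc k ] ⟦ τ ⟧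
      between s s′ = go _ s′ (wellFounded _) _ s
        where
        go : ∀ t → Start t → Acc _<_ t → ∀ b → Start b → b < t → seg α h b t ≈[ suc k ] ⟦ τ ⟧
        go _ base _ b s b<x₀ = ⊥-elim (x₀≤ s b<x₀)
        go _ (next {b′} s′) (acc rec) b s b<e with compare b b′
        ... | tri< b<b′ _ _ = ≈-trans (seg-· α h τ τ (<⇒≤ b<b′) (<⇒≤ (<end b′))
                                (go b′ s′ (rec (<end b′)) b s b<b′) (h-copy s′)) (equiv idem)
        ... | tri≈ _ refl _ = h-copy s
        ... | tri> _ _ b′<b = ⊥-elim (end≤ s′ s b′<b b<e)
        go t (lim _ cof) (acc rec) b s b<t with em {P = ∃ λ c → Cofinal α c t}
        ... | yes (c , c-cof) = ≈-trans (partition-^ω α h τ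
                (sup-partition α (λ i → <⇒≤ (d-strict i)) (d-sup)) d-copy) (equiv stable)
          where
          open Cofinal c-cof
          Inside : Set a
          Inside = ∃ λ p → Start p × b ≤ p × p < t
          above : ∀ ((p , _) : Inside) i → ∃ λ q → p < q × c i < q × q < t × Start q
          above (p , _ , _ , p<t) i with <⊎≥ p (c i)
          ... | inj₁ p<c = let q , c<q , q<t , sq = cof (c i) (bound i) in q , <-trans p<c c<q , c<q , q<t , sq
          ... | inj₂ c≤p = let q , p<q , q<t , sq = cof p p<t in q , p<q , ≤-<-trans c≤p p<q , q<t , sq
          d′ : ℕ → Inside
          d′ zero    = b , s , ≤-refl , b<t
          d′ (suc i) = let q , p<q , _ , q<t , sq = above (d′ i) i in
            q , sq , <⇒≤ (≤-<-trans (proj₁ (proj₂ (proj₂ (d′ i)))) p<q) , q<t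
          d : ℕ → Carrier α
          d i = proj₁ (d′ i)
          d-strict : ∀ i → d i < d (suc i)
          d-strict i = proj₁ (proj₂ (above (d′ i) i))
          d-sup : IsSup α d t
          d-sup = (λ i → <⇒≤ (proj₂ (proj₂ (proj₂ (d′ i))))) , λ p p<t →
            let i , p<c = cofinal p p<t in suc i , <-trans p<c (proj₁ (proj₂ (proj₂ (above (d′ i) i))))
          d-copy : ∀ i → seg α h (d i) (d (suc i)) ≈[ suc k ] ⟦ τ ⟧
          d-copy i = go (d (suc i)) (proj₁ (proj₂ (d′ (suc i)))) (rec (proj₂ (proj₂ (proj₂ (d′ (suc i))))))
                       (d i) (proj₁ (proj₂ (d′ i))) (d-strict i)
        ... | no unreached =
          let y , b<y , y<t , closed , e = Reflection.reflection α h (suc k) (b ≤_) limit unreached g g<t b<t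
              start-y = lim (≤-<-trans (x₀≤ s) b<y) λ p p<y → let q , p<q , gq<y = closed p p<y in
                g q , <-trans p<q (g> (<-trans (g-above q gq<y) y<t)) , gq<y , g-start (<-trans (g-above q gq<y) y<t)
          in ≈-trans (≈-sym e) (go y start-y (rec y<t) b s b<y)
          where
          limit : ∀ p → p < t → ∃ λ q → p < q × q < t
          limit p p<t = let q , p<q , q<t , _ = cof p p<t in q , p<q , q<t
          -- For p < t this is a start strictly between `p` and `t`, so a point closed under `g` is
          -- a limit of starts. The value at other points is arbitrary.
          g : Carrier α → Carrier α
          g p with p <? t
          ... | yes p<t = proj₁ (cof p p<t)
          ... | no _    = p
          g<t : ∀ {p} → p < t → g p < t
          g<t {p} p<t with p <? t
          ... | yes p<t = proj₁ (proj₂ (proj₂ (cof p p<t)))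
          ... | no p≮t  = ⊥-elim (p≮t p<t)
          g> : ∀ {p} → p < t → p < g p
          g> {p} p<t with p <? t
          ... | yes p<t = proj₁ (proj₂ (cof p p<t))
          ... | no p≮t  = ⊥-elim (p≮t p<t)
          g-start : ∀ {p} → p < t → Start (g p)
          g-start {p} p<t with p <? t
          ... | yes p<t = proj₂ (proj₂ (proj₂ (cof p p<t)))
          ... | no p≮t  = ⊥-elim (p≮t p<t)
          g-above : ∀ p {y} → g p < y → p < y
          g-above p gp<y with p <? t
          ... | yes p<t = <-trans (proj₁ (proj₂ (cof p p<t))) gp<y
          ... | no _    = gp<y

    abstract
      long : ∀ z → ∃ λ y → z ≤ y × x₀ ≤ y × Fills α (suc k) τ x₀ y
      long z with <⊎≥ z x₀
      ... | inj₁ z<x₀ = end x₀ , <⇒≤ (<-trans z<x₀ (<end x₀)) , <⇒≤ (<end x₀) , h , h-copy base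
      ... | inj₂ x₀≤z = let b , s , b≤z , z<e = within z x₀≤z in
        end b , <⇒≤ z<e , <⇒≤ (≤-<-trans (x₀≤ s) (<end b)) ,
        h , between base (next s) (≤-<-trans (x₀≤ s) (<end b))

  -- A type x ∼ x^ω, surrounded by arbitrary words; such a factor can be stretched.
  record Stretchable (k : ℕ) : Set where
    field
      left core right : Expr
      nonempty : ∃ (on ⟦ core ⟧)
      stable   : core ~[ k ] core ^ω

    whole : Expr
    whole = left · core · right

    -- x · x ∼ x · x^ω ∼ x^ω ∼ x.
    idem : (core · core) ~[ k ] core
    idem = ~-trans k (·-cong (~-refl k) stable) (~-trans k (~-sym k (ω-unfold core)) (~-sym k stable))

  -- Stretchable factors and words of cofinality ω.

  module _ (α : Ordinal a) where
    open Order α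

    -- Being a multiple of ω^m would not do, since such a point may have uncountable cofinality.
    -- Here each of the `m` levels comes with an ω-sequence, as Ramsey's theorem requires.
    Lim : ℕ → Carrier α → Set a
    Lim zero    _ = Poly.⊤
    Lim (suc m) s = ∃ λ c → Cofinal α c s × (∀ i → Lim m (c i))

    Add⇒Lim : ∀ m {x e} → Add α m x e → ∃ λ s → x < s × s ≤ e × Lim m s
    Add⇒Lim zero    {e = e} add = e , proj₁ add , ≤-refl , Poly.tt
    Add⇒Lim (suc m) {x} {e} ((x<e , closed) , _) =
      let s , s≤e , ub , lub = supremum α c e (λ i → <⇒≤ (proj₂ (proj₂ (c′ i)))) in
      s , <-≤-trans (strict 0) (ub 1) , s≤e , c ∘ suc , record
        { strict  = strict ∘ suc
        ; bound   = λ i → <-≤-trans (strict (suc i)) (ub (suc (suc i)))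
        ; cofinal = λ p p<s → let i , p<ci = lub p p<s in i , <-trans p<ci (strict i) } ,
      λ i → proj₂ (proj₂ (proj₂ (next (c′ i))))
      where
      Inside : Set a
      Inside = ∃ λ p → x ≤ p × p < e
      next : ((p , _) : Inside) → ∃ λ s → p < s × s < e × Lim m s
      next (p , x≤p , p<e) = let q , q<e , add = closed p x≤p p<e
                                 s , p<s , s≤q , l = Add⇒Lim m add
                             in s , p<s , ≤-<-trans s≤q q<e , l
      c′ : ℕ → Inside
      c′ zero    = x , ≤-refl , x<e
      c′ (suc i) = let s , p<s , s<e , _ = next (c′ i) in
        s , <⇒≤ (≤-<-trans (proj₁ (proj₂ (c′ i))) p<s) , s<e
      c : ℕ → Carrier α
      c i = proj₁ (c′ i)
      strict : ∀ i → c i < c (suc i)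
      strict i = proj₁ (proj₂ (next (c′ i)))

    module _ (f : Carrier α → Fin n) (k : ℕ) where
      private
        K = suc k

      -- Nested ω-powers: `e i` ends in the ω-power of `e (suc i)`. The sequences are total for
      -- convenience; only the steps below `m` are constrained.
      Chain : ℕ → Carrier α → Carrier α → Set a
      Chain m p q = Σ[ e ∈ (ℕ → Expr) ] Σ[ w ∈ (ℕ → Expr) ]
        (seg α f p q ≈[ K ] ⟦ e 0 ⟧ ×
         (∀ i → i ℕ.< m → e i ~[ K ] w i · e (suc i) ^ω) × (∀ i → ∃ (on ⟦ e i ⟧)))

      chain : ∀ m {p q} → p < q → Lim m q → Chain m p q
      chain zero {p} {q} p<q _ =
        let τ , e = classify α f K p q in
        (λ _ → τ) , (λ _ → ε) , e , (λ _ ()) , λ _ → ≈-nonempty e (p , ≤-refl , p<q)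
      chain (suc m) {p} {q} p<q (c , cof , lim) =
        let c′ , cof′ , p≤c , sub , hom = homogeneous α f cof p<q
            open Cofinal cof′
            -- The first of the equivalent segments ends at `c′ 1`, a member of `c` and hence in
            -- `Lim m`, so the chain continues inside this segment.
            j , c₁≡ = sub 1
            e , w , seg≈ , step , ne = chain m (strict 0) (subst (Lim m) (sym c₁≡) (lim j))
            ρ , seg≈ρ = classify α f K p (c′ 0)
            τ , seg≈τ = classify α f K p q
            whole = seg-· α f ρ (e 0 ^ω) p≤c (<⇒≤ (bound 0)) seg≈ρ
              (partition-^ω α f (e 0) (sup-partition α (λ i → <⇒≤ (strict i)) isSup)
                (λ i → ≈-trans (hom i) seg≈))
        in (λ { zero → τ ; (suc i) → e i }) , (λ { zero → ρ ; (suc i) → w i }) , seg≈τ ,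
           (λ { zero _ → ⟪ ≈-trans (≈-sym seg≈τ) whole ⟫ ; (suc i) (s≤s i<m) → step i i<m }) ,
           λ { zero → ≈-nonempty seg≈τ (p , ≤-refl , p<q) ; (suc i) → ne i }

      -- Unfolding one copy from each ω-power on the way exposes `e i` as a factor.
      context : ∀ {m} (e w : ℕ → Expr) → (∀ i → i ℕ.< m → e i ~[ K ] w i · e (suc i) ^ω) →
                ∀ i → i ℕ.≤ m → ∃₂ λ u v → e 0 ~[ K ] u · e i · v
      context e w step zero    _   = ε , ε , ~-sym K (~-trans K (·-identityˡ _) (·-identityʳ _))
      context e w step (suc i) i<m =
        let u , v , eq = context e w step i (ℕ.<⇒≤ i<m) in
        u · w i , e (suc i) ^ω · v ,
        ~-trans K eq (~-trans K (·-cong (~-refl K) (·-cong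
          (~-trans K (step i i<m) (·-cong (~-refl K) (ω-unfold _))) (~-refl K)))
        (~-trans K (·-cong (~-refl K) (~-trans K (·-assoc _ _ _) (·-cong (~-refl K) (·-assoc _ _ _))))
          (~-sym K (·-assoc _ _ _))))

      -- A chain of `types K` steps has one more entry than there are types. Two entries coincide,
      -- and the loop between them makes the type at its start stable.
      factor : Spacious α → ∀ p → ∃ λ q → p < q ×
               ∃ λ (σ : Stretchable K) → seg α f p q ≈[ K ] ⟦ Stretchable.whole σ ⟧
      factor room p =
        let m = types K
            _ , add = room m p
            q , p<q , _ , lim = Add⇒Lim m add
            e , w , seg≈ , step , ne = chain m p<q lim
            i , j , i<j , code≡ = pigeonhole (ℕ.n<1+n m) (λ i → code K ⟦ e (toℕ i) ⟧)
            σ , eq = stretch e w step ne (toℕ i) (toℕ j) i<j (ℕ.s≤s⁻¹ (toℕ<n j)) ⟪ code⇒≈ K _ _ code≡ ⟫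
        in q , p<q , σ , ≈-trans seg≈ (equiv eq)
        where
        stretch : ∀ {m} e w → (∀ i → i ℕ.< m → e i ~[ K ] w i · e (suc i) ^ω) → (∀ i → ∃ (on ⟦ e i ⟧)) →
                  ∀ i j → i ℕ.< j → j ℕ.≤ m → e i ~[ K ] e j →
                  ∃ λ (σ : Stretchable K) → e 0 ~[ K ] Stretchable.whole σ
        stretch {m} e w step ne i j i<j j≤m e≈ with ℕ.m≤n⇒∃[o]m+o≡n i<j
        ... | d , refl = let u , v , eq = context e w step i (ℕ.<⇒≤ (ℕ.<-≤-trans i<j j≤m)) in
          record { left = u ; core = e i ; right = v ; nonempty = ne i
                 ; stable = loop⇒ω-stable K e w i d
                     (~-trans K e≈ (~-reflexive K (cong e (sym (ℕ.+-suc i d)))))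
                     (λ t t≤d → step (i + t) (ℕ.≤-trans (s≤s (ℕ.+-monoʳ-≤ i t≤d)) j≤m)) } , eq

      factor-beyond : Spacious α → ∀ p b → ∃ λ q → p < q × b ≤ q ×
                      ∃ λ (σ : Stretchable K) → seg α f p q ≈[ K ] ⟦ Stretchable.whole σ ⟧
      factor-beyond room p b with <⊎≥ p b
      ... | inj₂ b≤p = let q , p<q , rest = factor room p in q , p<q , ≤-trans b≤p (<⇒≤ p<q) , rest
      ... | inj₁ p<b =
        let q , b<q , σ , e = factor room b
            open Stretchable σ
            ρ , e′ = classify α f K p b
        in q , <-trans p<b b<q , <⇒≤ b<q ,
           record { left = ρ · left ; core = core ; right = right ; nonempty = nonempty ; stable = stable } ,
           ≈-trans (seg-· α f ρ whole (<⇒≤ p<b) (<⇒≤ b<q) e′ e) (equiv (~-sym K (·-assoc ρ left _)))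

    module _ (k : ℕ) (i₀ : Fin n) (room : Spacious α) where

      fill-beyond : (σ : Stretchable (suc k)) → ∀ x b →
                    ∃ λ y → x ≤ y × b ≤ y × Fills α (suc k) (Stretchable.whole σ) x y
      fill-beyond σ x b =
        let open Stretchable σ
            y₁ , x≤y₁ , fill₁ = realise α (suc k) i₀ room left x
            y₂ , b≤y₂ , y₁≤y₂ , fill₂ = LongWords.long α k i₀ room core nonempty idem (~-sym (suc k) stable) y₁ b
            y₃ , y₂≤y₃ , fill₃ = realise α (suc k) i₀ room right y₂
        in y₃ , ≤-trans x≤y₁ (≤-trans y₁≤y₂ y₂≤y₃) , ≤-trans b≤y₂ y₂≤y₃ ,
           fills-· α (suc k) left (core · right) x≤y₁ (≤-trans y₁≤y₂ y₂≤y₃) fill₁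
             (fills-· α (suc k) core right y₁≤y₂ y₂≤y₃ fill₂ fill₃)

    -- This is the condition of `IsCofinal` for ω, so a cofinal ω-sequence can be passed on as it
    -- is.
    Unbounded : (ℕ → Carrier α) → Set a
    Unbounded c = ∀ p → ∃ λ i → ¬ c i < p

    tail-partition : ∀ {c d} → Unbounded d → (∀ i → c i < c (suc i)) → (∀ i → d i ≤ c (suc i)) →
                     Partition α c (λ z → c 0 ≤ z)
    tail-partition {c} unb strict beyond = record
      { mono = λ i → <⇒≤ (strict i) ; above = id
      ; below = λ {z} _ → let i , p≤d = unb z in
          suc (suc i) , ≤-<-trans (≤-trans p≤d (beyond i)) (strict (suc i))
      ; onto = λ c≤z _ → c≤z }

  module _ (α : Ordinal a) (β : Ordinal b) (i₀ : Fin n) (k : ℕ)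
           (α-room : Spacious α) (β-room : Spacious β) where
    private
      module A = Order α
      module B = Order β
      K = suc k

    abstract
      match-segment : ∀ x y f (x′ : Carrier β) → ∃ λ y′ → x′ B.≤ y′ × ∃ λ g →
                      seg α f x y ≈[ K ] seg β g x′ y′
      match-segment x y f x′ =
        let τ , e = classify α f K x y
            y′ , x′≤y′ , g , e′ = realise β K i₀ β-room τ x′
        in y′ , x′≤y′ , g , ≈-trans e (≈-sym e′)

      -- The word is cut into ω pieces, the one with index `i` ending at or beyond `c i`. Each piece
      -- has a stretchable factor, so its type is also realised in β by a word ending at or beyond
      -- `d i`. Cofinality ω on both sides ensures that the pieces exhaust the two tails.
      match-tail : ∀ {c d} → Unbounded α c → Unbounded β d → ∀ x f (x′ : Carrier β) →
                   ∃ λ g → tail α f x ≈[ K ] tail β g x′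
      match-tail {c} {d} c-unb d-unb x f x′ =
        let g , agree = glue β v (λ i → B.<⇒≤ (v-strict i)) (λ i → proj₁ (v-fill i)) in
        g , partition-≈ (tail-partition α c-unb u-strict u-beyond) (tail-partition β d-unb v-strict v-beyond)
              (λ i → ≈-trans (u-word i) (≈-sym (≈-trans (seg-cong β (agree i)) (proj₂ (v-fill i)))))
        where
        next : ∀ p i → ∃ λ q → p A.< q × c i A.≤ q ×
               ∃ λ (σ : Stretchable K) → seg α f p q ≈[ K ] ⟦ Stretchable.whole σ ⟧
        next p i = factor-beyond α f k α-room p (c i)
        u : ℕ → Carrier α
        u zero    = x
        u (suc i) = proj₁ (next (u i) i)
        u-strict : ∀ i → u i A.< u (suc i)
        u-strict i = proj₁ (proj₂ (next (u i) i))
        u-beyond : ∀ i → c i A.≤ u (suc i)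
        u-beyond i = proj₁ (proj₂ (proj₂ (next (u i) i)))
        σ : ℕ → Stretchable K
        σ i = proj₁ (proj₂ (proj₂ (proj₂ (next (u i) i))))
        u-word : ∀ i → seg α f (u i) (u (suc i)) ≈[ K ] ⟦ Stretchable.whole (σ i) ⟧
        u-word i = proj₂ (proj₂ (proj₂ (proj₂ (next (u i) i))))
        next′ : ∀ q i → ∃ λ y → q B.≤ y × d i B.≤ y × Fills β K (Stretchable.whole (σ i)) q y
        next′ q i = fill-beyond β k i₀ β-room (σ i) q (d i)
        v : ℕ → Carrier β
        v zero    = x′
        v (suc i) = proj₁ (next′ (v i) i)
        v-beyond : ∀ i → d i B.≤ v (suc i)
        v-beyond i = proj₁ (proj₂ (proj₂ (next′ (v i) i)))
        v-fill : ∀ i → Fills β K (Stretchable.whole (σ i)) (v i) (v (suc i))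
        v-fill i = proj₂ (proj₂ (proj₂ (next′ (v i) i)))
        -- The piece in α is nonempty, and rank `K`, being positive, carries this over to β.
        v-strict : ∀ i → v i B.< v (suc i)
        v-strict i =
          let _ , v≤z , z<v = ≈-nonempty (≈-trans (u-word i) (≈-sym (proj₂ (v-fill i)))) (u i , A.≤-refl , u-strict i)
          in B.≤-<-trans v≤z z<v

-- The game on the tree.

module TreeGame (em : ∀ {ℓ : Level} → ExcludedMiddle ℓ) (n : ℕ) where

  open import Data.Fin using (_≟_)
  open import Data.Irrelevant using ([_])
  open import Data.Refinement using (value; _,_)
  open import Data.Vec.Functional using (Vector) renaming (_∷_ to _∷ᵛ_)
  open import Relation.Binary.Structures using (IsEquivalence)
  open Classical em
  open Words em n

  Node : Ordinal a → Set a
  Node α = Carrier α × (Carrier α → Fin n)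

  module _ (α : Ordinal a) where
    open Order α

    Extends Prefix : Carrier α → Node α → Node α → Set a
    Prefix  x (l , f) (m , g) = l ≤ m × (∀ z → x ≤ z → z < l → f z ≡ g z)
    Extends x (l , f) (m , g) = m ≤ l × (∀ z → x ≤ z → z < m → f z ≡ g z)

    IsChild : IsLimit α → Fin n → Carrier α → Node α → Node α → Set a
    IsChild lim i x (l , f) (m , g) = m ≡ proj₁ (lim l) × g l ≡ i × (∀ z → x ≤ z → z < l → f z ≡ g z)

    infix 4 _≗_
    _≗_ : Node α → Node α → Set a
    (l , f) ≗ (m , g) = l ≡ m × (∀ z → z < l → f z ≡ g z)

  module Skeleton (α : Ordinal a) (α-lim : IsLimit α) (β : Ordinal b) (β-lim : IsLimit β)
                  (Same : Carrier α → Carrier β → Set ℓ) where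
    private
      module A = Order α
      module B = Order β

    next-α : Carrier α → Carrier α
    next-α x = proj₁ (α-lim x)

    next-β : Carrier β → Carrier β
    next-β x = proj₁ (β-lim x)

    -- A later node may leave a stem at any of its positions, so paired positions must also have
    -- indistinguishable cones; `Same` stands for this.
    Match : (Carrier α → Fin n) → (Carrier β → Fin n) → Carrier α → Carrier β → Set ℓ
    Match f g x y = f x ≡ g y × Same x y

    SegEF : ℕ → (f : Carrier α → Fin n) (g : Carrier β → Fin n) →
            (x y : Carrier α) (x′ y′ : Carrier β) → Set (a ⊔ b ⊔ ℓ)
    SegEF k f g x y x′ y′ =
      EF α β (Match f g) k (λ z → x A.≤ z × z A.< y) (λ z → x′ B.≤ z × z B.< y′)

    -- Sim k ρ ρ′ x x′ V: in the cones above two nodes of lengths x and x′, the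
    -- nodes ρ j and ρ′ j with V j span trees of the same shape, whose edges are
    -- words that cannot be told apart in k rounds.
    data Sim (k : ℕ) {m : ℕ} (ρ : Fin m → Node α) (ρ′ : Fin m → Node β) :
             Carrier α → Carrier β → (Fin m → Set) → Set (lsuc 0ℓ ⊔ a ⊔ b ⊔ ℓ) where
      none : ∀ {x x′ V} → Same x x′ → (∀ j → ¬ V j) → Sim k ρ ρ′ x x′ V
      node : ∀ {x x′ V} y y′ f f′ → x A.≤ y → x′ B.≤ y′ → SegEF k f f′ x y x′ y′ → Same y y′ →
             (∀ j → V j → Extends α x (ρ j) (y , f) × Extends β x′ (ρ′ j) (y′ , f′)) →
             (W : Fin n → Fin m → Set) →
             (∀ j → V j → (proj₁ (ρ j) ≡ y × proj₁ (ρ′ j) ≡ y′) ⊎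
                (∃ λ i → (y A.< proj₁ (ρ j) × proj₂ (ρ j) y ≡ i) ×
                         (y′ B.< proj₁ (ρ′ j) × proj₂ (ρ′ j) y′ ≡ i) × W i j)) →
             (∀ i → Sim k ρ ρ′ (next-α y) (next-β y′) (W i)) →
             Sim k ρ ρ′ x x′ V

    Sim-resp : ∀ {k m x x′ V} {ρ σ : Fin m → Node α} {ρ′ σ′ : Fin m → Node β} →
               (∀ j → _≗_ α (ρ j) (σ j)) → (∀ j → _≗_ β (ρ′ j) (σ′ j)) →
               Sim k ρ ρ′ x x′ V → Sim k σ σ′ x x′ V
    Sim-resp e e′ (none s ¬V) = none s ¬V
    Sim-resp {V = V} {ρ} {σ} {ρ′} {σ′} e e′ (node y y′ f f′ x≤y x′≤y′ play s thr W split children) =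
      node y y′ f f′ x≤y x′≤y′ play s
        (λ j v → let (y≤l , h) , (y′≤l′ , h′) = thr j v in
          (subst (y A.≤_) (proj₁ (e j)) y≤l , λ z x≤z z<y → trans (sym (proj₂ (e j) z (A.<-≤-trans z<y y≤l))) (h z x≤z z<y)) ,
          (subst (y′ B.≤_) (proj₁ (e′ j)) y′≤l′ , λ z x≤z z<y → trans (sym (proj₂ (e′ j) z (B.<-≤-trans z<y y′≤l′))) (h′ z x≤z z<y)))
        W split′ (λ i → Sim-resp e e′ (children i))
      where
      split′ : ∀ j → V j → (proj₁ (σ j) ≡ y × proj₁ (σ′ j) ≡ y′) ⊎
                (∃ λ i → (y A.< proj₁ (σ j) × proj₂ (σ j) y ≡ i) ×
                         (y′ B.< proj₁ (σ′ j) × proj₂ (σ′ j) y′ ≡ i) × W i j)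
      split′ j v with split j v
      ... | inj₁ (p , q) = inj₁ (trans (sym (proj₁ (e j))) p , trans (sym (proj₁ (e′ j))) q)
      ... | inj₂ (i , (p , q) , (p′ , q′) , w) = inj₂ (i ,
              (subst (y A.<_) (proj₁ (e j)) p , trans (sym (proj₂ (e j) y p)) q) ,
              (subst (y′ B.<_) (proj₁ (e′ j)) p′ , trans (sym (proj₂ (e′ j) y′ p′)) q′) , w)

    -- For the subtrees that the new node does not enter: they lose a round, and index `zero` is not
    -- in their set.
    weak : ∀ {k m x x′ V} {ρ : Fin m → Node α} {ρ′ : Fin m → Node β} (c : Node α) (c′ : Node β) →
           Sim (suc k) ρ ρ′ x x′ V → ∀ V₊ → ¬ V₊ zero → (∀ j → V₊ (suc j) → V j) →
           Sim k (c ∷ᵛ ρ) (c′ ∷ᵛ ρ′) x x′ V₊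
    weak c c′ (none s ¬V) V₊ ¬0 V₊⇒V = none s λ { zero → ¬0 ; (suc j) v → ¬V j (V₊⇒V j v) }
    weak {k} c c′ (node y y′ f f′ x≤y x′≤y′ play s thr W split children) V₊ ¬0 V₊⇒V =
      node y y′ f f′ x≤y x′≤y′ (EF-pred k play) s
        (λ { zero v → ⊥-elim (¬0 v) ; (suc j) v → thr j (V₊⇒V j v) })
        W₊ (λ { zero v → ⊥-elim (¬0 v) ; (suc j) v → split j (V₊⇒V j v) })
        (λ i → weak c c′ (children i) (W₊ i) (λ ()) (λ _ w → w))
      where
      W₊ : Fin n → Fin _ → Set
      W₊ i zero    = ⊥
      W₊ i (suc j) = W i j

    Sim-pred : ∀ {k m x x′ V} {ρ : Fin m → Node α} {ρ′ : Fin m → Node β} →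
               Sim (suc k) ρ ρ′ x x′ V → Sim k ρ ρ′ x x′ V
    Sim-pred (none s ¬V) = none s ¬V
    Sim-pred {k} (node y y′ f f′ x≤y x′≤y′ play s thr W split children) =
      node y y′ f f′ x≤y x′≤y′ (EF-pred k play) s thr W split (λ i → Sim-pred (children i))

    module Forth (same-next : ∀ {x x′} → Same x x′ → Same (next-α x) (next-β x′))
                 (respond : ∀ k {x x′} → Same x x′ → ∀ y f → x A.≤ y →
                    ∃₂ λ y′ f′ → x′ B.≤ y′ × Same y y′ × SegEF k f f′ x y x′ y′) where

      α-next< : ∀ z → z A.< next-α z
      α-next< z = proj₁ (proj₂ (α-lim z))

      β-next< : ∀ z → z B.< next-β z
      β-next< z = proj₁ (proj₂ (β-lim z))

      α-next≤ : ∀ {z w} → z A.< w → next-α z A.≤ w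
      α-next≤ = A.Succ⇒≤ (proj₂ (α-lim _))

      β-next≤ : ∀ {z w} → z B.< w → next-β z B.≤ w
      β-next≤ = B.Succ⇒≤ (proj₂ (β-lim _))

      -- `V₊` stays universally quantified because a recursive call in the cone of a child has to
      -- return a position for the index set formed by its caller.
      Answer : ∀ (k : ℕ) {m} (ρ : Fin m → Node α) (ρ′ : Fin m → Node β) → Carrier α → Carrier β →
               (Fin m → Set) → Node α → (Carrier β → Fin n) → Set _
      Answer k ρ ρ′ x x′ V c h′ = ∃ λ c′ → x′ B.≤ proj₁ c′ × (∀ z → z B.< x′ → proj₂ c′ z ≡ h′ z) ×
        (∀ V₊ → (∀ j → V₊ (suc j) → V j) → Sim k (c ∷ᵛ ρ) (c′ ∷ᵛ ρ′) x x′ V₊)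

      -- h′ is the word of the node at the base of the cone, which the reply extends.
      forth : ∀ {k m x x′ V} {ρ : Fin m → Node α} {ρ′ : Fin m → Node β} →
              Sim (suc k) ρ ρ′ x x′ V → ∀ c → x A.≤ proj₁ c → ∀ h′ → Answer k ρ ρ′ x x′ V c h′

      leaf : ∀ {k m x x′ y y′ V₊} {f f′} {ρ : Fin m → Node α} {ρ′ : Fin m → Node β} {c : Node α} {c′ : Node β} →
             c ≡ (y , f) → c′ ≡ (y′ , f′) →
             x A.≤ y → x′ B.≤ y′ → SegEF k f f′ x y x′ y′ → Same y y′ → (∀ j → ¬ V₊ (suc j)) →
             Sim k (c ∷ᵛ ρ) (c′ ∷ᵛ ρ′) x x′ V₊
      leaf {y = y} {y′} {f = f} {f′} refl refl x≤y x′≤y′ play s ¬V =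
        node y y′ f f′ x≤y x′≤y′ play s
          (λ { zero _ → (A.≤-refl , λ _ _ _ → refl) , (B.≤-refl , λ _ _ _ → refl) ; (suc j) v → ⊥-elim (¬V j v) })
          (λ _ _ → ⊥) (λ { zero _ → inj₁ (refl , refl) ; (suc j) v → ⊥-elim (¬V j v) })
          (λ _ → none (same-next s) λ _ ())

      forth {k} {x = x} {x′} (none s ¬V) (l , g) x≤l h′ =
        let l′ , f′ , x′≤l′ , s′ , play = respond k s l g x≤l in
        (l′ , splice β x′ h′ f′) , x′≤l′ , (λ z → splice-< β) , λ V₊ V₊⇒V →
          leaf refl refl x≤l x′≤l′
            (EF-map k id id id id (λ { _ (x′≤z , _) (p , q) → trans p (sym (splice-≥ β x′≤z)) , q }) play) s′
            (λ j v → ¬V j (V₊⇒V j v))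
      forth {k} {m} {x} {x′} {V} {ρ} {ρ′} (node y y′ f f′ x≤y x′≤y′ play s thr W split children) (l , g) x≤l h′
        with em {P = ∃ λ z → x A.≤ z × z A.< y × z A.≤ l × (l ≡ z ⊎ ¬ g z ≡ f z)}
      -- The new node follows the whole stem: it ends at the tip `y` or enters the cone of the child
      -- given by its letter there.
      ... | no agree = along
        where
        y≤l : y A.≤ l
        y≤l l<y = agree (l , x≤l , l<y , A.≤-refl , inj₁ refl)
        g≡f : ∀ z → x A.≤ z → z A.< y → g z ≡ f z
        g≡f z x≤z z<y = dne λ g≢f → agree (z , x≤z , z<y , A.<⇒≤ (A.<-≤-trans z<y y≤l) , inj₂ g≢f)
        along : Answer k ρ ρ′ x x′ V (l , g) h′
        along with A.≤⇒<⊎≡ y≤l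
        ... | inj₂ refl = (y′ , splice β x′ h′ f′) , x′≤y′ , (λ z → splice-< β) , λ V₊ V₊⇒V →
          node y y′ f f′ x≤y x′≤y′ (EF-pred k play) s
            (λ { zero _ → (A.≤-refl , g≡f) , (B.≤-refl , λ z x′≤z _ → splice-≥ β x′≤z)
               ; (suc j) v → thr j (V₊⇒V j v) })
            W₊ (λ { zero _ → inj₁ (refl , refl) ; (suc j) v → split j (V₊⇒V j v) })
            (λ i → weak _ _ (children i) (W₊ i) (λ ()) (λ _ w → w))
          where
          W₊ : Fin n → Fin (suc m) → Set
          W₊ i zero    = ⊥
          W₊ i (suc j) = W i j
        ... | inj₁ y<l =
          let c′ , y′<l′ , agree′ , sim = forth (children (g y)) (l , g) (α-next≤ y<l) h″ in
          c′ , B.<⇒≤ (B.<-≤-trans (B.≤-<-trans x′≤y′ (β-next< y′)) y′<l′) ,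
          (λ z z<x′ → trans (agree′ z (B.<-trans (B.<-≤-trans z<x′ x′≤y′) (β-next< y′))) (splice-< β z<x′)) ,
          λ V₊ V₊⇒V →
          node y y′ f f′ x≤y x′≤y′ (EF-pred k play) s
            (λ { zero _ → (y≤l , g≡f) , (B.<⇒≤ (B.<-≤-trans (β-next< y′) y′<l′) , λ z x′≤z z<y′ →
                   trans (agree′ z (B.<-trans z<y′ (β-next< y′))) (trans (splice-≥ β x′≤z) (splice-< β z<y′)))
               ; (suc j) v → thr j (V₊⇒V j v) })
            W₊ (λ { zero _ → inj₂ (g y , (y<l , refl) , (B.<-≤-trans (β-next< y′) y′<l′ ,
                      trans (agree′ y′ (β-next< y′)) (trans (splice-≥ β x′≤y′) (splice-≥ β B.≤-refl))) , refl)
                  ; (suc j) v → split j (V₊⇒V j v) })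
            (λ i → child i c′ sim (g y ≟ i))
          where
          h″ : Carrier β → Fin n
          h″ = splice β x′ h′ (splice β y′ f′ (λ _ → g y))
          W₊ : Fin n → Fin (suc m) → Set
          W₊ i zero    = g y ≡ i
          W₊ i (suc j) = W i j
          child : ∀ i c′ → (∀ V₊ → (∀ j → V₊ (suc j) → W (g y) j) →
                    Sim k ((l , g) ∷ᵛ ρ) (c′ ∷ᵛ ρ′) (next-α y) (next-β y′) V₊) →
                  Dec (g y ≡ i) → Sim k ((l , g) ∷ᵛ ρ) (c′ ∷ᵛ ρ′) (next-α y) (next-β y′) (W₊ i)
          child i c′ sim (yes refl) = sim (W₊ i) (λ _ w → w)
          child i c′ sim (no g≢i)   = weak _ _ (children i) (W₊ i) g≢i (λ _ w → w)
      -- At the least such `z` the new node ends or takes another letter. The reply `z′` to `z` in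
      -- the game on the stem cuts both stems, and `efˡ` and `efʳ` become the games on the two
      -- shorter edges.
      ... | yes deviates = branch (least α _ deviates)
        where
        branch : (∃ λ z → (x A.≤ z × z A.< y × z A.≤ l × (l ≡ z ⊎ ¬ g z ≡ f z)) ×
                   (∀ w → x A.≤ w × w A.< y × w A.≤ l × (l ≡ w ⊎ ¬ g w ≡ f w) → z A.≤ w)) →
                 Answer k ρ ρ′ x x′ V (l , g) h′
        branch (z , (x≤z , z<y , z≤l , dev) , first) with proj₁ play z (x≤z , z<y)
        ... | z′ , (x′≤z′ , z′<y′) , (fz≡ , same-z) , efˡ , efʳ = answer (refine dev)
          where
          g≡f : ∀ w → x A.≤ w → w A.< z → g w ≡ f w
          g≡f w x≤w w<z = dne λ g≢f → first w
            (x≤w , A.<-trans w<z z<y , A.<⇒≤ (A.<-≤-trans w<z z≤l) , inj₂ g≢f) w<z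
          efˡ′ : SegEF k f f′ x z x′ z′
          efˡ′ = EF-resp k (λ ((p , _) , q) → p , q) (λ (p , q) → (p , A.<-trans q z<y) , q)
                           (λ ((p , _) , q) → p , q) (λ (p , q) → (p , B.<-trans q z′<y′) , q) efˡ
          efʳ′ : SegEF k f f′ (next-α z) y (next-β z′) y′
          efʳ′ = EF-resp k (λ ((p , q) , r) → α-next≤ r , q)
                           (λ (p , q) → (A.<⇒≤ (A.≤-<-trans x≤z (A.<-≤-trans (α-next< z) p)) , q) , A.<-≤-trans (α-next< z) p)
                           (λ ((p , q) , r) → β-next≤ r , q)
                           (λ (p , q) → (B.<⇒≤ (B.≤-<-trans x′≤z′ (B.<-≤-trans (β-next< z′) p)) , q) , B.<-≤-trans (β-next< z′) p)
                           efʳ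
          -- The old stem beyond `z` becomes the edge of the child in direction `f z`.
          rest : ∀ c c′ V₊ → ¬ V₊ zero → (∀ j → V₊ (suc j) → V j) →
                 Sim k (c ∷ᵛ ρ) (c′ ∷ᵛ ρ′) (next-α z) (next-β z′) V₊
          rest c c′ V₊ ¬0 V₊⇒V = node y y′ f f′ (α-next≤ z<y) (β-next≤ z′<y′) efʳ′ s
            (λ { zero v → ⊥-elim (¬0 v)
               ; (suc j) v → let (p , q) , (p′ , q′) = thr j (V₊⇒V j v) in
                   (p , λ w z≤w → q w (A.<⇒≤ (A.≤-<-trans x≤z (A.<-≤-trans (α-next< z) z≤w)))) ,
                   (p′ , λ w z≤w → q′ w (B.<⇒≤ (B.≤-<-trans x′≤z′ (B.<-≤-trans (β-next< z′) z≤w)))) })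
            W₊ (λ { zero v → ⊥-elim (¬0 v) ; (suc j) v → split j (V₊⇒V j v) })
            (λ i → weak _ _ (children i) (W₊ i) (λ ()) (λ _ w → w))
            where
            W₊ : Fin n → Fin (suc m) → Set
            W₊ i zero    = ⊥
            W₊ i (suc j) = W i j

          thr-z : ∀ j → V j → Extends α x (ρ j) (z , f) × Extends β x′ (ρ′ j) (z′ , f′)
          thr-z j v = let (p , q) , (p′ , q′) = thr j v in
            (A.<⇒≤ (A.<-≤-trans z<y p) , λ w x≤w w<z → q w x≤w (A.<-trans w<z z<y)) ,
            (B.<⇒≤ (B.<-≤-trans z′<y′ p′) , λ w x≤w w<z → q′ w x≤w (B.<-trans w<z z′<y′))

          old : ∀ {ℓ} {X : Set ℓ} j → (v : V j) → X ⊎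
                (∃ λ i → (z A.< proj₁ (ρ j) × proj₂ (ρ j) z ≡ i) ×
                         (z′ B.< proj₁ (ρ′ j) × proj₂ (ρ′ j) z′ ≡ i) × (V j × f z ≡ i))
          old j v = let (p , q) , (p′ , q′) = thr j v in
            inj₂ (f z , (A.<-≤-trans z<y p , q z x≤z z<y) ,
                  (B.<-≤-trans z′<y′ p′ , trans (q′ z′ x′≤z′ z′<y′) (sym fz≡)) , v , refl)

          refine : l ≡ z ⊎ ¬ g z ≡ f z → l ≡ z ⊎ (z A.< l × ¬ g z ≡ f z)
          refine (inj₁ l≡z) = inj₁ l≡z
          refine (inj₂ g≢f) with A.≤⇒<⊎≡ z≤l
          ... | inj₁ z<l = inj₂ (z<l , g≢f)
          ... | inj₂ z≡l = inj₁ (sym z≡l)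

          answer : l ≡ z ⊎ (z A.< l × ¬ g z ≡ f z) → Answer k ρ ρ′ x x′ V (l , g) h′
          answer (inj₁ refl) = (z′ , splice β x′ h′ f′) , x′≤z′ , (λ w → splice-< β) , λ V₊ V₊⇒V →
            node z z′ f f′ x≤z x′≤z′ efˡ′ same-z
              (λ { zero _ → (A.≤-refl , g≡f) , (B.≤-refl , λ w x′≤w _ → splice-≥ β x′≤w)
                 ; (suc j) v → thr-z j (V₊⇒V j v) })
              W₊ (λ { zero _ → inj₁ (refl , refl) ; (suc j) v → old j (V₊⇒V j v) })
              (λ i → child i (f z ≟ i))
            where
            W₊ : Fin n → Fin (suc m) → Set
            W₊ i zero    = ⊥
            W₊ i (suc j) = V j × f z ≡ i
            child : ∀ i → Dec (f z ≡ i) →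
                    Sim k ((l , g) ∷ᵛ ρ) ((z′ , splice β x′ h′ f′) ∷ᵛ ρ′) (next-α z) (next-β z′) (W₊ i)
            child i (yes refl) = rest _ _ (W₊ i) (λ ()) (λ _ → proj₁)
            child i (no f≢i)   = none (same-next same-z) λ { zero () ; (suc j) (_ , e) → f≢i e }
          answer (inj₂ (z<l , g≢f)) = (l′ , H) , x′≤l′ , (λ w → splice-< β) , λ V₊ V₊⇒V →
            node z z′ f f′ x≤z x′≤z′ efˡ′ same-z
              (λ { zero _ → (z≤l , g≡f) , (B.<⇒≤ z′<l′ , λ w x′≤w w<z′ → trans (splice-≥ β x′≤w) (splice-< β w<z′))
                 ; (suc j) v → thr-z j (V₊⇒V j v) })
              W₊ (λ { zero _ → inj₂ (g z , (z<l , refl) , (z′<l′ , Hz′) , refl)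
                    ; (suc j) v → old j (V₊⇒V j v) })
              (λ i → child i (f z ≟ i) (g z ≟ i))
            where
            reply : ∃₂ λ y′ f″ → next-β z′ B.≤ y′ × Same l y′ × SegEF k g f″ (next-α z) l (next-β z′) y′
            reply = respond k (same-next same-z) l g (α-next≤ z<l)
            l′ : Carrier β
            l′ = proj₁ reply
            f″ H : Carrier β → Fin n
            f″ = proj₁ (proj₂ reply)
            H  = splice β x′ h′ (splice β z′ f′ (splice β (next-β z′) (λ _ → g z) f″))
            next≤l′ : next-β z′ B.≤ l′
            next≤l′ = proj₁ (proj₂ (proj₂ reply))
            z′<l′ : z′ B.< l′
            z′<l′ = B.<-≤-trans (β-next< z′) next≤l′
            x′≤l′ : x′ B.≤ l′
            x′≤l′ = B.<⇒≤ (B.≤-<-trans x′≤z′ z′<l′)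
            Hz′ : H z′ ≡ g z
            Hz′ = trans (splice-≥ β x′≤z′) (trans (splice-≥ β B.≤-refl) (splice-< β (β-next< z′)))
            H≡f″ : ∀ {w} → next-β z′ B.≤ w → f″ w ≡ H w
            H≡f″ n≤w = sym (trans (splice-≥ β (B.<⇒≤ (B.≤-<-trans x′≤z′ (B.<-≤-trans (β-next< z′) n≤w))))
                             (trans (splice-≥ β (B.<⇒≤ (B.<-≤-trans (β-next< z′) n≤w))) (splice-≥ β n≤w)))
            W₊ : Fin n → Fin (suc m) → Set
            W₊ i zero    = g z ≡ i
            W₊ i (suc j) = V j × f z ≡ i
            child : ∀ i → Dec (f z ≡ i) → Dec (g z ≡ i) →
                    Sim k ((l , g) ∷ᵛ ρ) ((l′ , H) ∷ᵛ ρ′) (next-α z) (next-β z′) (W₊ i)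
            child i (yes refl) _ = rest _ _ (W₊ i) g≢f (λ _ → proj₁)
            child i (no f≢i) (yes refl) = leaf refl refl (α-next≤ z<l) next≤l′
              (EF-map k id id id id (λ { _ (n≤w , _) (p , q) → trans p (H≡f″ n≤w) , q })
                (proj₂ (proj₂ (proj₂ (proj₂ reply)))))
              (proj₁ (proj₂ (proj₂ (proj₂ reply)))) (λ j (_ , e) → f≢i e)
            child i (no f≢i) (no g≢i) = none (same-next same-z) λ { zero → g≢i ; (suc j) (_ , e) → f≢i e }

    preserves-prefix : ∀ {k m x x′ V} {ρ : Fin m → Node α} {ρ′ : Fin m → Node β} →
      Sim k ρ ρ′ x x′ V → ∀ u v → V u → V v → Prefix α x (ρ u) (ρ v) → Prefix β x′ (ρ′ u) (ρ′ v)
    preserves-prefix (none _ ¬V) u v Vu _ _ = ⊥-elim (¬V u Vu)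
    preserves-prefix {x = x} {x′} {ρ = ρ} {ρ′} (node y y′ f f′ x≤y x′≤y′ play s thr W split children) u v Vu Vv (l≤m , g≡h)
      with split u Vu | split v Vv | thr u Vu | thr v Vv
    ... | inj₁ (_ , refl) | _ | _ , (_ , p) | _ , (y≤m , q) = y≤m , λ z x≤z z<l → trans (p z x≤z z<l) (sym (q z x≤z z<l))
    ... | inj₂ (i , (y<l , _) , _) | inj₁ (refl , _) | _ | _ = ⊥-elim (l≤m y<l)
    ... | inj₂ (i , (y<l , gy) , (_ , gy′) , Wu) | inj₂ (j , (y<m , hy) , (_ , hy′) , Wv) | _ , (y≤l , p) | _ , (_ , q)
      with trans (sym gy) (trans (g≡h y x≤y y<l) hy)
    ...   | refl =
      let l′≤m′ , e = preserves-prefix (children i) u v Wu Wv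
            (l≤m , λ z y≤z → g≡h z (A.<⇒≤ (A.≤-<-trans x≤y (A.<-≤-trans (proj₁ (proj₂ (α-lim y))) y≤z))))
      in l′≤m′ , λ z x≤z z<l′ → agree z x≤z z<l′ e
      where
      agree : ∀ z → x′ B.≤ z → z B.< proj₁ (ρ′ u) →
              (∀ z → next-β y′ B.≤ z → z B.< proj₁ (ρ′ u) → proj₂ (ρ′ u) z ≡ proj₂ (ρ′ v) z) →
              proj₂ (ρ′ u) z ≡ proj₂ (ρ′ v) z
      agree z x≤z z<l′ e with B.compare z y′
      ... | tri< z<y′ _ _ = trans (p z x≤z z<y′) (sym (q z x≤z z<y′))
      ... | tri≈ _ refl _ = trans gy′ (sym hy′)
      ... | tri> _ _ y′<z = e z (B.Succ⇒≤ (proj₂ (β-lim y′)) y′<z) z<l′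

    -- One round is kept for this: if the edge is empty in α, a point on the edge in β would be a
    -- move without a reply.
    ends-at-start : ∀ {k m x x′ V} {ρ : Fin m → Node α} {ρ′ : Fin m → Node β} →
      Sim (suc k) ρ ρ′ x x′ V → ∀ v → V v → proj₁ (ρ v) ≡ x → proj₁ (ρ′ v) ≡ x′
    ends-at-start (none _ ¬V) v Vv _ = ⊥-elim (¬V v Vv)
    ends-at-start {x = x} {x′} {ρ′ = ρ′} (node y y′ f f′ x≤y x′≤y′ play s thr W split children) v Vv refl
      with A.≤-antisym x≤y (proj₁ (proj₁ (thr v Vv)))
    ... | refl with split v Vv
    ...   | inj₂ (_ , (x<x , _) , _) = ⊥-elim (A.<-irrefl x<x)
    ...   | inj₁ (_ , refl) = sym (B.≤-antisym x′≤y′ λ x′<y′ →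
            let _ , (x≤z , z<x) , _ = proj₂ play x′ (B.≤-refl , x′<y′) in x≤z z<x)

    preserves-child : ∀ {k m x x′ V} {ρ : Fin m → Node α} {ρ′ : Fin m → Node β} →
      Sim (suc k) ρ ρ′ x x′ V → ∀ {i} u v → V u → V v →
      IsChild α α-lim i x (ρ u) (ρ v) → IsChild β β-lim i x′ (ρ′ u) (ρ′ v)
    preserves-child (none _ ¬V) u v Vu _ _ = ⊥-elim (¬V u Vu)
    preserves-child {x = x} {x′} {ρ = ρ} {ρ′} (node y y′ f f′ x≤y x′≤y′ play s thr W split children) u v Vu Vv (m≡ , hl , g≡h)
      with split u Vu | split v Vv | thr u Vu | thr v Vv
    ... | inj₁ (refl , refl) | inj₁ (m≡l , _) | _ | _ =
      ⊥-elim (A.irrefl (trans (sym m≡l) m≡) (proj₁ (proj₂ (α-lim _))))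
    ... | inj₁ (refl , refl) | inj₂ (j , (y<m , hy) , (y′<m′ , hy′) , Wv) | _ , (_ , p) | _ , (_ , q) =
      ends-at-start (children j) v Wv m≡ , trans hy′ (trans (sym hy) hl) ,
      λ z x≤z z<y → trans (p z x≤z z<y) (sym (q z x≤z z<y))
    ... | inj₂ (i , (y<l , _) , _) | inj₁ (refl , _) | _ | _ =
      ⊥-elim (A.<-irrefl (A.<-trans y<l (subst (proj₁ (ρ u) A.<_) (sym m≡) (proj₁ (proj₂ (α-lim _))))))
    ... | inj₂ (i , (y<l , gy) , (y′<l′ , gy′) , Wu) | inj₂ (j , (y<m , hy) , (_ , hy′) , Wv) | _ , (y≤l , p) | _ , (_ , q)
      with trans (sym gy) (trans (g≡h y x≤y y<l) hy)
    ...   | refl =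
      let m′≡ , hl′ , e = preserves-child (children i) u v Wu Wv
            (m≡ , hl , λ z y≤z → g≡h z (A.<⇒≤ (A.≤-<-trans x≤y (A.<-≤-trans (proj₁ (proj₂ (α-lim y))) y≤z))))
      in m′≡ , hl′ , λ z x≤z z<l′ → agree z x≤z z<l′ e
      where
      agree : ∀ z → x′ B.≤ z → z B.< proj₁ (ρ′ u) →
              (∀ z → next-β y′ B.≤ z → z B.< proj₁ (ρ′ u) → proj₂ (ρ′ u) z ≡ proj₂ (ρ′ v) z) →
              proj₂ (ρ′ u) z ≡ proj₂ (ρ′ v) z
      agree z x≤z z<l′ e with B.compare z y′
      ... | tri< z<y′ _ _ = trans (p z x≤z z<y′) (sym (q z x≤z z<y′))
      ... | tri≈ _ refl _ = trans gy′ (sym hy′)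
      ... | tri> _ _ y′<z = e z (B.Succ⇒≤ (proj₂ (β-lim y′)) y′<z) z<l′

  below : (α : Ordinal a) {l : Carrier α} (x : Carrier (α ↓ l)) → Ordinal._<_ α (value x) l
  below α {l} (x , [ p ]) = recompute (Ordinal._<?_ α x l) p

  module WordNodes (α : Ordinal a) (i₀ : Fin n) where
    open Order α

    -- Words as nodes: beyond its length a word is filled up with i₀.
    toNode : Word α n → Node α
    toNode (l , s) = l , total
      where
      total : Carrier α → Fin n
      total z with z <? l
      ... | yes z<l = s (z , [ z<l ])
      ... | no _    = i₀

    toNode-< : ∀ w {z} (p : z < proj₁ w) → proj₂ (toNode w) z ≡ proj₂ w (z , [ p ])
    toNode-< (l , s) {z} p with z <? l
    ... | yes _  = refl
    ... | no z≮l = ⊥-elim (z≮l p)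

    fromNode : Node α → Word α n
    fromNode (l , f) = l , λ x → f (value x)

    fromNode-≗ : ∀ c → _≗_ α c (toNode (fromNode c))
    fromNode-≗ c = refl , λ z z<l → sym (toNode-< (fromNode c) z<l)

    ⊆⇒Prefix : ∀ {v w} x → _⊆ʷ_ α n v w → Prefix α x (toNode v) (toNode w)
    ⊆⇒Prefix {l , s} {m , t} x v⊆w = l≤m , agree
      where
      l≤m : l ≤ m
      l≤m m<l with v⊆w (m , [ m<l ])
      ... | y , m≡y , _ = irrefl (sym m≡y) (below α y)
      agree : ∀ z → x ≤ z → z < l → _
      agree z _ z<l with v⊆w (z , [ z<l ])
      ... | y , refl , e = trans (toNode-< (l , s) z<l) (trans e (sym (toNode-< (m , t) (below α y))))

    module _ {x₀ : Carrier α} (x₀≤ : ∀ z → x₀ ≤ z) where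

      Prefix⇒⊆ : ∀ {v w} → Prefix α x₀ (toNode v) (toNode w) → _⊆ʷ_ α n v w
      Prefix⇒⊆ {l , s} {m , t} (l≤m , e) z =
        (value z , [ z<m ]) , refl , trans (sym (toNode-< (l , s) (below α z)))
          (trans (e (value z) (x₀≤ _) (below α z)) (toNode-< (m , t) z<m))
        where z<m = <-≤-trans (below α z) l≤m

      ≈⇒≗ : ∀ {v w} → _≈ʷ_ α n v w → _≗_ α (toNode v) (toNode w)
      ≈⇒≗ (p , q) = let l≤m , e = ⊆⇒Prefix x₀ p ; m≤l , _ = ⊆⇒Prefix x₀ q in
        ≤-antisym l≤m m≤l , λ z → e z (x₀≤ z)

      ≗⇒≈ : ∀ {v w} → _≗_ α (toNode v) (toNode w) → _≈ʷ_ α n v w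
      ≗⇒≈ {l , s} {.l , t} (refl , e) =
        Prefix⇒⊆ (≤-refl , λ z _ → e z) , Prefix⇒⊆ (≤-refl , λ z _ z<l → sym (e z z<l))

      module _ (lim : IsLimit α) where

        extend-< : ∀ i w {z} → z < proj₁ w → proj₂ (toNode (extend α n lim i w)) z ≡ proj₂ (toNode w) z
        extend-< i w@(l , s) {z} z<l = trans (toNode-< (extend α n lim i w) z<) (trans inside (sym (toNode-< w z<l)))
          where
          z< : z < proj₁ (lim l)
          z< = <-trans z<l (proj₁ (proj₂ (lim l)))
          inside : proj₂ (extend α n lim i w) (z , [ z< ]) ≡ s (z , [ z<l ])
          inside with compare z l
          ... | tri< _ _ _   = refl
          ... | tri≈ z≮l _ _ = ⊥-elim (z≮l z<l)
          ... | tri> z≮l _ _ = ⊥-elim (z≮l z<l)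

        extend-≡ : ∀ i w → proj₂ (toNode (extend α n lim i w)) (proj₁ w) ≡ i
        extend-≡ i w@(l , s) = trans (toNode-< (extend α n lim i w) (proj₁ (proj₂ (lim l)))) inside
          where
          inside : proj₂ (extend α n lim i w) (l , [ proj₁ (proj₂ (lim l)) ]) ≡ i
          inside with compare l l
          ... | tri< l<l _ _ = ⊥-elim (<-irrefl l<l)
          ... | tri≈ _ _ _   = refl
          ... | tri> _ _ _   = refl

        ≈extend⇒IsChild : ∀ {i v w} → _≈ʷ_ α n w (extend α n lim i v) → IsChild α lim i x₀ (toNode v) (toNode w)
        ≈extend⇒IsChild {i} {v} {w} w≈ =
          let m≡ , e = ≈⇒≗ {w} {extend α n lim i v} w≈
              <m = λ {z} z≤l → subst (z <_) (sym m≡) (≤-<-trans z≤l (proj₁ (proj₂ (lim (proj₁ v)))))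
          in m≡ , trans (e _ (<m ≤-refl)) (extend-≡ i v) ,
             λ z _ z<l → sym (trans (e z (<m (<⇒≤ z<l))) (extend-< i v z<l))

        IsChild⇒≈extend : ∀ {i v w} → IsChild α lim i x₀ (toNode v) (toNode w) → _≈ʷ_ α n w (extend α n lim i v)
        IsChild⇒≈extend {i} {v} {w} (m≡ , hl , g≡h) = ≗⇒≈ (m≡ , λ z z<m → agree z (subst (z <_) m≡ z<m))
          where
          agree : ∀ z → z < proj₁ (lim (proj₁ v)) → proj₂ (toNode w) z ≡ proj₂ (toNode (extend α n lim i v)) z
          agree z z< with ≤⇒<⊎≡ (<Succ⇒≤ (proj₂ (lim (proj₁ v))) z<)
          ... | inj₁ z<l  = trans (sym (g≡h z (x₀≤ z) z<l)) (sym (extend-< i v z<l))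
          ... | inj₂ refl = trans hl (sym (extend-≡ i v))

  -- Rounds reserved for a term: each application of `S` costs one round to name its argument and
  -- keeps one more for `preserves-child`.
  termSize : ∀ {m} → Term (Tree n) m → ℕ
  termSize (var _)         = 0
  termSize (func (S _) ts) = 2 + termSize (ts zero)

  rank : ∀ {m} → Formula (Tree n) m → ℕ
  rank (s ≐ t)     = 2 + termSize s + termSize t
  rank (rel ⊆ ts)  = 3 + termSize (ts zero) + termSize (ts (suc zero))
  rank (not φ)     = rank φ
  rank (φ and ψ)   = rank φ ℕ.⊔ rank ψ
  rank (exists φ)  = suc (rank φ)

  module Atoms (α : Ordinal a) (α-lim : IsLimit α) (β : Ordinal b) (β-lim : IsLimit β)
               (Same : Carrier α → Carrier β → Set ℓ) (i₀ : Fin n)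
               {x₀ : Carrier α} (x₀≤ : ∀ z → Order._≤_ α x₀ z)
               {y₀ : Carrier β} (y₀≤ : ∀ z → Order._≤_ β y₀ z) where

    private
      module A = WordNodes α i₀
      module B = WordNodes β i₀
      _≈A_ = _≈ʷ_ α n
      _≈B_ = _≈ʷ_ β n
    open Skeleton α α-lim β β-lim Same public

    Good : ∀ k {m} → (Fin m → Word α n) → (Fin m → Word β n) → Set _
    Good k ρ ρ′ = Sim k (A.toNode ∘ ρ) (B.toNode ∘ ρ′) x₀ y₀ (λ _ → ⊤)

    Good-down : ∀ {k l m} {ρ : Fin m → Word α n} {ρ′} → k ℕ.≤ l → Good l ρ ρ′ → Good k ρ ρ′
    Good-down {k} {l} k≤l g with ℕ.m≤n⇒m<n∨m≡n k≤l
    ... | inj₂ refl = g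
    Good-down {k} {suc l} k≤l g | inj₁ (s≤s k≤l′) = Good-down k≤l′ (Sim-pred g)

    preserves-⊆ : ∀ {k m} {ρ : Fin m → Word α n} {ρ′} → Good k ρ ρ′ → ∀ u v →
                  _⊆ʷ_ α n (ρ u) (ρ v) → _⊆ʷ_ β n (ρ′ u) (ρ′ v)
    preserves-⊆ g u v u⊆v = B.Prefix⇒⊆ y₀≤ (preserves-prefix g u v tt tt (A.⊆⇒Prefix x₀ u⊆v))

    preserves-≈ : ∀ {k m} {ρ : Fin m → Word α n} {ρ′} → Good k ρ ρ′ → ∀ u v → ρ u ≈A ρ v → ρ′ u ≈B ρ′ v
    preserves-≈ g u v (p , q) = preserves-⊆ g u v p , preserves-⊆ g v u q

    module Step (same-next : ∀ {x x′} → Same x x′ → Same (next-α x) (next-β x′))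
                (respond : ∀ k {x x′} → Same x x′ → ∀ y f → Order._≤_ α x y →
                   ∃₂ λ y′ f′ → Order._≤_ β x′ y′ × Same y y′ × SegEF k f f′ x y x′ y′) where

      step : ∀ {k m} {ρ : Fin m → Word α n} {ρ′} → Good (suc k) ρ ρ′ →
             ∀ w → ∃ λ w′ → Good k (w ∷ᵛ ρ) (w′ ∷ᵛ ρ′)
      step g w =
        let c′ , _ , _ , sim = Forth.forth same-next respond g (A.toNode w) (x₀≤ _) (λ _ → i₀) in
        B.fromNode c′ , Sim-resp (λ { zero → refl , λ _ _ → refl ; (suc j) → refl , λ _ _ → refl })
                                 (λ { zero → B.fromNode-≗ c′ ; (suc j) → refl , λ _ _ → refl })
                                 (sim _ (λ _ _ → tt))

      -- The game handles variables only, so Duplicator is made to answer the value of the argument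
      -- as a new node. The renaming `r` keeps track of the environment as it grows.
      follow : ∀ {l} (t : Term (Tree n) l) {k m} {ρ : Fin m → Word α n} {ρ′} (r : Fin l → Fin m) v →
               termSize t ℕ.≤ k → Good k ρ ρ′ →
               ρ v ≈A eval (𝔗 α n α-lim) (ρ ∘ r) t → ρ′ v ≈B eval (𝔗 β n β-lim) (ρ′ ∘ r) t
      follow (var i) r v _ g e = preserves-≈ g v (r i) e
      follow (func (S i) ts) {suc (suc k)} {ρ = ρ} {ρ′} r v (s≤s (s≤s le)) g e =
        let w , g′ = step g (eval (𝔗 α n α-lim) (ρ ∘ r) (ts zero))
            w≈ = follow (ts zero) (suc ∘ r) zero (ℕ.m≤n⇒m≤1+n le) g′
                   (IsEquivalence.refl (Structure.≈-equivalence (𝔗 α n α-lim)))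
            child = preserves-child g′ zero (suc v) tt tt (A.≈extend⇒IsChild x₀≤ α-lim e)
        in IsEquivalence.trans (Structure.≈-equivalence (𝔗 β n β-lim))
             (B.IsChild⇒≈extend y₀≤ β-lim {i} {w} {ρ′ v} child)
             (Structure.⟦⟧ᶠ-cong (𝔗 β n β-lim) (S i) {λ _ → w}
                {λ _ → eval (𝔗 β n β-lim) (ρ′ ∘ r) (ts zero)} (λ _ → w≈))

      atom-≐ : ∀ {m} (s t : Term (Tree n) m) {k} {ρ : Fin m → Word α n} {ρ′} → rank (s ≐ t) ℕ.≤ k → Good k ρ ρ′ →
               Sat (𝔗 α n α-lim) ρ (s ≐ t) → Sat (𝔗 β n β-lim) ρ′ (s ≐ t)
      atom-≐ s t {suc k} {ρ} {ρ′} (s≤s le) g e =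
        let w , g′ = step g (eval (𝔗 α n α-lim) ρ s)
            w≈s = follow s suc zero (ℕ.≤-trans (ℕ.≤-trans (ℕ.m≤m+n _ _) (ℕ.n≤1+n _)) le) g′
                    (IsEquivalence.refl (Structure.≈-equivalence (𝔗 α n α-lim)))
            w≈t = follow t suc zero (ℕ.≤-trans (ℕ.≤-trans (ℕ.m≤n+m _ (termSize s)) (ℕ.n≤1+n _)) le) g′ e
        in IsEquivalence.trans (Structure.≈-equivalence (𝔗 β n β-lim))
             (IsEquivalence.sym (Structure.≈-equivalence (𝔗 β n β-lim)) w≈s) w≈t

      atom-⊆ : ∀ {m} (ts : Vector (Term (Tree n) m) 2) {k} {ρ : Fin m → Word α n} {ρ′} → rank (rel ⊆ ts) ℕ.≤ k →
               Good k ρ ρ′ → Sat (𝔗 α n α-lim) ρ (rel ⊆ ts) → Sat (𝔗 β n β-lim) ρ′ (rel ⊆ ts)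
      atom-⊆ ts {suc (suc k)} {ρ} {ρ′} (s≤s (s≤s le)) g e =
        let w , g₁ = step g (eval (𝔗 α n α-lim) ρ (ts zero))
            v , g₂ = step g₁ (eval (𝔗 α n α-lim) ρ (ts (suc zero)))
            w≈ = follow (ts zero) (λ j → suc (suc j)) (suc zero)
                   (ℕ.≤-trans (ℕ.≤-trans (ℕ.m≤m+n _ _) (ℕ.n≤1+n _)) le) g₂
                   (IsEquivalence.refl (Structure.≈-equivalence (𝔗 α n α-lim)))
            v≈ = follow (ts (suc zero)) (λ j → suc (suc j)) zero
                   (ℕ.≤-trans (ℕ.≤-trans (ℕ.m≤n+m _ (termSize (ts zero))) (ℕ.n≤1+n _)) le) g₂
                   (IsEquivalence.refl (Structure.≈-equivalence (𝔗 α n α-lim)))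
            e′ = preserves-⊆ g₂ (suc zero) zero e
        in Structure.⟦⟧ʳ-resp (𝔗 β n β-lim) ⊆ {w ∷ᵛ v ∷ᵛ λ ()} {λ i → eval (𝔗 β n β-lim) ρ′ (ts i)}
             (λ { zero → w≈ ; (suc zero) → v≈ }) e′

  module _ (α : Ordinal a) (α-lim : IsLimit α) (β : Ordinal b) (β-lim : IsLimit β)
           (Same : Carrier α → Carrier β → Set ℓ) where
    private
      module F = Skeleton α α-lim β β-lim Same
      module G = Skeleton β β-lim α α-lim (flip Same)

    Sim-sym : ∀ {k m x y V} {ρ : Fin m → Node α} {ρ′ : Fin m → Node β} →
              F.Sim k ρ ρ′ x y V → G.Sim k ρ′ ρ y x V
    Sim-sym (F.none s ¬V) = G.none s ¬V
    Sim-sym {k} {V = V} {ρ} {ρ′} (F.node y y′ f f′ x≤y x′≤y′ play s thr W split children) =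
      G.node y′ y f′ f x′≤y′ x≤y
        (EF-map k id id id id (λ { _ _ (p , q) → sym p , q }) (EF-sym k play)) s
        (λ j v → proj₂ (thr j v) , proj₁ (thr j v)) W split′ (λ i → Sim-sym (children i))
      where
      split′ : ∀ j → V j → (proj₁ (ρ′ j) ≡ y′ × proj₁ (ρ j) ≡ y) ⊎
               (∃ λ i → (Ordinal._<_ β y′ (proj₁ (ρ′ j)) × proj₂ (ρ′ j) y′ ≡ i) ×
                        (Ordinal._<_ α y (proj₁ (ρ j)) × proj₂ (ρ j) y ≡ i) × W i j)
      split′ j v with split j v
      ... | inj₁ (p , q)           = inj₁ (q , p)
      ... | inj₂ (i , (p , q , w)) = inj₂ (i , (q , p , w))

  module Equivalence (α : Ordinal a) (α-lim : IsLimit α) (β : Ordinal b) (β-lim : IsLimit β)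
                     (Same : Carrier α → Carrier β → Set ℓ) (i₀ : Fin n)
                     {x₀ : Carrier α} (x₀≤ : ∀ z → Order._≤_ α x₀ z)
                     {y₀ : Carrier β} (y₀≤ : ∀ z → Order._≤_ β y₀ z) where
    private
      module F = Atoms α α-lim β β-lim Same i₀ x₀≤ y₀≤
      module G = Atoms β β-lim α α-lim (flip Same) i₀ y₀≤ x₀≤

    module _ (same-0 : Same x₀ y₀)
             (same-next : ∀ {x y} → Same x y → Same (F.next-α x) (F.next-β y))
             (respond : ∀ k {x x′} → Same x x′ → ∀ y f → Order._≤_ α x y →
                ∃₂ λ y′ f′ → Order._≤_ β x′ y′ × Same y y′ × F.SegEF k f f′ x y x′ y′)
             (respond⁻ : ∀ k {x x′} → flip Same x x′ → ∀ y f → Order._≤_ β x y →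
                ∃₂ λ y′ f′ → Order._≤_ α x′ y′ × flip Same y y′ × G.SegEF k f f′ x y x′ y′) where
      private
        module F′ = F.Step same-next respond
        module G′ = G.Step same-next respond⁻

        Sat⇔ : ∀ {m} (φ : Formula (Tree n) m) {k} {ρ : Fin m → Word α n} {ρ′} → rank φ ℕ.≤ k → F.Good k ρ ρ′ →
               (Sat (𝔗 α n α-lim) ρ φ → Sat (𝔗 β n β-lim) ρ′ φ) ×
               (Sat (𝔗 β n β-lim) ρ′ φ → Sat (𝔗 α n α-lim) ρ φ)
        Sat⇔ (s ≐ t)    le g = F′.atom-≐ s t le g , G′.atom-≐ s t le (Sim-sym α α-lim β β-lim Same g)
        Sat⇔ (rel ⊆ ts) le g = F′.atom-⊆ ts le g , G′.atom-⊆ ts le (Sim-sym α α-lim β β-lim Same g)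
        Sat⇔ (not φ)    le g = let to , from = Sat⇔ φ le g in (λ ¬φ φ′ → ¬φ (from φ′)) , (λ ¬φ φ′ → ¬φ (to φ′))
        Sat⇔ (φ and ψ)  le g =
          let to₁ , from₁ = Sat⇔ φ (ℕ.≤-trans (ℕ.m≤m⊔n _ _) le) g
              to₂ , from₂ = Sat⇔ ψ (ℕ.≤-trans (ℕ.m≤n⊔m (rank φ) _) le) g
          in (λ (x , y) → to₁ x , to₂ y) , (λ (x , y) → from₁ x , from₂ y)
        Sat⇔ (exists φ) {suc k} (s≤s le) g =
          (λ (w , h) → let w′ , g′ = F′.step g w in w′ , proj₁ (Sat⇔ φ le g′) h) ,
          (λ (w′ , h) → let w , g′ = G′.step (Sim-sym α α-lim β β-lim Same g) w′ in w , proj₂ (Sat⇔ φ le (Sim-sym β β-lim α α-lim (flip Same) g′)) h)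

      equivalent : 𝔗 α n α-lim ≡ₑ 𝔗 β n β-lim
      equivalent φ = let to , from = Sat⇔ φ ℕ.≤-refl (F.none {k = rank φ} same-0 λ ()) in mk⇔ to from

-- Trees over isomorphic ordinals and over sums.

module Sums (em : ∀ {ℓ : Level} → ExcludedMiddle ℓ) (n : ℕ) where

  open import Relation.Binary.Morphism.Structures using (IsOrderIsomorphism)
  open Classical em
  open Words em n
  open TreeGame em n

  bottom : (α : Ordinal a) → Positive α → ∃ λ x → ∀ y → Order._≤_ α x y
  bottom α x = let y , _ , y≤ = least α (λ _ → ⊤) (x , tt) in y , λ z → y≤ z tt

  module _ {a b} (α : Ordinal a) (β : Ordinal b) (h : Carrier α → Carrier β)
           (mono : ∀ {x y} → Ordinal._<_ α x y → Ordinal._<_ β (h x) (h y)) where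
    private
      module A = Order α
      module B = Order β

    mono⇒cancel : ∀ {x y} → h x B.< h y → x A.< y
    mono⇒cancel {x} {y} hx<hy with A.compare x y
    ... | tri< x<y _ _  = x<y
    ... | tri≈ _ refl _ = ⊥-elim (B.<-irrefl hx<hy)
    ... | tri> _ _ y<x  = ⊥-elim (B.<⇒≤ hx<hy (mono y<x))

    mono-≤ : ∀ {x y} → x A.≤ y → h x B.≤ h y
    mono-≤ x≤y hy<hx = x≤y (mono⇒cancel hy<hx)

    mono-injective : ∀ {x y} → h x ≡ h y → x ≡ y
    mono-injective {x} {y} hx≡hy with A.compare x y
    ... | tri< x<y _ _ = ⊥-elim (B.irrefl hx≡hy (mono x<y))
    ... | tri≈ _ x≡y _ = x≡y
    ... | tri> _ _ y<x = ⊥-elim (B.irrefl (sym hx≡hy) (mono y<x))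

    surjective⇒≅ : (∀ y → ∃ λ x → h x ≡ y) → α ≅ β
    surjective⇒≅ onto = h , record
      { isOrderMonomorphism = record
        { isOrderHomomorphism = record { cong = cong h ; mono = mono }
        ; injective = mono-injective
        ; cancel = mono⇒cancel }
      ; surjective = λ y → let x , e = onto y in x , λ { refl → e } }

  module Iso (α : Ordinal a) (β : Ordinal b) (e : α ≅ β) where
    private
      h = proj₁ e
    open IsOrderIsomorphism (proj₂ e) public using (mono; cancel; injective; surjective)

    back : Carrier β → Carrier α
    back y = proj₁ (surjective y)

    to-back : ∀ y → h (back y) ≡ y
    to-back y = proj₂ (surjective y) refl

    back-to : ∀ x → back (h x) ≡ x
    back-to x = injective (to-back (h x))

    back-mono : ∀ {x y} → Ordinal._<_ β x y → Ordinal._<_ α (back x) (back y)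
    back-mono {x} {y} x<y = cancel
      (subst (λ z → Ordinal._<_ β z (h (back y))) (sym (to-back x)) (subst (Ordinal._<_ β x) (sym (to-back y)) x<y))

  ≅-sym : {α : Ordinal a} {β : Ordinal b} → α ≅ β → β ≅ α
  ≅-sym {α = α} {β} e = surjective⇒≅ β α back back-mono (λ x → proj₁ e x , back-to x)
    where open Iso α β e

  module _ {α : Ordinal a} {β : Ordinal b} (i₀ : Fin n) (e : α ≅ β)
           (α-lim : IsLimit α) (β-lim : IsLimit β) (α⁺ : Positive α) where
    private
      module A = Order α
      module B = Order β
      open Iso α β e
      h = proj₁ e

      x₀≤ : ∀ z → proj₁ (bottom α α⁺) A.≤ z
      x₀≤ = proj₂ (bottom α α⁺)

      y₀≤ : ∀ z → h (proj₁ (bottom α α⁺)) B.≤ z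
      y₀≤ z z<hx = x₀≤ (back z) (cancel (subst (B._< h _) (sym (to-back z)) z<hx))

      same-next : ∀ {x y} → h x ≡ y → h (proj₁ (α-lim x)) ≡ proj₁ (β-lim y)
      same-next {x} refl = B.≤-antisym
        (subst (h _ B.≤_) (to-back _) (mono-≤ α β h mono (A.Succ⇒≤ (proj₂ (α-lim x))
          (cancel (subst (h x B.<_) (sym (to-back _)) (proj₁ (proj₂ (β-lim (h x)))))))))
        (B.Succ⇒≤ (proj₂ (β-lim (h x))) (mono (proj₁ (proj₂ (α-lim x)))))

    -- The relation on lengths is the graph of the isomorphism, and every reply carries the word
    -- over along it.
    ≅⇒≡ₑ : 𝔗 α n α-lim ≡ₑ 𝔗 β n β-lim
    ≅⇒≡ₑ = Equivalence.equivalent α α-lim β β-lim (λ x y → h x ≡ y) i₀ x₀≤ y₀≤ refl same-next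
      (λ { k {x} refl y f x≤y → h y , f ∘ back , mono-≤ α β h mono x≤y , refl ,
         EF-iso k (λ z w → h z ≡ w)
           (λ {z} (p , q) → h z , (mono-≤ α β h mono p , mono q) , refl)
           (λ {w} (p , q) → back w , ((λ bw<x → p (subst (B._< h x) (to-back w) (mono bw<x))) ,
                                      cancel (subst (B._< h y) (sym (to-back w)) q)) , to-back w)
           (λ { _ _ _ _ refl refl → mono }) (λ { _ _ _ _ refl refl → cancel })
           (λ { {z} _ _ refl → cong f (sym (back-to z)) , refl }) })
      (λ { k {_} {x} refl y f x≤y → back y , f ∘ h ,
         (λ by<x → x≤y (subst (B._< h x) (to-back y) (mono by<x))) , to-back y ,
         EF-iso k (λ w z → h z ≡ w)
           (λ {w} (p , q) → back w , ((λ bw<x → p (subst (B._< h x) (to-back w) (mono bw<x))) , back-mono q) , to-back w)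
           (λ {z} (p , q) → h z , (mono-≤ α β h mono p , subst (h z B.<_) (to-back y) (mono q)) , refl)
           (λ { _ _ _ _ refl refl → cancel }) (λ { _ _ _ _ refl refl → mono })
           (λ { _ _ refl → refl , refl }) })

  module _ {α : Ordinal a} {β : Ordinal b} {a′ b′} {α′ : Ordinal a′} {β′ : Ordinal b′}
           {M : Carrier α → Carrier β → Set ℓ} {M′ : Carrier α′ → Carrier β′ → Set ℓ′}
           (f : Carrier α → Carrier α′) (f-mono : ∀ {x y} → Ordinal._<_ α x y → Ordinal._<_ α′ (f x) (f y))
           (g : Carrier β → Carrier β′) (g-mono : ∀ {x y} → Ordinal._<_ β x y → Ordinal._<_ β′ (g x) (g y)) where

    EF-image : ∀ k {P Q P′ Q′} →
               (∀ {x} → P x → P′ (f x)) → (∀ {x} → P′ x → ∃ λ z → P z × f z ≡ x) →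
               (∀ {y} → Q y → Q′ (g y)) → (∀ {y} → Q′ y → ∃ λ z → Q z × g z ≡ y) →
               (∀ {x y} → P x → Q y → M x y → M′ (f x) (g y)) → EF α β M k P Q → EF α′ β′ M′ k P′ Q′
    EF-image zero _ _ _ _ _ _ = _
    EF-image (suc k) {P} {Q} {P′} {Q′} p p⁻ q q⁻ m (forth , back) =
      (λ x px → let z , pz , e = p⁻ px ; y , qy , r = forth z pz in
         g y , q qy , subst (λ x → Reply α′ β′ M′ k P′ Q′ x (g y)) e (reply pz qy r)) ,
      (λ y qy → let z , qz , e = q⁻ qy ; x , px , r = back z qz in
         f x , p px , subst (λ y → Reply α′ β′ M′ k P′ Q′ (f x) y) e (reply px qz r))
      where
      reply : ∀ {x y} → P x → Q y → Reply α β M k P Q x y → Reply α′ β′ M′ k P′ Q′ (f x) (g y)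
      reply px qy (match , l , r) = m px qy match ,
        EF-image k
          (λ (u , <x) → p u , f-mono <x)
          (λ (u , <x) → let z , pz , e = p⁻ u in z , (pz , mono⇒cancel α α′ f f-mono (subst (λ w → Ordinal._<_ α′ w _) (sym e) <x)) , e)
          (λ (u , <x) → q u , g-mono <x)
          (λ (u , <x) → let z , pz , e = q⁻ u in z , (pz , mono⇒cancel β β′ g g-mono (subst (λ w → Ordinal._<_ β′ w _) (sym e) <x)) , e)
          (λ (u , _) (v , _) → m u v) l ,
        EF-image k
          (λ (u , <x) → p u , f-mono <x)
          (λ (u , <x) → let z , pz , e = p⁻ u in z , (pz , mono⇒cancel α α′ f f-mono (subst (λ w → Ordinal._<_ α′ _ w) (sym e) <x)) , e)
          (λ (u , <x) → q u , g-mono <x)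
          (λ (u , <x) → let z , pz , e = q⁻ u in z , (pz , mono⇒cancel β β′ g g-mono (subst (λ w → Ordinal._<_ β′ _ w) (sym e) <x)) , e)
          (λ (u , _) (v , _) → m u v) r

  module _ (α : Ordinal a) (β : Ordinal b) (θ : Ordinal ℓ′) where

    -- All lengths in the first summands are identified: `sum-respond` shows that the game cannot
    -- tell what remains after them. Lengths inside θ are matched only with themselves.
    data Same : Carrier (α +ₒ θ) → Carrier (β +ₒ θ) → Set (a ⊔ b ⊔ ℓ′) where
      bothˡ  : ∀ x y → Same (inj₁ x) (inj₁ y)
      sameʳ : ∀ z → Same (inj₂ z) (inj₂ z)

  module _ (α : Ordinal a) (β : Ordinal b) (θ : Ordinal ℓ′)
           (α-lim : IsLimit α) (β-lim : IsLimit β) (θ-lim : IsLimit θ) (i₀ : Fin n)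
           (α-room : Spacious α) (β-room : Spacious β)
           {c} (c-unb : Unbounded α c) {d} (d-unb : Unbounded β d)
           (R : Carrier (α +ₒ θ) → Carrier (β +ₒ θ) → Set ℓ)
           (intro : ∀ {x y} → Same α β θ x y → R x y) (elim : ∀ {x y} → R x y → Same α β θ x y) where
    private
      module A = Order (α +ₒ θ)
      module B = Order (β +ₒ θ)
      module S = Skeleton (α +ₒ θ) (+ₒ-isLimit α θ α-lim θ-lim) (β +ₒ θ) (+ₒ-isLimit β θ β-lim θ-lim) R

    sum-next : ∀ {x y} → R x y → R (S.next-α x) (S.next-β y)
    sum-next r with elim r
    ... | bothˡ x y = intro (bothˡ _ _)
    ... | sameʳ z  = intro (sameʳ _)

    -- An edge within the first summands is answered by `match-segment`, an edge within θ by itself,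
    -- and an edge from α into θ by `match-tail` followed by a copy of its part in θ. `R` stands for
    -- `Same` or its converse, so both directions of the game use one proof.
    sum-respond : ∀ k {x x′} → R x x′ → ∀ y f → x A.≤ y →
                  ∃₂ λ y′ f′ → x′ B.≤ y′ × R y y′ × S.SegEF k f f′ x y x′ y′
    sum-respond k r y f x≤y with elim r
    sum-respond k r (inj₁ y) f x≤y | sameʳ z = ⊥-elim (x≤y ₁∼₂)
    sum-respond k r (inj₂ y) f x≤y | sameʳ z =
      inj₂ y , [ (λ _ → i₀) , f ∘ inj₂ ] , (λ { (₂∼₂ y<z) → x≤y (₂∼₂ y<z) }) , intro (sameʳ y) ,
      EF-iso k (Same α β θ)
        (λ { {inj₁ _} (p , _) → ⊥-elim (p ₁∼₂)
           ; {inj₂ u} (p , ₂∼₂ q) → inj₂ u , ((λ { (₂∼₂ u<z) → p (₂∼₂ u<z) }) , ₂∼₂ q) , sameʳ u })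
        (λ { {inj₁ _} (p , _) → ⊥-elim (p ₁∼₂)
           ; {inj₂ u} (p , ₂∼₂ q) → inj₂ u , ((λ { (₂∼₂ u<z) → p (₂∼₂ u<z) }) , ₂∼₂ q) , sameʳ u })
        (λ { (p , _) _ _ _ (bothˡ _ _) → ⊥-elim (p ₁∼₂)
           ; _ _ (p , _) _ (sameʳ _) (bothˡ _ _) → ⊥-elim (p ₁∼₂)
           ; _ _ _ _ (sameʳ _) (sameʳ _) (₂∼₂ <) → ₂∼₂ < })
        (λ { (p , _) _ _ _ (bothˡ _ _) → ⊥-elim (p ₁∼₂)
           ; _ _ (p , _) _ (sameʳ _) (bothˡ _ _) → ⊥-elim (p ₁∼₂)
           ; _ _ _ _ (sameʳ _) (sameʳ _) (₂∼₂ <) → ₂∼₂ < })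
        (λ { (p , _) _ (bothˡ _ _) → ⊥-elim (p ₁∼₂) ; _ _ (sameʳ _) → refl , intro (sameʳ _) })
    sum-respond k r (inj₁ y) f x≤y | bothˡ x x′ =
      let y′ , x′≤y′ , g , e = match-segment α β i₀ k α-room β-room x y (f ∘ inj₁) x′ in
      inj₁ y′ , [ g , (λ _ → i₀) ] , (λ { (₁∼₁ y<x) → x′≤y′ y<x }) , intro (bothˡ y y′) ,
      EF-image inj₁ ₁∼₁ inj₁ ₁∼₁ k
        (λ (p , q) → (λ { (₁∼₁ u) → p u }) , ₁∼₁ q)
        (λ { {inj₁ u} (p , ₁∼₁ q) → u , ((λ u<x → p (₁∼₁ u<x)) , q) , refl ; {inj₂ _} (_ , ()) })
        (λ (p , q) → (λ { (₁∼₁ u) → p u }) , ₁∼₁ q)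
        (λ { {inj₁ u} (p , ₁∼₁ q) → u , ((λ u<x → p (₁∼₁ u<x)) , q) , refl ; {inj₂ _} (_ , ()) })
        (λ _ _ m → m , intro (bothˡ _ _)) (game (≈-pred e))
    sum-respond k r (inj₂ y) f x≤y | bothˡ x x′ =
      let g , e = match-tail α β i₀ k α-room β-room c-unb d-unb x (f ∘ inj₁) x′ in
      inj₂ y , [ g , f ∘ inj₂ ] , (λ ()) , intro (sameʳ y) ,
      EF-resp k
        (λ { (inj₁ (u , x≤u , refl)) → (λ { (₁∼₁ u<x) → x≤u u<x }) , ₁∼₂ ; (inj₂ (u , u<y , refl)) → (λ ()) , ₂∼₂ u<y })
        (λ { {inj₁ u} (p , _) → inj₁ (u , (λ u<x → p (₁∼₁ u<x)) , refl) ; {inj₂ u} (_ , ₂∼₂ q) → inj₂ (u , q , refl) })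
        (λ { (inj₁ (u , x≤u , refl)) → (λ { (₁∼₁ u<x) → x≤u u<x }) , ₁∼₂ ; (inj₂ (u , u<y , refl)) → (λ ()) , ₂∼₂ u<y })
        (λ { {inj₁ u} (p , _) → inj₁ (u , (λ u<x → p (₁∼₁ u<x)) , refl) ; {inj₂ u} (_ , ₂∼₂ q) → inj₂ (u , q , refl) })
        (EF-∪ k {P₁ = λ z → ∃ λ u → Order._≤_ α x u × z ≡ inj₁ u}
                {P₂ = λ z → ∃ λ u → Ordinal._<_ θ u y × z ≡ inj₂ u}
                {Q₁ = λ z → ∃ λ u → Order._≤_ β x′ u × z ≡ inj₁ u}
                {Q₂ = λ z → ∃ λ u → Ordinal._<_ θ u y × z ≡ inj₂ u}
          (λ { (_ , _ , refl) (_ , _ , refl) → ₁∼₂ }) (λ { (_ , _ , refl) (_ , _ , refl) → ₁∼₂ })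
          (EF-image inj₁ ₁∼₁ inj₁ ₁∼₁ k
            (λ p → _ , p , refl) (λ (u , p , e) → u , p , sym e)
            (λ p → _ , p , refl) (λ (u , p , e) → u , p , sym e)
            (λ _ _ m → m , intro (bothˡ _ _)) (game (≈-pred e)))
          (EF-iso k (Same α β θ)
            (λ { (u , q , refl) → inj₂ u , (u , q , refl) , sameʳ u })
            (λ { (u , q , refl) → inj₂ u , (u , q , refl) , sameʳ u })
            (λ { (_ , _ , refl) (_ , _ , refl) (_ , _ , refl) (_ , _ , refl) (sameʳ _) (sameʳ _) (₂∼₂ <) → ₂∼₂ < })
            (λ { (_ , _ , refl) (_ , _ , refl) (_ , _ , refl) (_ , _ , refl) (sameʳ _) (sameʳ _) (₂∼₂ <) → ₂∼₂ < })
            (λ { _ _ (sameʳ _) → refl , intro (sameʳ _) ; (_ , _ , ()) _ (bothˡ _ _) })))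

  module _ (α : Ordinal a) (β : Ordinal b) (θ : Ordinal ℓ′)
           (α-lim : IsLimit α) (β-lim : IsLimit β) (θ-lim : IsLimit θ) (i₀ : Fin n)
           (α⁺ : Positive α) (β⁺ : Positive β) (α-room : Spacious α) (β-room : Spacious β)
           {c} (c-unb : Unbounded α c) {d} (d-unb : Unbounded β d) where

    private
      swap : ∀ {a b} {α : Ordinal a} {β : Ordinal b} {x y} → Same α β θ x y → Same β α θ y x
      swap (bothˡ x y) = bothˡ y x
      swap (sameʳ z)  = sameʳ z

      bottom-sum : ∀ {a} (α : Ordinal a) (α⁺ : Positive α) → ∀ z → Order._≤_ (α +ₒ θ) (inj₁ (proj₁ (bottom α α⁺))) z
      bottom-sum α α⁺ (inj₁ z) (₁∼₁ z<) = proj₂ (bottom α α⁺) z z<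

    sum-≡ₑ : 𝔗 (α +ₒ θ) n (+ₒ-isLimit α θ α-lim θ-lim) ≡ₑ 𝔗 (β +ₒ θ) n (+ₒ-isLimit β θ β-lim θ-lim)
    sum-≡ₑ = Equivalence.equivalent (α +ₒ θ) _ (β +ₒ θ) _ (Same α β θ) i₀ (bottom-sum α α⁺) (bottom-sum β β⁺)
      (bothˡ _ _)
      (sum-next α β θ α-lim β-lim θ-lim i₀ α-room β-room c-unb d-unb (Same α β θ) id id)
      (sum-respond α β θ α-lim β-lim θ-lim i₀ α-room β-room c-unb d-unb (Same α β θ) id id)
      (sum-respond β α θ β-lim α-lim θ-lim i₀ β-room α-room d-unb c-unb (flip (Same α β θ)) swap swap)

-- Comparing ordinals, and first-order descriptions of those below ω^ω.

module Definability (em : ∀ {ℓ : Level} → ExcludedMiddle ℓ) (n : ℕ) where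

  open import Data.Vec.Functional using (Vector) renaming (_∷_ to _∷ᵛ_)
  open Classical em
  open Words em n
  open Sums em n

  record Initial (α : Ordinal a) (β : Ordinal b) : Set (a ⊔ b) where
    field
      map  : Carrier α → Carrier β
      mono : ∀ {x y} → Ordinal._<_ α x y → Ordinal._<_ β (map x) (map y)
      down : ∀ {x z} → Ordinal._<_ β z (map x) → ∃ λ w → map w ≡ z

  module _ (α : Ordinal a) (β : Ordinal b) where
    private
      module A = Order α
      module B = Order β

    -- Relates points of equal order type. It is functional and injective by well-founded induction,
    -- so totality on one side yields an initial embedding.
    data Corresponds (x : Carrier α) (y : Carrier β) : Set (a ⊔ b) where
      matched : (∀ x′ → x′ A.< x → ∃ λ y′ → y′ B.< y × Corresponds x′ y′) →
                (∀ y′ → y′ B.< y → ∃ λ x′ → x′ A.< x × Corresponds x′ y′) → Corresponds x y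

    private
      functional-acc : ∀ {x y y′} → Acc A._<_ x → Corresponds x y → Corresponds x y′ → y ≡ y′
      functional-acc {x} {y} {y′} (acc rec) (matched f g) (matched f′ g′) with B.compare y y′
      ... | tri≈ _ y≡y′ _ = y≡y′
      ... | tri< y<y′ _ _ = let x₁ , x₁<x , r = g′ y y<y′ ; y₁ , y₁<y , r₁ = f x₁ x₁<x in
            ⊥-elim (B.irrefl (functional-acc (rec x₁<x) r₁ r) y₁<y)
      ... | tri> _ _ y′<y = let x₁ , x₁<x , r = g y′ y′<y ; y₁ , y₁<y , r₁ = f′ x₁ x₁<x in
            ⊥-elim (B.irrefl (functional-acc (rec x₁<x) r₁ r) y₁<y)

      injective-acc : ∀ {x x′ y} → Acc B._<_ y → Corresponds x y → Corresponds x′ y → x ≡ x′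
      injective-acc {x} {x′} {y} (acc rec) (matched f g) (matched f′ g′) with A.compare x x′
      ... | tri≈ _ x≡x′ _ = x≡x′
      ... | tri< x<x′ _ _ = let y₁ , y₁<y , r = f′ x x<x′ ; x₁ , x₁<x , r₁ = g y₁ y₁<y in
            ⊥-elim (A.irrefl (injective-acc (rec y₁<y) r₁ r) x₁<x)
      ... | tri> _ _ x′<x = let y₁ , y₁<y , r = f x′ x′<x ; x₁ , x₁<x , r₁ = g′ y₁ y₁<y in
            ⊥-elim (A.irrefl (injective-acc (rec y₁<y) r₁ r) x₁<x)

      functional : ∀ {x y y′} → Corresponds x y → Corresponds x y′ → y ≡ y′
      functional {x} = functional-acc (A.wellFounded x)

      injective : ∀ {x x′ y} → Corresponds x y → Corresponds x′ y → x ≡ x′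
      injective {y = y} = injective-acc (B.wellFounded y)

      forward : (∀ x → ∃ (Corresponds x)) → Initial α β
      forward F = record { map = λ x → proj₁ (F x) ; mono = λ {x} {y} → mono x y ; down = λ {x} {z} → down x z }
        where
        mono : ∀ x y → x A.< y → proj₁ (F x) B.< proj₁ (F y)
        mono x y x<y with F y
        ... | hy , matched f _ = let y′ , y′<hy , r = f x x<y in subst (B._< hy) (functional r (proj₂ (F x))) y′<hy
        down : ∀ x z → z B.< proj₁ (F x) → ∃ λ w → proj₁ (F w) ≡ z
        down x z z<hx with F x
        ... | hx , matched _ g = let w , _ , r = g z z<hx in w , functional (proj₂ (F w)) r

      backward : (∀ y → ∃ λ x → Corresponds x y) → Initial β α
      backward F = record { map = λ x → proj₁ (F x) ; mono = λ {x} {y} → mono x y ; down = λ {x} {z} → down x z }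
        where
        mono : ∀ x y → x B.< y → proj₁ (F x) A.< proj₁ (F y)
        mono x y x<y with F y
        ... | hy , matched _ g = let y′ , y′<hy , r = g x x<y in subst (A._< hy) (injective r (proj₂ (F x))) y′<hy
        down : ∀ x z → z A.< proj₁ (F x) → ∃ λ w → proj₁ (F w) ≡ z
        down x z z<hx with F x
        ... | hx , matched f _ = let w , _ , r = f z z<hx in w , injective (proj₂ (F w)) r

    abstract
      comparable : Initial α β ⊎ Initial β α
      comparable with em {P = ∃ λ x → ¬ ∃ (Corresponds x)}
      ... | no total = inj₁ (forward λ x → dne λ ¬r → total (x , ¬r))
      -- Let `x` be the least point of α without partner. If `y` were the first point of β without
      -- one, the points below `x` and below `y` would be matched with each other, and `x` would
      -- correspond to `y`.
      ... | yes missing = inj₂ (backward λ y → hit y (B.wellFounded y))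
        where
        first : ∃ λ x → ¬ ∃ (Corresponds x) × (∀ y → ¬ ∃ (Corresponds y) → x A.≤ y)
        first = least α (λ x → ¬ ∃ (Corresponds x)) missing
        x : Carrier α
        x = proj₁ first
        hit : ∀ y → Acc B._<_ y → ∃ λ x → Corresponds x y
        hit y (acc rec) = dne λ ¬r → proj₁ (proj₂ first) (y , matched (earlier ¬r) later)
          where
          earlier : ¬ (∃ λ x → Corresponds x y) → ∀ x′ → x′ A.< x → ∃ λ y′ → y′ B.< y × Corresponds x′ y′
          earlier ¬r x′ x′<x with dne (λ ¬r′ → proj₂ (proj₂ first) x′ ¬r′ x′<x)
          ... | y′ , r′@(matched _ g) with B.compare y′ y
          ...   | tri< y′<y _ _ = y′ , y′<y , r′
          ...   | tri≈ _ refl _ = ⊥-elim (¬r (x′ , r′))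
          ...   | tri> _ _ y<y′ = ⊥-elim (¬r (let x₁ , _ , r₁ = g y y<y′ in x₁ , r₁))
          later : ∀ y′ → y′ B.< y → ∃ λ x′ → x′ A.< x × Corresponds x′ y′
          later y′ y′<y with hit y′ (rec y′<y)
          ... | x′ , r′@(matched f _) with A.compare x′ x
          ...   | tri< x′<x _ _ = x′ , x′<x , r′
          ...   | tri≈ _ refl _ = ⊥-elim (proj₁ (proj₂ first) (y′ , r′))
          ...   | tri> _ _ x<x′ = ⊥-elim (proj₁ (proj₂ first) (let y₁ , _ , r₁ = f x x<x′ in y₁ , r₁))

  Add-functional : (α : Ordinal a) → ∀ m {x y z} → Add α m x y → Add α m x z → y ≡ z
  Add-functional α m {y = y} {z} p q with Ordinal.compare α y z
  ... | tri≈ _ y≡z _ = y≡z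
  Add-functional α zero    (x<y , _) (_ , lz) | tri< y<z _ _ = ⊥-elim (lz _ x<y y<z)
  Add-functional α zero    (_ , ly) (x<z , _) | tri> _ _ z<y = ⊥-elim (ly _ x<z z<y)
  Add-functional α (suc m) (cy , _) (_ , lz)  | tri< y<z _ _ = ⊥-elim (lz _ y<z cy)
  Add-functional α (suc m) (_ , ly) (cz , _)  | tri> _ _ z<y = ⊥-elim (ly _ z<y cz)

  module _ (α : Ordinal a) (β : Ordinal b) (ι : Initial α β) where
    private
      module A = Order α
      module B = Order β
    open Initial ι renaming (map to h)

    private
      cancel : ∀ {x y} → h x B.< h y → x A.< y
      cancel = mono⇒cancel α β h mono

    -- The quantifiers in `Add` and `Closed` range below the larger argument only, where `down`
    -- supplies preimages. Hence initial embeddings preserve and reflect both relations.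
    Add⁺ : ∀ m {x y} → Add α m x y → Add β m (h x) (h y)
    Add⁻ : ∀ m {x y} → Add β m (h x) (h y) → Add α m x y
    Closed⁺ : ∀ m {x y} → Closed α m x y → Closed β m (h x) (h y)
    Closed⁻ : ∀ m {x y} → Closed β m (h x) (h y) → Closed α m x y

    Add⁺ zero (x<y , least) = mono x<y , λ z hx<z z<hy → between z hx<z z<hy (down z<hy)
      where
      between : ∀ z → h _ B.< z → z B.< h _ → ∃ (λ w → h w ≡ z) → ⊥
      between _ hx<z z<hy (w , refl) = least w (cancel hx<z) (cancel z<hy)
    Add⁺ (suc m) {x} (cl , least) = Closed⁺ m cl , λ z z<hy c → below z z<hy c (down z<hy)
      where
      below : ∀ z → z B.< h _ → Closed β m (h x) z → ∃ (λ w → h w ≡ z) → ⊥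
      below _ z<hy c (w , refl) = least w (cancel z<hy) (Closed⁻ m c)
    Closed⁺ m {x} {y} (x<y , closed) = mono x<y , λ p hx≤p p<hy → reach p hx≤p p<hy (down p<hy)
      where
      reach : ∀ p → h x B.≤ p → p B.< h y → ∃ (λ w → h w ≡ p) → ∃ λ q → q B.< h y × Add β m p q
      reach _ hx≤p p<hy (w , refl) = let q , q<y , add = closed w (λ w<x → hx≤p (mono w<x)) (cancel p<hy) in
        h q , mono q<y , Add⁺ m add
    Add⁻ zero (hx<hy , least) = cancel hx<hy , λ z x<z z<y → least (h z) (mono x<z) (mono z<y)
    Add⁻ (suc m) (cl , least) = Closed⁻ m cl , λ z z<y c → least (h z) (mono z<y) (Closed⁺ m c)
    Closed⁻ m {x} {y} (hx<hy , closed) = cancel hx<hy , λ p x≤p p<y →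
      let q , q<hy , add = closed (h p) (mono-≤ α β h mono x≤p) (mono p<y) in reach q<hy (down q<hy) add
      where
      reach : ∀ {p q} → q B.< h y → ∃ (λ w → h w ≡ q) → Add β m (h p) q → ∃ λ q → q A.< y × Add α m p q
      reach q<hy (w , refl) add = w , cancel q<hy , Add⁻ m add

  -- Shape es m x: the remainder from x on is ω^e₁ + … + ω^eᵣ + ω^(m + 1), es = e₁ … eᵣ.
  module _ (α : Ordinal a) where
    open Order α

    Shape : List ℕ → ℕ → Carrier α → Set a
    Shape []       m x = (∀ p → x ≤ p → ∃ λ q → Add α m p q) × (∀ y → ¬ Closed α m x y)
    Shape (e ∷ es) m x = ∃ λ y → Add α e x y × Shape es m y

    HasShape : List ℕ → ℕ → Set a
    HasShape es m = ∃ λ x → (∀ z → x ≤ z) × Shape es m x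

  module _ (α : Ordinal a) (β : Ordinal b) (ι : Initial α β) where
    private
      module A = Order α
      module B = Order β
    open Initial ι renaming (map to h)

    private
      -- The summands of the shape end at corresponding points since `Add` is functional. For the
      -- last one, the first point `z` of β outside the image would be a closed point, which the
      -- shape of β excludes.
      unequal : ∀ {z} → (∀ x → h x B.< z) → (∀ y → y B.< z → ∃ λ x → h x ≡ y) →
                ∀ es {m x} → Shape α es m x → ¬ Shape β es m (h x)
      unequal {z} below onto [] {m} {x} (room , _) (_ , ¬closed) = ¬closed z
        (below x , λ p hx≤p p<z → reach p hx≤p (onto p p<z))
        where
        reach : ∀ p → h x B.≤ p → ∃ (λ w → h w ≡ p) → ∃ λ q → q B.< z × Add β m p q
        reach _ hx≤p (w , refl) = let q , add = room w (λ w<x → hx≤p (mono w<x)) in h q , below q , Add⁺ α β ι m add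
      unequal below onto (e ∷ es) (y , add , shape) (y′ , add′ , shape′)
        with Add-functional β e (Add⁺ α β ι e add) add′
      ... | refl = unequal below onto es shape shape′

    initial-shape : ∀ {es m} → HasShape α es m → HasShape β es m → α ≅ β
    initial-shape {es} {m} (x , x≤ , shape) (y , y≤ , shape′) = surjective⇒≅ α β h mono λ y → dne λ ¬hit →
      let z , ¬z , first = least β (λ z → ¬ ∃ λ x → h x ≡ z) (y , ¬hit) in
      unequal (λ w → above ¬z w) (λ y y<z → dne λ ¬y → first y ¬y y<z) es shape
        (subst (Shape β es m) (B.≤-antisym (y≤ (h x)) bottom-image) shape′)
      where
      above : ∀ {z} → ¬ (∃ λ x → h x ≡ z) → ∀ w → h w B.< z
      above {z} ¬z w with B.compare (h w) z
      ... | tri< hw<z _ _ = hw<z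
      ... | tri≈ _ hw≡z _ = ⊥-elim (¬z (w , hw≡z))
      ... | tri> _ _ z<hw = ⊥-elim (¬z (down z<hw))
      bottom-image : h x B.≤ y
      bottom-image y<hx with down y<hx
      ... | w , refl = x≤ w (mono⇒cancel α β h mono y<hx)

  shape-unique : (α : Ordinal a) (β : Ordinal b) → ∀ {es m} → HasShape α es m → HasShape β es m → α ≅ β
  shape-unique α β {es} s s′ with comparable α β
  ... | inj₁ ι = initial-shape α β ι {es} s s′
  ... | inj₂ ι = ≅-sym {α = β} {β = α} (initial-shape β α ι {es} s′ s)

  shape-≅ : (α : Ordinal a) (β : Ordinal b) → α ≅ β → ∀ {es m} → HasShape α es m → HasShape β es m
  shape-≅ α β e@(h , _) {es} (x , x≤ , shape) = h x ,
    (λ z z<hx → x≤ (back z) (cancel (subst (λ w → Ordinal._<_ β w (h x)) (sym (to-back z)) z<hx))) , transport es shape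
    where
    open Iso α β e
    module B = Order β
    ι : Initial α β
    ι = record { map = h ; mono = mono ; down = λ {_} {z} _ → back z , to-back z }
    transport : ∀ es {m x} → Shape α es m x → Shape β es m (h x)
    transport [] {m} {x} (room , ¬closed) =
      (λ p hx≤p → let q , add = room (back p) (λ bp<x → hx≤p (subst (B._< h x) (to-back p) (mono bp<x))) in
         h q , subst (λ p → Add β m p (h q)) (to-back p) (Add⁺ α β ι m add)) ,
      λ y cl → ¬closed (back y) (Closed⁻ α β ι m (subst (Closed β m (h x)) (sym (to-back y)) cl))
    transport (e ∷ es) (y , add , shape) = h y , Add⁺ α β ι e add , transport es shape

  module _ {m : ℕ} where
    ltᶠ : Fin m → Fin m → Formula Order m
    ltᶠ i j = rel lt (var i ∷ᵛ var j ∷ᵛ λ ())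

  addᶠ closedᶠ : ∀ {k} → ℕ → Fin k → Fin k → Formula Order k
  addᶠ zero    i j = ltᶠ i j and not (exists (ltᶠ (suc i) zero and ltᶠ zero (suc j)))
  addᶠ (suc m) i j = closedᶠ m i j and not (exists (ltᶠ zero (suc j) and closedᶠ m (suc i) zero))
  closedᶠ m i j = ltᶠ i j and not (exists (not (ltᶠ zero (suc i)) and (ltᶠ zero (suc j) and
                    not (exists (ltᶠ zero (suc (suc j)) and addᶠ m (suc zero) zero)))))

  shapeᶠ : ∀ {k} → List ℕ → ℕ → Fin k → Formula Order k
  shapeᶠ []       m i = not (exists (not (ltᶠ zero (suc i)) and not (exists (addᶠ m (suc zero) zero)))) and
                        not (exists (closedᶠ m (suc i) zero))
  shapeᶠ (e ∷ es) m i = exists (addᶠ e (suc i) zero and shapeᶠ es m zero)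

  hasShapeᶠ : List ℕ → ℕ → Sentence Order
  hasShapeᶠ es m = exists (not (exists (ltᶠ zero (suc zero))) and shapeᶠ es m zero)

  spaciousᶠ : ℕ → Sentence Order
  spaciousᶠ m = not (exists (not (exists (addᶠ m (suc zero) zero))))

  module _ (α : Ordinal a) where
    private
      O = orderStructure α

    addᶠ⁺ : ∀ m {k} (ρ : Vector (Carrier α) k) i j → Sat O ρ (addᶠ m i j) → Add α m (ρ i) (ρ j)
    addᶠ⁻ : ∀ m {k} (ρ : Vector (Carrier α) k) i j → Add α m (ρ i) (ρ j) → Sat O ρ (addᶠ m i j)
    closedᶠ⁺ : ∀ m {k} (ρ : Vector (Carrier α) k) i j → Sat O ρ (closedᶠ m i j) → Closed α m (ρ i) (ρ j)
    closedᶠ⁻ : ∀ m {k} (ρ : Vector (Carrier α) k) i j → Closed α m (ρ i) (ρ j) → Sat O ρ (closedᶠ m i j)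
    addᶠ⁺ zero    ρ i j (p , ¬q) = p , λ z u v → ¬q (z , u , v)
    addᶠ⁺ (suc m) ρ i j (p , ¬q) = closedᶠ⁺ m ρ i j p , λ z u c → ¬q (z , u , closedᶠ⁻ m (z ∷ᵛ ρ) (suc i) zero c)
    addᶠ⁻ zero    ρ i j (p , q)  = p , λ (z , u , v) → q z u v
    addᶠ⁻ (suc m) ρ i j (p , q)  = closedᶠ⁻ m ρ i j p , λ (z , u , c) → q z u (closedᶠ⁺ m (z ∷ᵛ ρ) (suc i) zero c)
    closedᶠ⁺ m ρ i j (p , ¬q) = p , λ z x≤z z<y → dne λ ¬w → ¬q (z , x≤z , z<y , λ (w , w<y , add) →
      ¬w (w , w<y , addᶠ⁺ m (w ∷ᵛ z ∷ᵛ ρ) (suc zero) zero add))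
    closedᶠ⁻ m ρ i j (p , q) = p , λ (z , x≤z , z<y , ¬w) → let w , w<y , add = q z x≤z z<y in
      ¬w (w , w<y , addᶠ⁻ m (w ∷ᵛ z ∷ᵛ ρ) (suc zero) zero add)

    shapeᶠ⁺ : ∀ es m {k} (ρ : Vector (Carrier α) k) i → Sat O ρ (shapeᶠ es m i) → Shape α es m (ρ i)
    shapeᶠ⁺ [] m ρ i (¬p , ¬q) =
      (λ p x≤p → dne λ ¬r → ¬p (p , x≤p , λ (r , add) → ¬r (r , addᶠ⁺ m (r ∷ᵛ p ∷ᵛ ρ) (suc zero) zero add))) ,
      λ y c → ¬q (y , closedᶠ⁻ m (y ∷ᵛ ρ) (suc i) zero c)
    shapeᶠ⁺ (e ∷ es) m ρ i (y , add , s) = y , addᶠ⁺ e (y ∷ᵛ ρ) (suc i) zero add , shapeᶠ⁺ es m (y ∷ᵛ ρ) zero s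

    shapeᶠ⁻ : ∀ es m {k} (ρ : Vector (Carrier α) k) i → Shape α es m (ρ i) → Sat O ρ (shapeᶠ es m i)
    shapeᶠ⁻ [] m ρ i (room , ¬closed) =
      (λ (p , x≤p , ¬r) → let r , add = room p x≤p in ¬r (r , addᶠ⁻ m (r ∷ᵛ p ∷ᵛ ρ) (suc zero) zero add)) ,
      λ (y , c) → ¬closed y (closedᶠ⁺ m (y ∷ᵛ ρ) (suc i) zero c)
    shapeᶠ⁻ (e ∷ es) m ρ i (y , add , s) = y , addᶠ⁻ e (y ∷ᵛ ρ) (suc i) zero add , shapeᶠ⁻ es m (y ∷ᵛ ρ) zero s

    hasShapeᶠ⁺ : ∀ es m → O ⊨ hasShapeᶠ es m → HasShape α es m
    hasShapeᶠ⁺ es m (x , ¬z , s) = x , (λ z z<x → ¬z (z , z<x)) , shapeᶠ⁺ es m _ zero s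

    hasShapeᶠ⁻ : ∀ es m → HasShape α es m → O ⊨ hasShapeᶠ es m
    hasShapeᶠ⁻ es m (x , x≤ , s) = x , (λ (z , z<x) → x≤ z z<x) , shapeᶠ⁻ es m _ zero s

    spaciousᶠ⁺ : (∀ m → O ⊨ spaciousᶠ m) → Spacious α
    spaciousᶠ⁺ sat m x = dne λ ¬y → sat m (x , λ (y , add) → ¬y (y , addᶠ⁺ m (y ∷ᵛ x ∷ᵛ λ ()) (suc zero) zero add))

    spaciousᶠ⁻ : Spacious α → ∀ m → O ⊨ spaciousᶠ m
    spaciousᶠ⁻ room m (x , ¬y) = let y , add = room m x in ¬y (y , addᶠ⁻ m _ (suc zero) zero add)

-- Arithmetic of Cantor normal forms.

module NormalForms (em : ∀ {ℓ : Level} → ExcludedMiddle ℓ) (n : ℕ) where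

  open import Data.Irrelevant using ([_])
  open import Data.List using (_∷ʳ_; _++_; map; replicate; length)
  open import Data.List.Properties using (∷ʳ-++; ++-identityʳ)
  open import Data.List.Relation.Binary.Lex.Strict as Lex using (halt; this; next)
  open import Data.List.Relation.Unary.All as All using (All; []; _∷_)
  open import Data.List.Relation.Unary.All.Properties using (∷ʳ⁺)
  open import Data.List.Relation.Unary.Linked as Linked using (Linked; []; [-]; _∷_)
  open import Data.Nat using (_≤_; _≥_; _<_; s≤s⁻¹)
  open import Data.Refinement using (value; _,_)
  open Classical em
  open Words em n
  open Sums em n
  open Definability em n

  private module Ω = Order ω^ω

  linked : (x : CNF) → Linked _≥_ (value x)
  linked (xs , [ l ]) = recompute (Linked.linked? ℕ._≥?_ xs) l

  linked-∷ʳ : ∀ {e xs} → Linked _≥_ xs → All (e ≤_) xs → Linked _≥_ (xs ∷ʳ e)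
  linked-∷ʳ []      []      = [-]
  linked-∷ʳ [-]     (p ∷ _) = p ∷ [-]
  linked-∷ʳ (q ∷ l) (_ ∷ p) = q ∷ linked-∷ʳ l p

  linked-head : ∀ {x xs} → Linked _≥_ (x ∷ xs) → All (_≤ x) xs
  linked-head [-]     = []
  linked-head (p ∷ l) = p ∷ All.map (λ q → ℕ.≤-trans q p) (linked-head l)

  linked-split : ∀ xs {e ys} → Linked _≥_ (xs ++ e ∷ ys) → Linked _≥_ xs × All (e ≤_) xs
  linked-split []           _       = [] , []
  linked-split (x ∷ [])     (p ∷ _) = [-] , p ∷ []
  linked-split (x ∷ y ∷ xs) (p ∷ l) with linked-split (y ∷ xs) l
  ... | l′ , q ∷ qs = p ∷ l′ , ℕ.≤-trans q p ∷ q ∷ qs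

  snoc : (x : CNF) → ∀ e → All (e ≤_) (value x) → CNF
  snoc x e p = value x ∷ʳ e , [ linked-∷ʳ (linked x) p ]

  ≮[] : ∀ {xs} → ¬ xs <ˡ []
  ≮[] {[]} (Lex.base ())

  xs<xs∷ʳ : ∀ xs e → xs <ˡ (xs ∷ʳ e)
  xs<xs∷ʳ []       e = halt
  xs<xs∷ʳ (x ∷ xs) e = next refl (xs<xs∷ʳ xs e)

  -- The part of a normal form that is divisible by ω^e.
  trunc : ℕ → List ℕ → List ℕ
  trunc e []       = []
  trunc e (x ∷ xs) with e ℕ.≤? x
  ... | yes _ = x ∷ trunc e xs
  ... | no _  = []

  trunc-All : ∀ e xs → All (e ≤_) (trunc e xs)
  trunc-All e []       = []
  trunc-All e (x ∷ xs) with e ℕ.≤? x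
  ... | yes e≤x = e≤x ∷ trunc-All e xs
  ... | no _    = []

  trunc-linked : ∀ e {xs} → Linked _≥_ xs → Linked _≥_ (trunc e xs)
  trunc-linked e {[]}     _ = []
  trunc-linked e {x ∷ []} _ with e ℕ.≤? x
  ... | yes _ = [-]
  ... | no _  = []
  trunc-linked e {x ∷ y ∷ xs} (p ∷ l) with e ℕ.≤? x | trunc-linked e l
  ... | no _  | _ = []
  ... | yes _ | l′ with e ℕ.≤? y
  ...   | yes _ = p ∷ l′
  ...   | no _  = [-]

  trunc-0 : ∀ xs → trunc 0 xs ≡ xs
  trunc-0 []       = refl
  trunc-0 (x ∷ xs) = cong (x ∷_) (trunc-0 xs)

  -- raise e x = x + ω^e
  raise : ℕ → CNF → CNF
  raise e x = trunc e (value x) ∷ʳ e , [ linked-∷ʳ (trunc-linked e (linked x)) (trunc-All e (value x)) ]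

  raise-All : ∀ e x → All (e ≤_) (value (raise e x))
  raise-All e x = ∷ʳ⁺ (trunc-All e (value x)) ℕ.≤-refl

  trunc-above : ∀ e xs → xs <ˡ (trunc e xs ∷ʳ e)
  trunc-above e []       = halt
  trunc-above e (x ∷ xs) with e ℕ.≤? x
  ... | yes _  = next refl (trunc-above e xs)
  ... | no e≰x = this (ℕ.≰⇒> e≰x)

  trunc-below : ∀ e xs {ys} → All (suc e ≤_) ys → xs <ˡ ys → (trunc e xs ∷ʳ e) <ˡ ys
  trunc-below e []       {[]}     _       (Lex.base ())
  trunc-below e []       {y ∷ ys} (p ∷ _) halt = this p
  trunc-below e (x ∷ xs) {y ∷ ys} (p ∷ ps) x<y with e ℕ.≤? x
  trunc-below e (x ∷ xs) {y ∷ ys} (p ∷ ps) (this x<y)       | yes _  = this x<y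
  trunc-below e (x ∷ xs) {y ∷ ys} (p ∷ ps) (next refl xs<)  | yes _  = next refl (trunc-below e xs ps xs<)
  trunc-below e (x ∷ xs) {y ∷ ys} (p ∷ ps) _                | no _   = this p

  -- The candidate `raise (suc m) c` is closed, by the lemma for `m` below it. The least closed
  -- point is at most this candidate, and `trunc-below` puts the candidate below `d`.
  add-below : ∀ m c d → All (suc m ≤_) (value d) → c Ω.< d → ∃ λ q → q Ω.< d × Add ω^ω m c q
  add-below zero c d d≥ c<d = proj₁ (ω^ω-isLimit c) ,
    subst (λ xs → (xs ∷ʳ 0) <ˡ value d) (trunc-0 (value c)) (trunc-below 0 (value c) d≥ c<d) , proj₂ (ω^ω-isLimit c)
  add-below (suc m) c d d≥ c<d =
    let y , closed , first = least ω^ω (Closed ω^ω m c) (raise (suc m) c , trunc-above (suc m) (value c) ,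
          λ p _ p<q → add-below m p (raise (suc m) c) (raise-All (suc m) c) p<q)
        y≤q = first (raise (suc m) c) (trunc-above (suc m) (value c) ,
          λ p _ p<q → add-below m p (raise (suc m) c) (raise-All (suc m) c) p<q)
    in y , Ω.≤-<-trans {y} {raise (suc m) c} {d} y≤q (trunc-below (suc m) (value c) d≥ c<d) ,
       closed , λ z z<y c → first z c z<y

  ω^ω-spacious : Spacious ω^ω
  ω^ω-spacious m c = let q , _ , add = add-below m c (raise (suc m) c) (raise-All (suc m) c) (trunc-above (suc m) (value c))
                     in q , add

  single : ℕ → CNF
  single i = i ∷ [] , [ [-] ]

  ω^ω-unbounded : Unbounded ω^ω single
  ω^ω-unbounded ([] , _)     = 0 , λ ()
  ω^ω-unbounded (e ∷ es , _) = suc e , λ { (this e+1<e) → ℕ.<-asym e+1<e ℕ.≤-refl ; (next () _) }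

  replicate-bound : ∀ i m {ys} → All (_≤ m) ys → replicate i m <ˡ ys → i < length ys
  replicate-bound zero    m {[]}     _        (Lex.base ())
  replicate-bound zero    m {y ∷ ys} _        _             = s≤s z≤n
  replicate-bound (suc i) m {y ∷ ys} (p ∷ ps) (this m<y)    = ⊥-elim (ℕ.≤⇒≯ p m<y)
  replicate-bound (suc i) m {y ∷ ys} (p ∷ ps) (next _ rec)  = s≤s (replicate-bound i m ps rec)

  -- Such a list `ys` continues `xs` by exponents at most `m`, and `i` of these cannot exceed ω^m·i.
  -- In `not-closed` this would make the length of a list smaller than itself.
  between-bound : ∀ i m xs {ys} → Linked _≥_ ys → (xs ++ replicate i m) <ˡ ys → ys <ˡ (xs ∷ʳ suc m) → i < length ys
  between-bound i m [] {[]}     _ p             _ = replicate-bound i m [] p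
  between-bound i m [] {y ∷ ys} l p (this (s≤s y≤m)) =
    replicate-bound i m (y≤m ∷ All.map (λ q → ℕ.≤-trans q y≤m) (linked-head l)) p
  between-bound i m [] {y ∷ ys} l p (next _ (Lex.base ()))
  between-bound i m (x ∷ xs) {[]} _ () _
  between-bound i m (x ∷ xs) {y ∷ ys} l (this x<y)    (this y<x)    = ⊥-elim (ℕ.<-asym x<y y<x)
  between-bound i m (x ∷ xs) {y ∷ ys} l (this x<y)    (next refl _) = ⊥-elim (ℕ.<-irrefl refl x<y)
  between-bound i m (x ∷ xs) {y ∷ ys} l (next refl _) (this y<x)    = ⊥-elim (ℕ.<-irrefl refl y<x)
  between-bound i m (x ∷ xs) {y ∷ ys} l (next _ p)    (next _ q)    = ℕ.m≤n⇒m≤1+n (between-bound i m xs (Linked.tail l) p q)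

  replicate-∷ʳ : ∀ i (m : ℕ) → replicate i m ∷ʳ m ≡ m ∷ replicate i m
  replicate-∷ʳ zero    m = refl
  replicate-∷ʳ (suc i) m = cong (m ∷_) (replicate-∷ʳ i m)

  ∷ʳ-replicate : ∀ xs i (m : ℕ) → (xs ++ replicate i m) ∷ʳ m ≡ xs ++ replicate (suc i) m
  ∷ʳ-replicate []       i m = replicate-∷ʳ i m
  ∷ʳ-replicate (x ∷ xs) i m = cong (x ∷_) (∷ʳ-replicate xs i m)

  add-snoc : ∀ m c (c≥ : All (m ≤_) (value c)) → Add ω^ω m c (snoc c m c≥)
  not-closed : ∀ m c (c≥ : All (suc m ≤_) (value c)) y → y Ω.< snoc c (suc m) c≥ → ¬ Closed ω^ω m c y
  add-snoc zero    c c≥ = proj₂ (ω^ω-isLimit c)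
  add-snoc (suc m) c c≥ =
    (xs<xs∷ʳ (value c) (suc m) , λ p _ p<d → add-below m p (snoc c (suc m) c≥) (∷ʳ⁺ c≥ ℕ.≤-refl) p<d) ,
    not-closed m c c≥
  -- A closed y above c would lie above c + ω^m·i for every i.
  not-closed m c c≥ y y<d (c<y , closed) =
    let x , e , _ , x<y = multiples (length (value y)) in
    ℕ.<-irrefl refl (between-bound (length (value y)) m (value c) (linked y)
      (subst (_<ˡ value y) e x<y) y<d)
    where
    multiples : ∀ i → ∃ λ x → value x ≡ value c ++ replicate i m × All (m ≤_) (value x) × x Ω.< y
    multiples zero    = c , sym (++-identityʳ (value c)) , All.map (ℕ.≤-trans (ℕ.n≤1+n m)) c≥ , c<y
    multiples (suc i) =
      let x , e , x≥ , x<y = multiples i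
          q , q<y , add = closed x (λ x<c → extension (value c) (subst (_<ˡ value c) e x<c)) x<y
      in snoc x m x≥ , trans (cong (_∷ʳ m) e) (∷ʳ-replicate (value c) i m) , ∷ʳ⁺ x≥ ℕ.≤-refl ,
         subst (Ω._< y) (Add-functional ω^ω m {x} {q} {snoc x m x≥} add (add-snoc m x x≥)) q<y
      where
      extension : ∀ xs {ys} → ¬ (xs ++ ys) <ˡ xs
      extension []       {[]} (Lex.base ())
      extension (x ∷ xs) (this x<x) = ℕ.<-irrefl refl x<x
      extension (x ∷ xs) (next _ p) = extension xs p

  module _ (θ : Ordinal a) (θ-lim : IsLimit θ) (θ⁺ : Positive θ) (l : CNF) (e : θ ≅ ω^ω ↓ l) where
    private
      open Iso θ (ω^ω ↓ l) e
      module T = Order θ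

      bound : (x : Carrier (ω^ω ↓ l)) → value x Ω.< l
      bound (x , [ p ]) = recompute (x Ω.<? l) p

      h : Carrier θ → CNF
      h x = value (proj₁ e x)

      at : ∀ x → x Ω.< l → ∃ λ z → h z ≡ x
      at x x<l = back (x , [ x<l ]) , cong value (to-back (x , [ x<l ]))

      ι : Initial θ ω^ω
      ι = record { map = h ; mono = mono ; down = λ {x} {z} z<hx →
            at z (Ω.<-trans {z} {h x} {l} z<hx (bound (proj₁ e x))) }

      suffix : ∀ xs e ys → value l ≡ xs ++ e ∷ ys → Linked _≥_ xs × All (e ≤_) xs
      suffix xs e ys eq = linked-split xs (subst (Linked _≥_) eq (linked l))

      prefix< : ∀ xs {y ys} → xs <ˡ (xs ++ y ∷ ys)
      prefix< []       = halt
      prefix< (x ∷ xs) = next refl (prefix< xs)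

      -- Reads the normal form of `l` from left to right. Its proper prefixes lie below `l` and so
      -- are points of θ, each obtained from the preceding one by adding a power of ω.
      shape : ∀ xs y ys → value l ≡ xs ++ y ∷ ys → ∀ x → value (h x) ≡ xs → ∃₂ λ es m → Shape θ es m x
      -- A last exponent 0 would make `h x` the predecessor of `l` and `x` the maximum of θ, which
      -- is a limit.
      shape xs zero [] eq x hx≡ = ⊥-elim (
        let z , x<z , _ = θ-lim x
        in proj₂ (proj₂ (ω^ω-isLimit (h x))) (h z) (mono x<z)
             (subst (value (h z) <ˡ_) (trans eq (cong (_∷ʳ 0) (sym hx≡))) (bound (proj₁ e z))))
      shape xs (suc m) [] eq x refl = [] , m ,
        (λ p x≤p → let q , q<l , add = add-below m (h p) l (subst (All (suc m ≤_)) (sym eq) (∷ʳ⁺ x≥ ℕ.≤-refl)) (bound (proj₁ e p))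
                       z , hz≡q = at q q<l
                   in z , Add⁻ θ ω^ω ι m (subst (Add ω^ω m (h p)) (sym hz≡q) add)) ,
        λ y c → not-closed m (h x) x≥ (h y) (subst (value (h y) <ˡ_) eq (bound (proj₁ e y))) (Closed⁺ θ ω^ω ι m c)
        where x≥ = proj₂ (suffix xs (suc m) [] eq)
      shape xs y (y′ ∷ ys) eq x refl =
        let z , hz≡ = at (snoc (h x) y x≥) (subst (value (snoc (h x) y x≥) <ˡ_) (sym eq′) (prefix< (xs ∷ʳ y)))
            es , m , s = shape (xs ∷ʳ y) y′ ys eq′ z (cong value hz≡)
        in y ∷ es , m , z , Add⁻ θ ω^ω ι y (subst (Add ω^ω y (h x)) (sym hz≡) (add-snoc y (h x) x≥)) , s
        where
        x≥ = proj₂ (suffix xs y (y′ ∷ ys) eq)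
        eq′ : value l ≡ (xs ∷ʳ y) ++ y′ ∷ ys
        eq′ = trans eq (sym (∷ʳ-++ xs y (y′ ∷ ys)))

      nonempty : ∀ xs → value l ≡ xs → ∃₂ λ y ys → value l ≡ y ∷ ys
      nonempty (y ∷ ys) eq = y , ys , eq
      nonempty []       eq = ⊥-elim (≮[] (subst (value (h θ⁺) <ˡ_) eq (bound (proj₁ e θ⁺))))

    has-shape : ∃₂ λ es m → HasShape θ es m
    has-shape =
      let y , ys , eq = nonempty (value l) refl
          x , hx≡ = at ([] , [ [] ]) (subst ([] <ˡ_) (sym eq) halt)
          es , m , s = shape [] y ys eq x (cong value hx≡)
      in es , m , x , (λ z z<x → ≮[] (subst (h z Ω.<_) hx≡ (mono z<x))) , s

  mono-≥ : (α : Ordinal a) (h : Carrier α → Carrier α) → (∀ {x y} → Ordinal._<_ α x y → Ordinal._<_ α (h x) (h y)) →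
           ∀ x → ¬ Ordinal._<_ α (h x) x
  mono-≥ α h mono x = go x (Ordinal.wellFounded α x)
    where
    go : ∀ x → Acc (Ordinal._<_ α) x → ¬ Ordinal._<_ α (h x) x
    go x (acc rec) hx<x = go (h x) (rec hx<x) (mono hx<x)

  private
    shift : ℕ → List ℕ → List ℕ
    shift m xs = map (m +_) xs ∷ʳ m

    shift-linked : ∀ m {xs} → Linked _≥_ xs → Linked _≥_ (shift m xs)
    shift-linked m {[]}         _       = [-]
    shift-linked m {x ∷ []}     _       = ℕ.m≤m+n m x ∷ [-]
    shift-linked m {x ∷ y ∷ xs} (p ∷ l) = ℕ.+-monoʳ-≤ m p ∷ shift-linked m l

    shift-mono : ∀ m {xs ys} → xs <ˡ ys → shift m xs <ˡ shift m ys
    shift-mono m (Lex.base ())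
    shift-mono m {ys = zero ∷ []}        halt = next (sym (ℕ.+-identityʳ m)) halt
    shift-mono m {ys = zero ∷ _ ∷ _}     halt = next (sym (ℕ.+-identityʳ m)) halt
    shift-mono m {ys = suc y ∷ _}        halt = this (ℕ.m<m+n m (s≤s z≤n))
    shift-mono m (this x<y)    = this (ℕ.+-monoʳ-< m x<y)
    shift-mono m (next refl p) = next refl (shift-mono m p)

  -- x ↦ ω^m·x + ω^m maps ω^ω above any given y.
  embed-above : ∀ y → ∃ λ (h : CNF → CNF) → (∀ {x z} → x Ω.< z → h x Ω.< h z) × (∀ x → y Ω.< h x)
  embed-above y = (λ x → shift (m (value y)) (value x) , [ shift-linked _ (linked x) ]) , shift-mono _ , λ x → above (value y) (value x)
    where
    m : List ℕ → ℕ
    m []      = 0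
    m (e ∷ _) = suc e
    above : ∀ ys xs → ys <ˡ shift (m ys) xs
    above []       []       = halt
    above []       (_ ∷ _)  = halt
    above (y ∷ ys) []       = this ℕ.≤-refl
    above (y ∷ ys) (x ∷ xs) = this (s≤s (ℕ.m≤m+n y x))

  Single : CNF → Set
  Single x = ∃ λ i → value x ≡ i ∷ []

  -- `z` is the largest power of ω below `y`, or 0 if `y` is 1.
  singles-discrete : ∀ y → (∃ λ x → x Ω.< y) → ∃ λ z → z Ω.< y × (∀ w → z Ω.< w → w Ω.< y → ¬ Single w)
  singles-discrete ([] , _) (([] , _) , Lex.base ())
  singles-discrete (zero ∷ [] , _) _ = ([] , [ [] ]) , halt ,
    λ { (.(i ∷ []) , _) _ (this ()) (i , refl) ; (.(zero ∷ []) , _) _ (next refl (Lex.base ())) (_ , refl) }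
  singles-discrete (suc e ∷ [] , _) _ = (e ∷ [] , [ [-] ]) , this ℕ.≤-refl ,
    λ { (.(i ∷ []) , _) (this e<i) (this i≤e) (i , refl) → ℕ.<⇒≱ e<i (s≤s⁻¹ i≤e)
      ; (.(i ∷ []) , _) (next _ (Lex.base ())) _ (i , refl)
      ; (.(suc e ∷ []) , _) _ (next refl (Lex.base ())) (_ , refl) }
  singles-discrete (e ∷ f ∷ r , _) _ = (e ∷ [] , [ [-] ]) , next refl halt ,
    λ { (.(i ∷ []) , _) (this e<i) (this i<e) (i , refl) → ℕ.<-asym e<i i<e
      ; (.(i ∷ []) , _) (next _ (Lex.base ())) _ (i , refl)
      ; (.(e ∷ []) , _) (this e<e) (next refl _) (_ , refl) → ℕ.<-irrefl refl e<e }

-- Interpreting orders in the tree.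

module Interpretation (em : ∀ {ℓ : Level} → ExcludedMiddle ℓ) (n : ℕ) where

  open import Data.Irrelevant using ([_])
  open import Data.Refinement using (Refinement-syntax; value; value-injective; _,_)
  open import Data.Vec.Functional using (Vector) renaming (_∷_ to _∷ᵛ_)
  import Relation.Binary.Construct.On as On
  open Classical em
  open Words em n
  open TreeGame em n
  open Sums em n

  infix 8 _↑_
  _↑_ : (α : Ordinal a) → Carrier α → Ordinal a
  α ↑ l = record
    { Carrier            = [ x ∈ Carrier α ∣ ¬ x < l ]
    ; _<_                = λ x y → value x < value y
    ; isStrictTotalOrder = isStrictTotalOrderᶜ (record
        { isEquivalence = isEquivalence ; trans = <-trans ; compare = cmp })
    ; wellFounded        = On.wellFounded value wellFounded
    }
    where
    open Ordinal α hiding (Carrier)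
    cmp : Trichotomous {A = [ x ∈ Carrier α ∣ ¬ x < l ]} _≡_ (λ x y → value x < value y)
    cmp x y with compare (value x) (value y)
    ... | tri< p q r = tri< p (q ∘ cong value) r
    ... | tri≈ p q r = tri≈ p (value-injective q) r
    ... | tri> p q r = tri> p (q ∘ cong value) r

  above : (α : Ordinal a) {l : Carrier α} (x : Carrier (α ↑ l)) → ¬ Ordinal._<_ α (value x) l
  above α (x , [ p ]) x<l = ⊥-elim-irr (p x<l)

  module _ {m : ℕ} where
    infix 6 _⊑_ _⊏_
    _⊑_ _⊏_ : Fin m → Fin m → Formula (Tree n) m
    i ⊑ j = rel ⊆ (var i ∷ᵛ var j ∷ᵛ λ ())
    i ⊏ j = (i ⊑ j) and not (j ⊑ i)

    childᶠ : Fin n → Fin m → Fin m → Formula (Tree n) m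
    childᶠ c i j = rel ⊆ (func (S c) (λ _ → var i) ∷ᵛ var j ∷ᵛ λ ())

  -- Elements are interpreted by the nodes x that satisfy δ x p for a parameter p.
  module Translate (δ : ∀ {m} → Fin m → Fin m → Formula (Tree n) m) where

    variableOf : ∀ {k} → Term Order k → Fin k
    variableOf (var i) = i

    lift⁺ : ∀ {k m} → (Fin k → Fin m) → Fin (suc k) → Fin (suc m)
    lift⁺ r zero    = zero
    lift⁺ r (suc i) = suc (r i)

    translate : ∀ {k m} → Formula Order k → (Fin k → Fin m) → Fin m → Formula (Tree n) m
    translate (s ≐ t)     r p = var (r (variableOf s)) ≐ var (r (variableOf t))
    translate (rel lt ts) r p = r (variableOf (ts zero)) ⊏ r (variableOf (ts (suc zero)))
    translate (not φ)     r p = not (translate φ r p)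
    translate (φ and ψ)   r p = translate φ r p and translate ψ r p
    translate (exists φ)  r p = exists (δ zero (suc p) and translate φ (lift⁺ r) (suc p))

  prefixᶠ : ∀ {m} → Fin m → Fin m → Formula (Tree n) m
  prefixᶠ i p = i ⊏ p

  -- The nodes `i` that continue `p` by letters `i₀` only. They form a chain whose order type is the
  -- remainder of α after the length of `p`, so sentences about this remainder can be evaluated at
  -- `p`.
  zerosᶠ : Fin n → ∀ {m} → Fin m → Fin m → Formula (Tree n) m
  zerosᶠ i₀ i p = (p ⊑ i) and not (exists ((suc p ⊑ zero) and ((zero ⊏ suc i) and not (childᶠ i₀ zero (suc i)))))

  module Semantics (α : Ordinal a) (lim : IsLimit α) (i₀ : Fin n)
                   {x₀ : Carrier α} (x₀≤ : ∀ z → Order._≤_ α x₀ z) where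
    open Order α
    open WordNodes α i₀ public
    private
      T = 𝔗 α n lim

    len : Word α n → Carrier α
    len = proj₁

    at : Word α n → Carrier α → Fin n
    at w = proj₂ (toNode w)

    Agree : Word α n → Word α n → Set a
    Agree v w = ∀ z → z < len v → at v z ≡ at w z

    ⊆⁺ : ∀ {v w} → _⊆ʷ_ α n v w → len v ≤ len w × Agree v w
    ⊆⁺ p = let l , e = ⊆⇒Prefix x₀ p in l , λ z → e z (x₀≤ z)

    ⊆⁻ : ∀ {v w} → len v ≤ len w → Agree v w → _⊆ʷ_ α n v w
    ⊆⁻ l e = Prefix⇒⊆ x₀≤ (l , λ z _ → e z)

    ⊏⁺ : ∀ {v w} → _⊆ʷ_ α n v w × ¬ _⊆ʷ_ α n w v → len v < len w × Agree v w
    ⊏⁺ {v} {w} (p , ¬q) with ⊆⁺ p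
    ... | l≤m , e with ≤⇒<⊎≡ l≤m
    ...   | inj₁ l<m = l<m , e
    ...   | inj₂ l≡m = ⊥-elim (¬q (⊆⁻ (≤-reflexive (sym l≡m)) λ z z<m → sym (e z (subst (z <_) (sym l≡m) z<m))))

    ⊏⁻ : ∀ {v w} → len v < len w → Agree v w → _⊆ʷ_ α n v w × ¬ _⊆ʷ_ α n w v
    ⊏⁻ l<m e = ⊆⁻ (<⇒≤ l<m) e , λ q → proj₁ (⊆⁺ q) l<m

    child⁺ : ∀ {c v w} → _⊆ʷ_ α n (extend α n lim c v) w → len v < len w × at w (len v) ≡ c × Agree v w
    child⁺ {c} {v} p with ⊆⁺ p
    ... | s≤m , e = let v<s = proj₁ (proj₂ (lim (len v))) in
      <-≤-trans v<s s≤m , trans (sym (e _ v<s)) (extend-≡ x₀≤ lim c v) ,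
      λ z z<v → trans (sym (extend-< x₀≤ lim c v z<v)) (e z (<-trans z<v v<s))

    child⁻ : ∀ {c v w} → len v < len w → at w (len v) ≡ c → Agree v w → _⊆ʷ_ α n (extend α n lim c v) w
    child⁻ {c} {v} {w} v<w e agree = ⊆⁻ (Succ⇒≤ (proj₂ (lim (len v))) v<w) letters
      where
      letters : ∀ z → z < proj₁ (lim (len v)) → at (extend α n lim c v) z ≡ at w z
      letters z z< with ≤⇒<⊎≡ (<Succ⇒≤ (proj₂ (lim (len v))) z<)
      ... | inj₁ z<v  = trans (extend-< x₀≤ lim c v z<v) (agree z z<v)
      ... | inj₂ refl = trans (extend-≡ x₀≤ lim c v) (sym e)

    word : Carrier α → (Carrier α → Fin n) → Word α n
    word z g = fromNode (z , g)

    word-at : ∀ {z g u} → u < z → at (word z g) u ≡ g u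
    word-at {z} {g} {u} u<z = sym (proj₂ (fromNode-≗ (z , g)) u u<z)

    module Interpretation (γ : Ordinal b) (e : Carrier γ → Carrier α)
                          (mono : ∀ {x y} → Ordinal._<_ γ x y → e x < e y) (g : Carrier α → Fin n)
                          (δ : ∀ {m} → Fin m → Fin m → Formula (Tree n) m) (w : Word α n) where
      open Translate δ

      -- All representing nodes lie on the branch `g`, so each point has one node up to equality of
      -- words, and inclusion of these nodes is the order of γ.
      Represents : Word α n → Carrier γ → Set a
      Represents v x = len v ≡ e x × (∀ z → z < len v → at v z ≡ g z)

      module _ (δ⁺ : ∀ {m} (ρ : Vector (Word α n) m) i p → ρ p ≡ w → Sat T ρ (δ i p) → ∃ (Represents (ρ i)))
               (δ⁻ : ∀ {m} (ρ : Vector (Word α n) m) i p → ρ p ≡ w → ∃ (Represents (ρ i)) → Sat T ρ (δ i p)) where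

        private
          represent : ∀ x → Represents (word (e x) g) x
          represent x = refl , λ z → word-at

          agree : ∀ {v v′ x x′} → Represents v x → Represents v′ x′ → len v ≤ len v′ → Agree v v′
          agree (_ , h) (_ , h′) v≤v′ z z<v = trans (h z z<v) (sym (h′ z (<-≤-trans z<v v≤v′)))

          extend-rep : ∀ {k m} {σ : Vector (Carrier γ) k} {ρ : Vector (Word α n) m} {r x v} →
                       (∀ i → Represents (ρ (r i)) (σ i)) → Represents v x →
                       ∀ i → Represents ((v ∷ᵛ ρ) (lift⁺ r i)) ((x ∷ᵛ σ) i)
          extend-rep reps rv zero    = rv
          extend-rep reps rv (suc i) = reps i

        translate-correct : ∀ {k m} (φ : Formula Order k) (σ : Vector (Carrier γ) k) (ρ : Vector (Word α n) m) r p →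
          ρ p ≡ w → (∀ i → Represents (ρ (r i)) (σ i)) →
          (Sat (orderStructure γ) σ φ → Sat T ρ (translate φ r p)) ×
          (Sat T ρ (translate φ r p) → Sat (orderStructure γ) σ φ)
        translate-correct (var i ≐ var j) σ ρ r p eq reps =
          (λ { x≡y → let l≡m = trans (proj₁ (reps i)) (trans (cong e x≡y) (sym (proj₁ (reps j)))) in
                 ⊆⁻ (≤-reflexive l≡m) (agree (reps i) (reps j) (≤-reflexive l≡m)) ,
                 ⊆⁻ (≤-reflexive (sym l≡m)) (agree (reps j) (reps i) (≤-reflexive (sym l≡m))) }) ,
          (λ (p , q) → mono-injective γ α e mono (trans (sym (proj₁ (reps i)))
                 (trans (≤-antisym (proj₁ (⊆⁺ p)) (proj₁ (⊆⁺ q))) (proj₁ (reps j)))))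
        translate-correct (rel lt ts) σ ρ r p eq reps with ts zero | ts (suc zero)
        ... | var i | var j =
          (λ x<y → let l<m = subst (_< len (ρ (r j))) (sym (proj₁ (reps i)))
                               (subst (e (σ i) <_) (sym (proj₁ (reps j))) (mono x<y)) in
                 ⊏⁻ l<m (agree (reps i) (reps j) (<⇒≤ l<m))) ,
          (λ s → mono⇒cancel γ α e mono (subst (_< e (σ j)) (proj₁ (reps i))
                   (subst (len (ρ (r i)) <_) (proj₁ (reps j)) (proj₁ (⊏⁺ s)))))
        translate-correct (not φ) σ ρ r p eq reps =
          let to , from = translate-correct φ σ ρ r p eq reps in (λ ¬φ φ′ → ¬φ (from φ′)) , (λ ¬φ φ′ → ¬φ (to φ′))
        translate-correct (φ and ψ) σ ρ r p eq reps =
          let to₁ , from₁ = translate-correct φ σ ρ r p eq reps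
              to₂ , from₂ = translate-correct ψ σ ρ r p eq reps
          in (λ (x , y) → to₁ x , to₂ y) , (λ (x , y) → from₁ x , from₂ y)
        translate-correct (exists φ) σ ρ r p eq reps =
          (λ (x , s) → let v = word (e x) g in v , δ⁻ (v ∷ᵛ ρ) zero (suc p) eq (x , represent x) ,
             proj₁ (translate-correct φ (x ∷ᵛ σ) (v ∷ᵛ ρ) (lift⁺ r) (suc p) eq (extend-rep reps (represent x))) s) ,
          (λ (v , d , s) → let x , rep = δ⁺ (v ∷ᵛ ρ) zero (suc p) eq d in x ,
             proj₂ (translate-correct φ (x ∷ᵛ σ) (v ∷ᵛ ρ) (lift⁺ r) (suc p) eq (extend-rep reps rep)) s)

    module _ (γ : Ordinal b) (e : Carrier γ → Carrier α) (mono : ∀ {x y} → Ordinal._<_ γ x y → e x < e y)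
             (w : Word α n) where

      module _ (image : ∀ x → e x < len w) (onto : ∀ z → z < len w → ∃ λ x → e x ≡ z) where
        private
          open module I = Interpretation γ e mono (at w) prefixᶠ w using (Represents)

          δ⁺ : ∀ {m} (ρ : Vector (Word α n) m) i p → ρ p ≡ w → Sat T ρ (prefixᶠ i p) → ∃ (Represents (ρ i))
          δ⁺ ρ i p refl s = let v<w , agree = ⊏⁺ s ; x , ex≡ = onto _ v<w in x , sym ex≡ , agree

          δ⁻ : ∀ {m} (ρ : Vector (Word α n) m) i p → ρ p ≡ w → ∃ (Represents (ρ i)) → Sat T ρ (prefixᶠ i p)
          δ⁻ ρ i p refl (x , l≡ , h) = ⊏⁻ (subst (_< len w) (sym l≡) (image x)) h

        -- γ may be any presentation of the positions of `w`: the segment of α below the length of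
        -- `w` in one direction of the theorem, and ω^ω inside ω^ω + θ in the other.
        prefix-correct : ∀ φ {m} (ρ : Vector (Word α n) m) p → ρ p ≡ w →
          (orderStructure γ ⊨ φ → Sat T ρ (Translate.translate prefixᶠ φ (λ ()) p)) ×
          (Sat T ρ (Translate.translate prefixᶠ φ (λ ()) p) → orderStructure γ ⊨ φ)
        prefix-correct φ ρ p eq = I.translate-correct δ⁺ δ⁻ φ (λ ()) ρ (λ ()) p eq (λ ())

      module _ (image : ∀ x → len w ≤ e x) (onto : ∀ z → len w ≤ z → ∃ λ x → e x ≡ z) where
        private
          g : Carrier α → Fin n
          g = splice α (len w) (at w) (λ _ → i₀)

          open module I = Interpretation γ e mono g (zerosᶠ i₀) w using (Represents)

          δ⁺ : ∀ {m} (ρ : Vector (Word α n) m) i p → ρ p ≡ w → Sat T ρ (zerosᶠ i₀ i p) → ∃ (Represents (ρ i))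
          δ⁺ ρ i p refl (w⊆v , ¬bad) = let w≤v , agree = ⊆⁺ w⊆v ; x , ex≡ = onto _ w≤v in
            x , sym ex≡ , letters agree
            where
            v = ρ i
            letters : Agree w v → ∀ z → z < len v → at v z ≡ g z
            letters agree z z<v with <⊎≥ z (len w)
            ... | inj₁ z<w = sym (agree z z<w)
            ... | inj₂ w≤z = dne λ v≢i₀ → ¬bad (u , ⊆⁻ w≤z (λ y y<w → trans (agree y y<w) (sym (word-at (<-≤-trans y<w w≤z)))) ,
                  ⊏⁻ {u} {v} z<v (λ y → word-at) , λ c → v≢i₀ (proj₁ (proj₂ (child⁺ {i₀} {u} {v} c))))
              where u = word z (at v)

          δ⁻ : ∀ {m} (ρ : Vector (Word α n) m) i p → ρ p ≡ w → ∃ (Represents (ρ i)) → Sat T ρ (zerosᶠ i₀ i p)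
          δ⁻ ρ i p refl (x , l≡ , h) =
            ⊆⁻ w≤v (λ z z<w → trans (sym (splice-< α z<w)) (sym (h z (<-≤-trans z<w w≤v)))) ,
            λ (u , w⊆u , u⊏v , ¬c) → let u<v , agree = ⊏⁺ u⊏v in
              ¬c (child⁻ u<v (trans (h _ u<v) (splice-≥ α (proj₁ (⊆⁺ w⊆u)))) agree)
            where
            w≤v : len w ≤ len (ρ i)
            w≤v = subst (len w ≤_) (sym l≡) (image x)

        zeros-correct : ∀ φ {m} (ρ : Vector (Word α n) m) p → ρ p ≡ w →
          (orderStructure γ ⊨ φ → Sat T ρ (Translate.translate (zerosᶠ i₀) φ (λ ()) p)) ×
          (Sat T ρ (Translate.translate (zerosᶠ i₀) φ (λ ()) p) → orderStructure γ ⊨ φ)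
        zeros-correct φ ρ p eq = I.translate-correct δ⁺ δ⁻ φ (λ ()) ρ (λ ()) p eq (λ ())

-- The two directions of the equivalence.

module Main (em : ∀ {ℓ : Level} → ExcludedMiddle ℓ) (n : ℕ) where

  open import Data.Irrelevant using ([_])
  open import Data.Refinement using (value; value-injective; _,_)
  open import Data.Vec.Functional using (Vector) renaming (_∷_ to _∷ᵛ_)
  open import Function.Bundles using (Equivalence)
  open import Function.Properties.Equivalence using () renaming (trans to ⇔-trans)
  open Classical em
  open Words em n
  open TreeGame em n
  open Sums em n
  open Definability em n
  open NormalForms em n
  open Interpretation em n

  module _ (α : Ordinal a) (α⁺ : Positive α) (no-max : ∀ x → ∃ λ y → Ordinal._<_ α x y) where
    private
      module A = Order α

    bounded-image : (β : Ordinal b) (g : Initial β ω) (f : Carrier β → Carrier α) →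
                    ∀ m → ∃ λ y → ∀ x → Initial.map g x ℕ.< m → f x A.< y
    bounded-image β g f zero    = α⁺ , λ _ ()
    bounded-image β g f (suc m) with bounded-image β g f m | em {P = ∃ λ x → Initial.map g x ≡ m}
    ... | y , f<y | no ¬hit = y , λ x gx≤m → f<y x (ℕ.≤∧≢⇒< (ℕ.s≤s⁻¹ gx≤m) λ e → ¬hit (x , e))
    ... | y , f<y | yes (x , gx≡m) =
      let z , z> = upper (f x) y in z , λ x′ gx′≤m → case-≤ x′ (ℕ.m≤n⇒m<n∨m≡n (ℕ.s≤s⁻¹ gx′≤m)) z>
      where
      upper : ∀ u v → ∃ λ z → u A.< z × v A.≤ z
      upper u v with A.<⊎≥ u v
      ... | inj₁ u<v = v , u<v , A.≤-refl
      ... | inj₂ v≤u = let z , u<z = no-max u in z , u<z , A.<⇒≤ (A.≤-<-trans v≤u u<z)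
      case-≤ : ∀ x′ {z} → Initial.map g x′ ℕ.< m ⊎ Initial.map g x′ ≡ m → f x A.< z × y A.≤ z → f x′ A.< z
      case-≤ x′ (inj₁ g<m) (_ , y≤z)   = A.<-≤-trans (f<y x′ g<m) y≤z
      case-≤ x′ (inj₂ g≡m) (fx<z , _) = subst (λ x → f x A.< _)
        (mono-injective β ω (Initial.map g) (Initial.mono g) (trans gx≡m (sym g≡m))) fx<z

    -- Compare ω with β. If ω embeds as an initial segment, then ω ≤ β. Otherwise β embeds into ω;
    -- if it misses some number, it is finite, and a finite image is bounded in an order without
    -- maximum.
    ω-least : (β : Ordinal b) → ∃ (IsCofinal β α) → ω ≤ₒ β
    ω-least β (f , cof) with comparable ω β
    ... | inj₁ ι = embedded (em {P = ∃ λ y → ¬ ∃ λ i → h i ≡ y})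
      where
      open Initial ι renaming (map to h)
      module B = Order β
      unhit : ∀ {z} i → ¬ (∃ λ i → h i ≡ z) → ¬ (z B.< h i ⊎ z ≡ h i)
      unhit i ¬z (inj₁ z<hi) = ¬z (down z<hi)
      unhit i ¬z (inj₂ z≡hi) = ¬z (i , sym z≡hi)
      embedded : Dec (∃ λ y → ¬ ∃ λ i → h i ≡ y) → ω ≤ₒ β
      embedded (no onto) = inj₂ (surjective⇒≅ ω β h mono λ y → dne λ ¬i → onto (y , ¬i))
      embedded (yes missing) =
        let z , ¬z , first = least β (λ y → ¬ ∃ λ i → h i ≡ y) missing
            h<z = λ i → dne λ z≤hi → unhit i ¬z (B.≤⇒<⊎≡ z≤hi)
        in inj₁ (z , surjective⇒≅ ω (β ↓ z) (λ i → h i , [ h<z i ]) mono λ (y , p) →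
             let i , hi≡y = dne {A = ∃ λ i → h i ≡ y} (λ ¬i → first y ¬i (below β (y , p))) in i , value-injective hi≡y)
    ... | inj₂ ι = embedded (em {P = ∃ λ m → ¬ ∃ λ x → h x ≡ m})
      where
      open Initial ι renaming (map to h)
      embedded : Dec (∃ λ m → ¬ ∃ λ x → h x ≡ m) → ω ≤ₒ β
      embedded (no onto) = inj₂ (≅-sym {α = β} {β = ω} (surjective⇒≅ β ω h mono λ m → dne λ ¬x → onto (m , ¬x)))
      embedded (yes (m , ¬m)) =
        let y , f<y = bounded-image β ι f m
            x , fx≥y = cof y
        in ⊥-elim (fx≥y (f<y x (h<m x)))
        where
        h<m : ∀ x → h x ℕ.< m
        h<m x with ℕ.<-cmp (h x) m
        ... | tri< hx<m _ _ = hx<m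
        ... | tri≈ _ hx≡m _ = ⊥-elim (¬m (x , hx≡m))
        ... | tri> _ _ m<hx = ⊥-elim (¬m (down m<hx))

  ≡ₑ-trans : ∀ {L : Signature} {c} {M : Structure L a} {N : Structure L b} {O : Structure L c} →
             M ≡ₑ N → N ≡ₑ O → M ≡ₑ O
  ≡ₑ-trans e f φ = ⇔-trans (e φ) (f φ)

  nonemptyᶠ : Sentence Order
  nonemptyᶠ = exists (var zero ≐ var zero)

  module Sentences (i₀ i₁ : Fin n) (es : List ℕ) (m : ℕ) where

    -- The remainder θ may occur after several lengths; for θ = ω, for example, α₀ can be prolonged
    -- by a finite amount. So `landmarkᶠ` asks for the shortest prefix. The last two formulas say
    -- that the positions of `i₁` are cofinal and have no limit point below the length.
    restᶠ landmarkᶠ cofinalᶠ discreteᶠ : ∀ {k} → Fin k → Formula (Tree n) k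
    restᶠ p = Translate.translate (zerosᶠ i₀) (hasShapeᶠ es m) (λ ()) p
    landmarkᶠ p = restᶠ p and not (exists ((zero ⊏ suc p) and restᶠ zero))
    cofinalᶠ p = not (exists ((zero ⊏ suc p) and
      not (exists ((suc zero ⊑ zero) and childᶠ i₁ zero (suc (suc p))))))
    discreteᶠ p = not (exists ((zero ⊏ suc p) and (exists (zero ⊏ suc zero) and
      not (exists ((zero ⊏ suc zero) and
        not (exists ((suc zero ⊏ zero) and ((zero ⊏ suc (suc zero)) and childᶠ i₁ zero (suc (suc (suc p)))))))))))

    -- For θ of the given shape: some node of length α₀, where α₀ is least with
    -- α = α₀ + θ, has a cofinal set of letters i₁ without limit points, and α₀ ⊨ φ.
    sentence : Sentence Order → Sentence (Tree n)
    sentence φ = exists (landmarkᶠ zero and (cofinalᶠ zero and (discreteᶠ zero and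
      Translate.translate prefixᶠ φ (λ ()) zero)))

    module _ (α : Ordinal a) (lim : IsLimit α) {x₀ : Carrier α} (x₀≤ : ∀ z → Order._≤_ α x₀ z) where
      open Order α
      open Semantics α lim i₀ x₀≤
      private
        T = 𝔗 α n lim

      record Landmark (w : Word α n) : Set a where
        field
          minimal  : ∀ y → y < len w → ¬ HasShape (α ↑ y) es m
          cofinal  : ∀ y → y < len w → ∃ λ z → y ≤ z × z < len w × at w z ≡ i₁
          discrete : ∀ y → y < len w → (∃ λ v → v < y) →
                     ∃ λ z → z < y × (∀ u → z < u → u < y → ¬ at w u ≡ i₁)
      open Landmark public

      private
        restᶠ-correct : ∀ {k} (ρ : Vector (Word α n) k) p →
          (orderStructure (α ↑ len (ρ p)) ⊨ hasShapeᶠ es m → Sat T ρ (restᶠ p)) ×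
          (Sat T ρ (restᶠ p) → orderStructure (α ↑ len (ρ p)) ⊨ hasShapeᶠ es m)
        restᶠ-correct ρ p = zeros-correct (α ↑ len (ρ p)) value id (ρ p) (above α) (λ z w≤z → (z , [ w≤z ]) , refl)
          (hasShapeᶠ es m) ρ p refl

        prefix⊏ : ∀ {w y} → y < len w → _⊆ʷ_ α n (word y (at w)) w × ¬ _⊆ʷ_ α n w (word y (at w))
        prefix⊏ {w} {y} y<w = ⊏⁻ {word y (at w)} {w} y<w (λ z → word-at)

      sentence⁺ : ∀ φ → T ⊨ sentence φ → ∃ λ w → HasShape (α ↑ len w) es m × Landmark w ×
                  orderStructure (α ↓ len w) ⊨ φ
      sentence⁺ φ (w , (rest , least-rest) , cof , disc , tr) = w ,
        hasShapeᶠ⁺ (α ↑ len w) es m (proj₂ (restᶠ-correct ρ zero) rest) ,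
        record
          { minimal  = λ y y<w shape → least-rest (word y (at w) , prefix⊏ y<w ,
              proj₁ (restᶠ-correct (word y (at w) ∷ᵛ ρ) zero) (hasShapeᶠ⁻ (α ↑ y) es m shape))
          ; cofinal  = λ y y<w → dne λ ¬z → cof (word y (at w) , prefix⊏ y<w , λ (z , v⊆z , c) →
              let z<w , i₁≡ , _ = child⁺ c in ¬z (len z , proj₁ (⊆⁺ v⊆z) , z<w , i₁≡))
          ; discrete = λ y y<w (v , v<y) → dne λ ¬z → disc (word y (at w) , prefix⊏ y<w ,
              (word v (at w) , ⊏⁻ {word v (at w)} {word y (at w)} v<y
                (λ z z<v → trans (word-at z<v) (sym (word-at (<-trans z<v v<y))))) ,
              λ (z , z⊏y , ¬u) → let z<y , z-agree = ⊏⁺ z⊏y in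
                ¬z (len z , z<y , λ u z<u u<y i₁≡ → ¬u (word u (at w) ,
                  ⊏⁻ {z} {word u (at w)} z<u (λ x x<z →
                    trans (z-agree x x<z) (trans (word-at (<-trans x<z z<y)) (sym (word-at (<-trans x<z z<u))))) ,
                  ⊏⁻ {word u (at w)} {word y (at w)} u<y (λ x x<u → trans (word-at x<u) (sym (word-at (<-trans x<u u<y)))) ,
                  child⁻ {i₁} {word u (at w)} {w} (<-trans u<y y<w) i₁≡ (λ x → word-at))))
          } ,
        proj₂ (prefix-correct (α ↓ len w) value id w (below α) (λ z z<w → (z , [ z<w ]) , refl) φ ρ zero refl) tr
        where
        ρ : Vector (Word α n) 1
        ρ = w ∷ᵛ λ ()

      sentence⁻ : ∀ φ w → HasShape (α ↑ len w) es m → Landmark w →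
                  Sat T (w ∷ᵛ λ ()) (Translate.translate prefixᶠ φ (λ ()) zero) → T ⊨ sentence φ
      sentence⁻ φ w shape lm sat = w ,
        (proj₁ (restᶠ-correct ρ zero) (hasShapeᶠ⁻ (α ↑ len w) es m shape) ,
         λ (v , v⊏w , rest) → minimal lm (len v) (proj₁ (⊏⁺ v⊏w))
           (hasShapeᶠ⁺ (α ↑ len v) es m (proj₂ (restᶠ-correct (v ∷ᵛ ρ) zero) rest))) ,
        (λ (v , v⊏w , ¬z) → let v<w , agree = ⊏⁺ v⊏w ; z , v≤z , z<w , i₁≡ = cofinal lm (len v) v<w in
           ¬z (word z (at w) ,
               ⊆⁻ {v} {word z (at w)} v≤z (λ x x<v → trans (agree x x<v) (sym (word-at (<-≤-trans x<v v≤z)))) ,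
               child⁻ {i₁} {word z (at w)} {w} z<w i₁≡ (λ x → word-at))) ,
        (λ (y , y⊏w , (v , v⊏y) , ¬z) →
           let y<w , agree = ⊏⁺ y⊏w ; z , z<y , none = discrete lm (len y) y<w (len v , proj₁ (⊏⁺ v⊏y)) in
           ¬z (word z (at w) ,
               ⊏⁻ {word z (at w)} {y} z<y (λ x x<z → trans (word-at x<z) (sym (agree x (<-trans x<z z<y)))) ,
               λ (u , z⊏u , u⊏y , c) → none (len u) (proj₁ (⊏⁺ z⊏u)) (proj₁ (⊏⁺ u⊏y)) (proj₁ (proj₂ (child⁺ c))))) ,
        sat
        where
        ρ : Vector (Word α n) 1
        ρ = w ∷ᵛ λ ()

      -- Each sentence φ produces a witness of its own; equality of lengths makes a single α₀ serve
      -- for all of them.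
      landmark-length : ∀ {v w} → HasShape (α ↑ len v) es m → HasShape (α ↑ len w) es m → Landmark v → Landmark w →
                        len v ≡ len w
      landmark-length {v} {w} sv sw lv lw with compare (len v) (len w)
      ... | tri< v<w _ _ = ⊥-elim (minimal lw (len v) v<w sv)
      ... | tri≈ _ e _   = e
      ... | tri> _ _ w<v = ⊥-elim (minimal lv (len w) w<v sw)

      -- An increasing sequence of letters i₁ cannot have a supremum inside w.
      landmark-cofinal : ∀ {w} → Landmark w → (∀ y → y < len w → ∃ λ z → y < z × z < len w) → Positive (α ↓ len w) →
                         ∃ (IsCofinal ω (α ↓ len w))
      landmark-cofinal {w} lm no-max (y₀ , p₀) = (λ i → f i , [ proj₁ (proj₂ (f′ i)) ]) ,
        λ (y , [ q ]) → dne λ ¬i → unbounded (y , below α (y , [ q ]) , λ i fi≮y → ¬i (i , fi≮y))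
        where
        Marked : Set a
        Marked = ∃ λ z → z < len w × at w z ≡ i₁
        beyond : ∀ y → y < len w → ∃ λ ((z , _) : Marked) → y < z
        beyond y y<w = let y′ , y<y′ , y′<w = no-max y y<w ; z , y′≤z , z<w , e = cofinal lm y′ y′<w in
          (z , z<w , e) , <-≤-trans y<y′ y′≤z
        f′ : ℕ → Marked
        f′ zero    = proj₁ (beyond y₀ (below α (y₀ , p₀)))
        f′ (suc i) = proj₁ (beyond (proj₁ (f′ i)) (proj₁ (proj₂ (f′ i))))
        f : ℕ → Carrier α
        f i = proj₁ (f′ i)
        f-strict : ∀ i → f i < f (suc i)
        f-strict i = proj₂ (beyond (f i) (proj₁ (proj₂ (f′ i))))
        unbounded : ¬ (∃ λ y → y < len w × (∀ i → ¬ ¬ f i < y))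
        unbounded (y , y<w , f<y) =
          let s , s≤y , ub , lub = supremum α f y (λ i → <⇒≤ (dne (f<y i)))
              f<s = λ i → <-≤-trans (f-strict i) (ub (suc i))
              z , z<s , none = discrete lm s (≤-<-trans s≤y y<w) (f 0 , f<s 0)
              i , z<fi = lub z z<s
          in none (f i) z<fi (f<s i) (proj₂ (proj₂ (f′ i)))

  decompose : (α : Ordinal a) (θ : Ordinal ℓ) (l : Carrier α) → (α ↑ l) ≅ θ → α ≅ (α ↓ l) +ₒ θ
  decompose α θ l e = ≅-sym {α = (α ↓ l) +ₒ θ} {β = α} (surjective⇒≅ ((α ↓ l) +ₒ θ) α h (λ {x} {y} → mono′ x y) onto)
    where
    open Order α
    open Iso (α ↑ l) θ e
    h : Carrier ((α ↓ l) +ₒ θ) → Carrier α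
    h (inj₁ x) = value x
    h (inj₂ z) = value (back z)
    mono′ : ∀ x y → Ordinal._<_ ((α ↓ l) +ₒ θ) x y → h x < h y
    mono′ (inj₁ x) (inj₁ y) (₁∼₁ x<y) = x<y
    mono′ (inj₂ x) (inj₂ y) (₂∼₂ x<y) = back-mono x<y
    mono′ (inj₁ x) (inj₂ y) ₁∼₂       = <-≤-trans (below α x) (above α (back y))
    onto : ∀ y → ∃ λ x → h x ≡ y
    onto y with <⊎≥ y l
    ... | inj₁ y<l = inj₁ (y , [ y<l ]) , refl
    ... | inj₂ l≤y = inj₂ (proj₁ e (y , [ l≤y ])) , cong value (back-to (y , [ l≤y ]))

  module _ (i₀ i₁ : Fin n) (i₀≢i₁ : ¬ i₀ ≡ i₁) (θ : Ordinal ℓ) (θ-lim : IsLimit θ) (θ⁺ : Positive θ)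
           (c : CNF) (θ≅ : θ ≅ ω^ω ↓ c) where
    private
      Λ = ω^ω +ₒ θ
      Λ-lim = +ₒ-isLimit ω^ω θ ω^ω-isLimit θ-lim
      ω^ω⁺ : Positive ω^ω
      ω^ω⁺ = c

      es : List ℕ
      es = proj₁ (has-shape θ θ-lim θ⁺ c θ≅)
      m : ℕ
      m = proj₁ (proj₂ (has-shape θ θ-lim θ⁺ c θ≅))
      θ-shape : HasShape θ es m
      θ-shape = proj₂ (proj₂ (has-shape θ θ-lim θ⁺ c θ≅))

      open Sentences i₀ i₁ es m

      Λ-bottom : ∀ z → Order._≤_ Λ (inj₁ (proj₁ (bottom ω^ω c))) z
      Λ-bottom (inj₁ z) (₁∼₁ z<) = proj₂ (bottom ω^ω c) z z<

      t₀ : Carrier θ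
      t₀ = proj₁ (bottom θ θ⁺)

      -- Marks the powers of ω in the first summand. They are cofinal in ω^ω and, by
      -- `singles-discrete`, have no limit point in it.
      mark : Carrier Λ → Fin n
      mark (inj₁ x) with em {P = Single x}
      ... | yes _ = i₁
      ... | no _  = i₀
      mark (inj₂ _) = i₀

      mark-single : ∀ x → Single x → mark (inj₁ x) ≡ i₁
      mark-single x s with em {P = Single x}
      ... | yes _ = refl
      ... | no ¬s = ⊥-elim (¬s s)

      single-mark : ∀ x → mark (inj₁ x) ≡ i₁ → Single x
      single-mark x e with em {P = Single x}
      ... | yes s = s
      ... | no _  = ⊥-elim (i₀≢i₁ e)

      module Sem = Semantics Λ Λ-lim i₀ Λ-bottom

      w₀ : Word Λ n
      w₀ = Sem.word (inj₂ t₀) mark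

      θ≅rest : (Λ ↑ inj₂ t₀) ≅ θ
      θ≅rest = ≅-sym {α = θ} {β = Λ ↑ inj₂ t₀} (surjective⇒≅ θ (Λ ↑ inj₂ t₀)
        (λ z → inj₂ z , [ (λ { (₂∼₂ z<t₀) → proj₂ (bottom θ θ⁺) z z<t₀ }) ]) ₂∼₂
        λ { (inj₁ x , [ p ]) → ⊥-elim-irr (p ₁∼₂) ; (inj₂ z , _) → z , refl })

      -- Otherwise ω^ω would embed into a proper initial segment of itself.
      front-minimal : ∀ y → ¬ HasShape (Λ ↑ inj₁ y) es m
      front-minimal y shape = mono-≥ ω^ω j (λ {u} {v} → j-mono {u} {v}) c (bound-c (proj₁ θ≅ (g (up c))))
        where
        h = proj₁ (embed-above y)
        up : Carrier ω^ω → Carrier (Λ ↑ inj₁ y)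
        up x = inj₁ (h x) , [ (λ { (₁∼₁ hx<y) → Order.<⇒≤ ω^ω {y} {h x} (proj₂ (proj₂ (embed-above y)) x) hx<y }) ]
        iso : (Λ ↑ inj₁ y) ≅ θ
        iso = shape-unique (Λ ↑ inj₁ y) θ {es} {m} shape θ-shape
        g = proj₁ iso
        j : Carrier ω^ω → Carrier ω^ω
        j x = value (proj₁ θ≅ (g (up x)))
        j-mono : ∀ {u v} → Ordinal._<_ ω^ω u v → Ordinal._<_ ω^ω (j u) (j v)
        j-mono {u} {v} u<v = Iso.mono θ (ω^ω ↓ c) θ≅ (Iso.mono (Λ ↑ inj₁ y) θ iso
          (₁∼₁ (proj₁ (proj₂ (embed-above y)) {u} {v} u<v)))
        bound-c : ∀ x → Ordinal._<_ ω^ω (value x) c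
        bound-c = below ω^ω {c}

      landmark₀ : Landmark Λ Λ-lim Λ-bottom w₀
      landmark₀ = record
        { minimal  = λ { (inj₁ y) _ → front-minimal y
                       ; (inj₂ z) (₂∼₂ z<t₀) → ⊥-elim (proj₂ (bottom θ θ⁺) z z<t₀) }
        ; cofinal  = λ { (inj₁ y) _ → let i , i≮y = ω^ω-unbounded y in
                           inj₁ (single i) , (λ { (₁∼₁ i<y) → i≮y i<y }) , ₁∼₂ ,
                           trans (Sem.word-at {inj₂ t₀} {mark} {inj₁ (single i)} ₁∼₂) (mark-single (single i) (i , refl))
                       ; (inj₂ z) (₂∼₂ z<t₀) → ⊥-elim (proj₂ (bottom θ θ⁺) z z<t₀) }
        ; discrete = λ { (inj₁ y) _ (inj₁ v , ₁∼₁ v<y) → let z , z<y , none = singles-discrete y (v , v<y) in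
                           inj₁ z , ₁∼₁ z<y , λ { (inj₁ u) (₁∼₁ z<u) (₁∼₁ u<y) e →
                             none u z<u u<y (single-mark u (trans (sym (Sem.word-at {inj₂ t₀} {mark} {inj₁ u} ₁∼₂)) e)) }
                       ; (inj₂ z) (₂∼₂ z<t₀) _ → ⊥-elim (proj₂ (bottom θ θ⁺) z z<t₀) }
        }

      rest₀ : HasShape (Λ ↑ inj₂ t₀) es m
      rest₀ = shape-≅ θ (Λ ↑ inj₂ t₀) (≅-sym {α = Λ ↑ inj₂ t₀} {β = θ} θ≅rest) {es} {m} θ-shape

      true-sentence : ∀ φ → orderStructure ω^ω ⊨ φ → 𝔗 Λ n Λ-lim ⊨ sentence φ
      true-sentence φ sat = sentence⁻ Λ Λ-lim Λ-bottom φ w₀ rest₀ landmark₀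
        (proj₁ (Sem.prefix-correct ω^ω inj₁ ₁∼₁ w₀ (λ _ → ₁∼₂)
          (λ { (inj₁ x) _ → x , refl ; (inj₂ z) (₂∼₂ z<t₀) → ⊥-elim (proj₂ (bottom θ θ⁺) z z<t₀) })
          φ (w₀ ∷ᵛ λ ()) zero refl) sat)

    module _ (α : Ordinal a) (α-lim : IsLimit α) (α⁺ : Positive α) where

      Splits : Set (lsuc a ⊔ ℓ)
      Splits = Σ[ α₀ ∈ Ordinal a ]
        (α ≅ α₀ +ₒ θ × orderStructure α₀ ≡ₑ orderStructure ω^ω × HasCofinality α₀ ω)

      spacious : ∀ {α₀ : Ordinal a} → orderStructure α₀ ≡ₑ orderStructure ω^ω → Spacious α₀
      spacious {α₀} e = spaciousᶠ⁺ α₀ λ m → Equivalence.from (e (spaciousᶠ m)) (spaciousᶠ⁻ ω^ω ω^ω-spacious m)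

      equivalent⇒splits : 𝔗 α n α-lim ≡ₑ 𝔗 Λ n Λ-lim → Splits
      equivalent⇒splits equiv = α₀ , decompose α θ l (shape-unique (α ↑ l) θ {es} {m} rest θ-shape) , α₀≡ ,
        landmark-cofinal α α-lim x₀≤ {w} lm no-max α₀⁺ , λ β → ω-least α₀ α₀⁺ bigger β
        where
        open Order α
        x₀≤ : ∀ z → proj₁ (bottom α α⁺) ≤ z
        x₀≤ = proj₂ (bottom α α⁺)
        witness : ∀ φ → orderStructure ω^ω ⊨ φ → ∃ λ (w : Word α n) → HasShape (α ↑ proj₁ w) es m ×
                  Landmark α α-lim x₀≤ w × orderStructure (α ↓ proj₁ w) ⊨ φ
        witness φ sat = sentence⁺ α α-lim x₀≤ φ (Equivalence.from (equiv (sentence φ)) (true-sentence φ sat))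
        nonempty : ∃ λ (w : Word α n) → HasShape (α ↑ proj₁ w) es m ×
                   Landmark α α-lim x₀≤ w × orderStructure (α ↓ proj₁ w) ⊨ nonemptyᶠ
        -- Any true sentence would fix a node; this one also provides a point of α₀.
        nonempty = witness nonemptyᶠ (ω^ω⁺ , refl)
        w : Word α n
        w = proj₁ nonempty
        rest : HasShape (α ↑ proj₁ w) es m
        rest = proj₁ (proj₂ nonempty)
        lm : Landmark α α-lim x₀≤ w
        lm = proj₁ (proj₂ (proj₂ nonempty))
        l : Carrier α
        l = proj₁ w
        α₀ : Ordinal a
        α₀ = α ↓ l
        α₀⁺ : Positive α₀
        α₀⁺ = proj₁ (proj₂ (proj₂ (proj₂ nonempty)))
        true : ∀ φ → orderStructure ω^ω ⊨ φ → orderStructure α₀ ⊨ φ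
        true φ sat = let v , shape , lm′ , sat′ = witness φ sat in
          subst (λ l → orderStructure (α ↓ l) ⊨ φ)
            (landmark-length α α-lim x₀≤ {v} {w} shape rest lm′ lm) sat′
        α₀≡ : orderStructure α₀ ≡ₑ orderStructure ω^ω
        -- Transfer from ω^ω to α₀ gives the converse when applied to the negation.
        α₀≡ φ = mk⇔ (λ sat → dne λ ¬sat → true (not φ) ¬sat sat) (true φ)
        bigger : ∀ x → ∃ λ y → Ordinal._<_ α₀ x y
        bigger x = let y , add = spacious {α₀} α₀≡ 0 x in y , Add⇒< α₀ 0 {x} {y} add
        no-max : ∀ y → y < l → ∃ λ z → y < z × z < l
        no-max y y<l = let z , y<z = bigger (y , [ y<l ]) in value z , y<z , below α z

      splits⇒equivalent : Splits → 𝔗 α n α-lim ≡ₑ 𝔗 Λ n Λ-lim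
      splits⇒equivalent (α₀ , α≅ , α₀≡ , (f , cof) , _) =
        ≡ₑ-trans {M = 𝔗 α n α-lim} {N = 𝔗 (α₀ +ₒ θ) n (+ₒ-isLimit α₀ θ α₀-lim θ-lim)} {O = 𝔗 Λ n Λ-lim}
          (≅⇒≡ₑ i₀ α≅ α-lim _ α⁺)
          (sum-≡ₑ α₀ ω^ω θ α₀-lim ω^ω-isLimit θ-lim i₀ α₀⁺ ω^ω⁺ room ω^ω-spacious {f} cof {single} ω^ω-unbounded)
        where
        room : Spacious α₀
        room = spacious {α₀} α₀≡
        α₀-lim : IsLimit α₀
        -- For exponent 0 the relation `Add` is the successor relation.
        α₀-lim = room 0
        α₀⁺ : Positive α₀
        α₀⁺ = proj₁ (Equivalence.from (α₀≡ nonemptyᶠ) (ω^ω⁺ , refl))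

open import Data.Nat using (_≤_)

theorem22 : (∀ {ℓ : Level} → ExcludedMiddle ℓ) →
    ∀ {a t : Level} (n : ℕ) → 2 ≤ n →
    (θ : Ordinal t) (θ-limit : IsLimit θ) → Positive θ → θ <ₒ ω^ω →
    (α : Ordinal a) (α-limit : IsLimit α) → Positive α →
    𝔗 α n α-limit ≡ₑ 𝔗 (ω^ω +ₒ θ) n (+ₒ-isLimit ω^ω θ ω^ω-isLimit θ-limit)
    ⇔ (Σ[ α₀ ∈ Ordinal a ]
    (α ≅ α₀ +ₒ θ × orderStructure α₀ ≡ₑ orderStructure ω^ω × HasCofinality α₀ ω))
theorem22 em n (s≤s (s≤s _)) θ θ-limit θ⁺ (c , θ≅) α α-limit α⁺ = mk⇔
  (Main.equivalent⇒splits em n zero (suc zero) (λ ()) θ θ-limit θ⁺ c θ≅ α α-limit α⁺)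
  (Main.splits⇒equivalent em n zero (suc zero) (λ ()) θ θ-limit θ⁺ c θ≅ α α-limit α⁺)
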